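{- Let $\mathscr C$ be a class of graphs of shrubdepth at most $d$, where $d>1$. Then there exist a hereditary graph class $\mathscr C'$ of shrubdepth at most $d-1$, first-order formulas $\varphi(\bar x;\bar y)$ and $\lambda(\bar x;\bar y)$ (with $|\bar x|=2$) that are finitary on $\mathscr C$ and each define a partition, and an integer $\ell\in\mathbb N$, such that for every graph $G\in\mathscr C$ there exists $\bar s\in G^{\bar y}$ with: (1) $(\varphi(G^{\bar x};\bar s),\lambda(G^{\bar x};\bar s))$ is a dicing of $G$ of order at most $\ell$; and (2) for every part $A$ of $\varphi(G^{\bar x};\bar s)$, we have $G[A]\in\mathscr C'$.
   Context: Graphs are finite simple undirected graphs viewed as structures with one binary edge relation. A connection model for $G$ consists of a finite set $\mathsf{Labels}$, a labelling $\mathsf{label}\colon V(G)\to\mathsf{Labels}$, a rooted tree $T$ whose leaf set is $V(G)$, and for every non-leaf node $x$ of $T$ a symmetric relation $\mathsf{Adj}(x)\subseteq\mathsf{Labels}\times\mathsf{Labels}$, such that distinct $u,v$ are adjacent iff $(\mathsf{label}(u),\mathsf{label}(v))\in\mathsf{Adj}(x)$, $x$ the lowest common ancestor of $u,v$. Its depth is the depth of $T$ (the maximum number of nodes on a root-to-leaf path; so shrubdepth $1$ corresponds to graphs with at most one vertex). A graph class has shrubdepth at most $d$ if there is a finite label set such that every member has a connection model of depth at most $d$ using it. A class is hereditary if closed under induced subgraphs. For a formula $\varphi(\bar x;\bar y)$ and $\bar b\in G^{\bar y}$, $\varphi(G^{\bar x};\bar b)=\{\bar a\in G^{\bar x}:G\models\varphi(\bar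 a;\bar b)\}$. A formula $\varphi(\bar x;\bar y)$ with $|\bar x|=2$ defines a partition if for every graph $G$ and every $\bar b\in G^{\bar y}$, $\varphi(G^{\bar x};\bar b)$ is an equivalence relation on $V(G)$ (identified with the partition into its classes). A formula is finitary on $\mathscr C$ if there is $k$ such that for all $G\in\mathscr C$, $|\{\varphi(G^{\bar x};\bar b):\bar b\in G^{\bar y}\}|\le k$. A pair $(\mathcal P,\mathcal L)$ of partitions of $V(G)$ is a dicing of $G$ if there is a symmetric relation $Z\subseteq\mathcal L\times\mathcal L$ such that for all $u,v$ in different parts of $\mathcal P$, $u,v$ are adjacent iff $(\mathcal L(u),\mathcal L(v))\in Z$, where $\mathcal L(w)$ is the part of $\mathcal L$ containing $w$; its order is $|\mathcal L|$. -}

module Defs where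

open import Data.Nat using (ℕ; zero; suc; _≤_; _<_; _∸_)
open import Data.Fin using (Fin; zero; suc; _≟_)
open import Data.Bool using (Bool; true; false; _∨_; _∧_; not; if_then_else_)
open import Data.List using (List; []; _∷_; _++_; allFin)
open import Data.List.Relation.Binary.Permutation.Propositional using (_↭_)
open import Data.Product using (Σ; ∃; _×_; _,_)
open import Relation.Binary.PropositionalEquality using (_≡_; _≢_)
open import Relation.Binary.Structures using (IsEquivalence)
open import Relation.Nullary.Decidable using (⌊_⌋)
open import Function.Definitions using (Injective)

record Graph : Set where
  field
    size   : ℕ
    E      : Fin size → Fin size → Bool
    E-sym  : ∀ u v → E u v ≡ E v u
    E-irr  : ∀ v → E v v ≡ false
open Graph public

V : Graph → Set
V G = Fin (size G)

GraphClass : Set₁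
GraphClass = Graph → Set

-- The graph induced (pulled back) along a map f : Fin m → V G.
-- For injective f this is the induced subgraph on the image of f
-- (with vertices renamed along f).
pull : (G : Graph) {m : ℕ} (f : Fin m → V G) → Graph
pull G {m} f = record
  { size = m
  ; E = λ i j → if ⌊ i ≟ j ⌋ then false else E G (f i) (f j)
  ; E-sym = sym'
  ; E-irr = irr }
  where
  open import Relation.Binary.PropositionalEquality using (refl; trans; cong)
  open import Relation.Nullary using (yes; no)
  sym' : ∀ i j → (if ⌊ i ≟ j ⌋ then false else E G (f i) (f j))
               ≡ (if ⌊ j ≟ i ⌋ then false else E G (f j) (f i))
  sym' i j with i ≟ j | j ≟ i
  ... | yes _ | yes _ = refl
  ... | yes refl | no ¬p = Data.Empty.⊥-elim (¬p refl) where import Data.Empty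
  ... | no ¬p | yes refl = Data.Empty.⊥-elim (¬p refl) where import Data.Empty
  ... | no _ | no _ = E-sym G (f i) (f j)
  irr : ∀ i → (if ⌊ i ≟ i ⌋ then false else E G (f i) (f i)) ≡ false
  irr i with i ≟ i
  ... | yes _ = refl
  ... | no ¬p = Data.Empty.⊥-elim (¬p refl) where import Data.Empty

Hereditary : GraphClass → Set
Hereditary C = ∀ (G : Graph) {m : ℕ} (f : Fin m → V G) →
  Injective _≡_ _≡_ f → C G → C (pull G f)

-- Rooted trees of depth at most d (depth = number of nodes on a
-- longest root-to-leaf path) whose leaves are decorated by vertices
-- (elements of Fin n), and whose inner nodes carry a symmetric relation
-- Adj(x) on the label set Fin L.
data CTree (L n : ℕ) : ℕ → Set where
  leaf : ∀ {d} → Fin n → CTree L n (suc d)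
  node : ∀ {d} (Adj : Fin L → Fin L → Bool) →
         (∀ a b → Adj a b ≡ Adj b a) →
         List (CTree L n d) → CTree L n (suc d)

mutual
  leaves : ∀ {L n d} → CTree L n d → List (Fin n)
  leaves (leaf v) = v ∷ []
  leaves (node _ _ ts) = leavesL ts

  leavesL : ∀ {L n d} → List (CTree L n d) → List (Fin n)
  leavesL [] = []
  leavesL (t ∷ ts) = leaves t ++ leavesL ts

mutual
  mem : ∀ {L n d} → Fin n → CTree L n d → Bool
  mem v (leaf w) = ⌊ v ≟ w ⌋
  mem v (node _ _ ts) = memL v ts

  memL : ∀ {L n d} → Fin n → List (CTree L n d) → Bool
  memL v [] = false
  memL v (t ∷ ts) = mem v t ∨ memL v ts

-- adjacency prescribed by the model: descend while u and v lie in a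
-- common child; at the lowest common ancestor x use Adj(x).
mutual
  modelAdj : ∀ {L n d} → (Fin n → Fin L) → CTree L n d → Fin n → Fin n → Bool
  modelAdj lab (leaf _) u v = false
  modelAdj lab (node A _ ts) u v = modelAdjL lab A ts u v

  modelAdjL : ∀ {L n d} → (Fin n → Fin L) → (Fin L → Fin L → Bool) →
              List (CTree L n d) → Fin n → Fin n → Bool
  modelAdjL lab A [] u v = A (lab u) (lab v)
  modelAdjL lab A (t ∷ ts) u v =
    if mem u t ∧ mem v t then modelAdj lab t u v else modelAdjL lab A ts u v

record ConnectionModel (L d : ℕ) (G : Graph) : Set where
  field
    label  : V G → Fin L
    tree   : CTree L (size G) d
    leafset : leaves tree ↭ allFin (size G)
    correct : ∀ u v → u ≢ v → E G u v ≡ modelAdj label tree u v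

ShrubDepth≤ : ℕ → GraphClass → Set
ShrubDepth≤ d C = Σ ℕ λ L → ∀ G → C G → ConnectionModel L d G

data Formula : ℕ → Set where
  edge  : ∀ {k} → Fin k → Fin k → Formula k
  equal : ∀ {k} → Fin k → Fin k → Formula k
  ff    : ∀ {k} → Formula k
  neg   : ∀ {k} → Formula k → Formula k
  conj  : ∀ {k} → Formula k → Formula k → Formula k
  disj  : ∀ {k} → Formula k → Formula k → Formula k
  exi   : ∀ {k} → Formula (suc k) → Formula k
  all   : ∀ {k} → Formula (suc k) → Formula k

anyF : ∀ n → (Fin n → Bool) → Bool
anyF zero f = false
anyF (suc n) f = f zero ∨ anyF n (λ i → f (suc i))

allF : ∀ n → (Fin n → Bool) → Bool
allF zero f = true
allF (suc n) f = f zero ∧ allF n (λ i → f (suc i))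

extend : ∀ {k} {A : Set} → A → (Fin k → A) → Fin (suc k) → A
extend a ρ zero = a
extend a ρ (suc i) = ρ i

eval : (G : Graph) → ∀ {k} → Formula k → (Fin k → V G) → Bool
eval G (edge i j) ρ = E G (ρ i) (ρ j)
eval G (equal i j) ρ = ⌊ ρ i ≟ ρ j ⌋
eval G ff ρ = false
eval G (neg φ) ρ = not (eval G φ ρ)
eval G (conj φ ψ) ρ = eval G φ ρ ∧ eval G ψ ρ
eval G (disj φ ψ) ρ = eval G φ ρ ∨ eval G ψ ρ
eval G (exi φ) ρ = anyF (size G) (λ a → eval G φ (extend a ρ))
eval G (all φ) ρ = allF (size G) (λ a → eval G φ (extend a ρ))

-- A formula φ(x̄; ȳ) with |x̄| = 2, |ȳ| = m: free variables 0,1 are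
-- x₁,x₂ and 2+i is y_i.
Formula₂ : ℕ → Set
Formula₂ m = Formula (suc (suc m))

defRel : ∀ {m} → Formula₂ m → (G : Graph) → (Fin m → V G) → V G → V G → Bool
defRel φ G b u v = eval G φ (extend u (extend v b))

DefinesPartition : ∀ {m} → Formula₂ m → Set
DefinesPartition φ = ∀ (G : Graph) (b : Fin _ → V G) →
  IsEquivalence (λ u v → defRel φ G b u v ≡ true)

SameDef : ∀ {m} → Formula₂ m → (G : Graph) → (b b' : Fin m → V G) → Set
SameDef φ G b b' = ∀ u v → defRel φ G b u v ≡ defRel φ G b' u v

-- finitary on C: for some k, among any k+1 parameter tuples two define
-- the same set (i.e. at most k distinct defined sets)
Finitary : ∀ {m} → Formula₂ m → GraphClass → Set
Finitary {m} φ C = Σ ℕ λ k → ∀ (G : Graph) → C G →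
  ∀ (bs : Fin (suc k) → (Fin m → V G)) →
  ∃ λ i → ∃ λ j → i ≢ j × SameDef φ G (bs i) (bs j)

-- Dicings (partitions given as Boolean equivalence relations on V G)

-- (P, L) is a dicing: there is a symmetric relation Z on the parts of L
-- (a vertex relation invariant under L) governing adjacency between
-- vertices in distinct parts of P.
IsDicing : (G : Graph) → (P L : V G → V G → Bool) → Set
IsDicing G P L = Σ (V G → V G → Bool) λ Z →
  (∀ u v → Z u v ≡ Z v u) ×
  (∀ u u' v v' → L u u' ≡ true → L v v' ≡ true → Z u v ≡ Z u' v') ×
  (∀ u v → P u v ≡ false → E G u v ≡ Z u v)

PartsAtMost : (G : Graph) → (V G → V G → Bool) → ℕ → Set
PartsAtMost G L ℓ = ∀ (ws : Fin (suc ℓ) → V G) →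
  ∃ λ i → ∃ λ j → i ≢ j × L (ws i) (ws j) ≡ true

EnumeratesPart : (G : Graph) → (V G → V G → Bool) → V G →
                 ∀ {m} → (Fin m → V G) → Set
EnumeratesPart G P u f = ∀ w → (P u w ≡ true → ∃ λ i → f i ≡ w)
                              × (∀ i → P u (f i) ≡ true)

{-# OPTIONS --safe #-}
-- A graph with a connection model of depth suc d becomes a disjoint union of graphs of depth d after a
-- flip, i.e. after complementing the adjacency between some types of vertices, where the type of v records
-- its adjacency to boundedly many parameters: sample every label in three children of the root, or in all
-- children where it occurs, and merge the sampled children. Components of the flip are first-order
-- definable since their diameter is bounded, and so is, by recursion on d, the goodness of the parameters.
--
-- The formulas must not depend on the choice of parameters. If parameter tuples s₁,…,s_c have neighbourhoods
-- forming a sunflower (every vertex deviates from the majority in at most one of them), then the tuple of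
-- majority sets is as good as the s_i: a component of its flip is covered by the components of one vertex in the
-- flips for s₁,…,s_c, which can be merged at the cost of more labels. Sets obtained by iterated majorities
-- correspond to nodes of the connection model; a sunflower moves them towards the root, so the iteration stops
-- after boundedly many rounds, and its last generation is finite of bounded size, having no further sunflowers.
-- The partition φ is the meet of the component partitions over this last generation. The partition λ compares
-- types for the same sets, and is refined by links to those types that meet at most two classes of φ.
-- In depth two, where children cannot be merged, φ is equality and λ is the relation of being twins.
module Submission where

open import Defs
open import Data.Nat as ℕ using (ℕ; zero; suc; _+_; _*_; _^_; _∸_; _≤_; _<_; z≤n; s≤s)
import Data.Nat.Properties as ℕₚ
import Data.Nat.Induction as ℕᵢ
open import Data.Fin as Fin using (Fin; zero; suc; toℕ; fromℕ<; combine; remQuot; quotient; remainder; funToFin; finToFun)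
import Data.Fin.Properties as Finₚ
open import Data.Bool as Bool using (Bool; true; false; _∧_; _∨_; not; if_then_else_)
import Data.Bool.Properties as Boolₚ
open import Data.List as List using (List; []; _∷_; _++_; length; lookup; filter; allFin; tabulate)
import Data.List.Properties as Listₚ
open import Data.List.Membership.Propositional using (_∈_; _∉_)
import Data.List.Membership.Propositional.Properties as ∈ₚ
open import Data.List.Membership.Propositional.Properties.WithK using (unique∧set⇒bag)
open import Data.List.Relation.Unary.Any as Any using (here; there)
import Data.List.Relation.Unary.Any.Properties as Anyₚ
open import Data.List.Relation.Unary.All as All using (All; []; _∷_)
import Data.List.Relation.Unary.All.Properties as Allₚ
open import Data.List.Relation.Unary.AllPairs using (AllPairs; []; _∷_)
import Data.List.Relation.Unary.AllPairs.Properties as AllPairsₚ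
open import Data.List.Relation.Unary.Unique.Propositional using (Unique)
import Data.List.Relation.Unary.Unique.Propositional.Properties as Uniqueₚ
open import Data.List.Relation.Binary.Permutation.Propositional using (_↭_; ↭-sym; ↭⇒↭ₛ)
import Data.List.Relation.Binary.Permutation.Propositional.Properties as ↭ₚ
import Data.List.Relation.Binary.Permutation.Setoid.Properties as ↭ₛₚ
open import Data.List.Relation.Binary.BagAndSetEquality using (∼bag⇒↭)
open import Data.Maybe as Maybe using (Maybe; just; nothing; fromMaybe; maybe)
open import Data.Product using (Σ; ∃; _×_; _,_; proj₁; proj₂)
open import Data.Sum as Sum using (_⊎_; inj₁; inj₂; [_,_]′)
open import Data.Unit using (⊤; tt)
open import Data.Empty using (⊥; ⊥-elim)
open import Function using (_∘_; id; const; case_of_)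
open import Function.Bundles using (_⇔_; mk⇔; Equivalence)
open import Function.Definitions using (Injective)
open import Relation.Nullary using (¬_; Dec; yes; no; contradiction)
open import Relation.Nullary.Decidable using (⌊_⌋; ¬?; _×-dec_; _⊎-dec_; _→-dec_; decidable-stable)
import Relation.Nullary.Decidable as Dec
open import Relation.Binary.Definitions using (DecidableEquality; tri<; tri≈; tri>)
open import Relation.Binary.Structures using (IsEquivalence)
open import Relation.Binary.PropositionalEquality using (_≡_; _≢_; _≗_; refl; sym; trans; cong; cong₂; subst; subst₂; setoid; isEquivalence)

-- No formula can single out one good parameter tuple, and the types over all good tuples together
-- may be unboundedly many; this is why the last generation, whose members define boundedly many
-- sets, replaces them. Using all its members at once creates a second difficulty: two vertices may
-- be separated by one member and linked by another, so different members make predictions about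
-- different pairs of the same types, and these predictions may disagree. Types alone then fail to
-- determine the adjacency between classes of `φ`. A disagreement, however, forces one of the two
-- types to meet at most two classes, and recording the links to two classes costs only boundedly
-- many bits. The number three has two independent origins: of three sampled children one differs
-- from the children of two given vertices, and three petals of a sunflower determine its centre by
-- majority.

-- Searching, choosing and coding in finite sets

first : ∀ {n} → (Fin n → Bool) → Maybe (Fin n)
first {zero} p = nothing
first {suc n} p with p zero
... | true = just zero
... | false = Maybe.map suc (first (p ∘ suc))

first-cong : ∀ {n} {p q : Fin n → Bool} → p ≗ q → first p ≡ first q
first-cong {zero} e = refl
first-cong {suc n} {p} {q} e with p zero | q zero | e zero
... | true | .true | refl = refl
... | false | .false | refl = cong (Maybe.map suc) (first-cong (e ∘ suc))

first-spec : ∀ {n} (p : Fin n → Bool) {i} → p i ≡ true →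
  ∃ λ j → first p ≡ just j × p j ≡ true
first-spec {suc n} p {i} pi with p zero in eq
... | true = zero , refl , eq
first-spec {suc n} p {zero} pi | false = contradiction (trans (sym eq) pi) λ ()
first-spec {suc n} p {suc i} pi | false with first-spec (p ∘ suc) pi
... | j , fj , pj rewrite fj = suc j , refl , pj

first-least : ∀ {n} (p : Fin n → Bool) {i j} → first p ≡ just j → i Fin.< j → p i ≡ false
first-least {suc n} p {i} e i<j with p zero in p₀
first-least {suc n} p refl () | true
... | false with first (p ∘ suc) in eq
first-least {suc n} p {zero} refl i<j | false | just j = p₀
first-least {suc n} p {suc i} refl (s≤s i<j) | false | just j = first-least (p ∘ suc) eq i<j

⌊⌋-⇔ : ∀ {a b} {A : Set a} {B : Set b} (da : Dec A) (db : Dec B) →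
  (A → B) → (B → A) → ⌊ da ⌋ ≡ ⌊ db ⌋
⌊⌋-⇔ (yes a) (yes b) f g = refl
⌊⌋-⇔ (yes a) (no ¬b) f g = contradiction (f a) ¬b
⌊⌋-⇔ (no ¬a) (yes b) f g = contradiction (g b) ¬a
⌊⌋-⇔ (no ¬a) (no ¬b) f g = refl

⌊⌋-true : ∀ {a} {A : Set a} (da : Dec A) → A → ⌊ da ⌋ ≡ true
⌊⌋-true (yes _) _ = refl
⌊⌋-true (no ¬a) a = contradiction a ¬a

true-⌊⌋ : ∀ {a} {A : Set a} (da : Dec A) → ⌊ da ⌋ ≡ true → A
true-⌊⌋ (yes a) _ = a

module Pick {n} {P : Fin n → Set} (P? : ∀ i → Dec (P i)) (default : Fin n) where

  pick : Fin n
  pick = fromMaybe default (first (λ i → ⌊ P? i ⌋))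

  private
    found : ∃ P → ∃ λ i → first (λ i → ⌊ P? i ⌋) ≡ just i × P i
    found (i , p) = let j , fj , pj = first-spec (λ i → ⌊ P? i ⌋) (⌊⌋-true (P? i) p) in j , fj , true-⌊⌋ (P? j) pj

  pick-spec : ∃ P → P pick
  pick-spec w = let j , fj , pj = found w in subst P (sym (cong (fromMaybe default) fj)) pj

  pick-least : ∃ P → ∀ {i} → i Fin.< pick → ¬ P i
  pick-least w {i} lt p = let j , fj , _ = found w in contradiction
    (trans (sym (⌊⌋-true (P? i) p)) (first-least _ fj (subst (i Fin.<_) (cong (fromMaybe default) fj) lt))) λ ()

-- Classes are named by their first member, so that they can serve as values of `child`; related
-- elements get the same name because `first` depends only on the truth values of the predicate.
module Representative {n} (_~_ : Fin n → Fin n → Set) (_~?_ : ∀ u v → Dec (u ~ v))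
  (~-refl : ∀ u → u ~ u) (~-sym : ∀ {u v} → u ~ v → v ~ u)
  (~-trans : ∀ {u v w} → u ~ v → v ~ w → u ~ w) where

  rep : Fin n → Fin n
  rep u = fromMaybe u (first (λ v → ⌊ u ~? v ⌋))

  rep-related : ∀ u → u ~ rep u
  rep-related u with first-spec (λ v → ⌊ u ~? v ⌋) {u} (⌊⌋-true (u ~? u) (~-refl u))
  ... | j , fj , pj rewrite fj = true-⌊⌋ (u ~? j) pj

  rep-≡ : ∀ {u v} → u ~ v → rep u ≡ rep v
  rep-≡ {u} {v} u~v
    with first-spec (λ w → ⌊ u ~? w ⌋) {u} (⌊⌋-true (u ~? u) (~-refl u))
       | first-cong {p = λ w → ⌊ u ~? w ⌋} {q = λ w → ⌊ v ~? w ⌋}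
           (λ w → ⌊⌋-⇔ (u ~? w) (v ~? w) (~-trans (~-sym u~v)) (~-trans u~v))
  ... | j , fj , pj | e rewrite sym e | fj = refl

  rep-≡⁻ : ∀ {u v} → rep u ≡ rep v → u ~ v
  rep-≡⁻ {u} {v} e = ~-trans (rep-related u) (subst (_~ v) (sym e) (~-sym (rep-related v)))

-- An entry is `true` when some realised pair with these types has value `true`; entries of types
-- that no pair realises become `false`.
matrix : ∀ {n a b} (S : Fin n → Fin n → Set) → (∀ u v → Dec (S u v)) →
  (f : Fin n → Fin a) (g : Fin n → Fin b) (val : Fin n → Fin n → Bool) →
  (∀ {u v u' v'} → S u v → S u' v' → f u ≡ f u' → g v ≡ g v' → val u v ≡ val u' v') →
  Σ (Fin a → Fin b → Bool) λ A → ∀ {u v} → S u v → val u v ≡ A (f u) (g v)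
matrix {n} {a} {b} S S? f g val hom = A , spec
  where
  W : Fin a → Fin b → Set
  W x y = ∃ λ u → ∃ λ v → S u v × f u ≡ x × g v ≡ y × val u v ≡ true
  W? : ∀ x y → Dec (W x y)
  W? x y = Finₚ.any? λ u → Finₚ.any? λ v →
    S? u v ×-dec (f u Fin.≟ x) ×-dec (g v Fin.≟ y) ×-dec (val u v Bool.≟ true)
  A : Fin a → Fin b → Bool
  A x y = ⌊ W? x y ⌋
  spec : ∀ {u v} → S u v → val u v ≡ A (f u) (g v)
  spec {u} {v} s with W? (f u) (g v)
  ... | yes (u' , v' , s' , fe , ge , t) = trans (hom s s' (sym fe) (sym ge)) t
  ... | no ¬w with val u v in eq
  ...   | true = contradiction (u , v , s , refl , refl , eq) ¬w
  ...   | false = refl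

bit : Bool → Fin 2
bit true = suc zero
bit false = zero

unbit : Fin 2 → Bool
unbit zero = false
unbit (suc zero) = true

unbit-bit : ∀ b → unbit (bit b) ≡ b
unbit-bit true = refl
unbit-bit false = refl

-- Boolean m × m matrices are coded by their index z, so that formulas can branch over them.
Codes : ℕ → ℕ
Codes m = 2 ^ (m * m)

abstract
  decode : ∀ {m} → Fin (Codes m) → Fin m → Fin m → Bool
  decode {m} z a b = unbit (finToFun z (combine a b))

  decode-surjective : ∀ {m} (A : Fin m → Fin m → Bool) →
    ∃ λ z → ∀ a b → decode z a b ≡ A a b
  decode-surjective {m} A = funToFin f , spec
    where
    f : Fin (m * m) → Fin 2
    f i = bit (A (quotient m i) (remainder {m} m i))
    spec : ∀ a b → decode (funToFin f) a b ≡ A a b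
    spec a b = trans (cong unbit (Finₚ.finToFun-funToFin f (combine a b)))
      (trans (unbit-bit _) (cong (λ p → A (proj₁ p) (proj₂ p)) (Finₚ.remQuot-combine a b)))

funToFin-injective : ∀ {a b} {f g : Fin a → Fin b} → funToFin f ≡ funToFin g → f ≗ g
funToFin-injective {f = f} {g} e i =
  trans (sym (Finₚ.finToFun-funToFin f i)) (trans (cong (λ z → finToFun z i) e) (Finₚ.finToFun-funToFin g i))

funToFin-cong : ∀ {a b} {f g : Fin a → Fin b} → f ≗ g → funToFin f ≡ funToFin g
funToFin-cong {zero} e = refl
funToFin-cong {suc a} e = cong₂ combine (e zero) (funToFin-cong (e ∘ suc))

-- Functions are searched through their codes; without function extensionality `P` has to respect
-- pointwise equality.
anyFun? : ∀ {a b} {P : (Fin a → Fin b) → Set} → (∀ {f g} → f ≗ g → P f → P g) →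
  (∀ f → Dec (P f)) → Dec (∃ P)
anyFun? ext P? = Dec.map′ (λ (z , p) → finToFun z , p)
  (λ (f , p) → funToFin f , ext (λ i → sym (Finₚ.finToFun-funToFin f i)) p)
  (Finₚ.any? (λ z → P? (finToFun z)))

missing : ∀ {n} (xs : List (Fin n)) → length xs < n → ∃ λ i → i ∉ xs
missing {n} xs lt = decidable-stable (Finₚ.any? λ i → ¬? (i ∈? xs)) λ none →
  let covered : ∀ i → i ∈ xs
      covered i = decidable-stable (i ∈? xs) (λ i∉ → none (i , i∉))
      i , j , i<j , e = Finₚ.pigeonhole lt (λ i → Any.index (covered i))
  in Finₚ.<⇒≢ i<j (trans (Anyₚ.lookup-index (covered i))
       (trans (cong (lookup xs) e) (sym (Anyₚ.lookup-index (covered j)))))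
  where
  _∈?_ : ∀ (i : Fin n) xs → Dec (i ∈ xs)
  i ∈? xs = Any.any? (i Fin.≟_) xs

-- Selecting many equal or many distinct values

Monotone : ∀ {a b} → (Fin a → Fin b) → Set
Monotone ι = ∀ {i j} → i Fin.< j → ι i Fin.< ι j

monotone-injective : ∀ {a b} {ι : Fin a → Fin b} → Monotone ι → ∀ {i j} → i ≢ j → ι i ≢ ι j
monotone-injective mono {i} {j} i≢j e with Finₚ.<-cmp i j
... | tri< i<j _ _ = Finₚ.<⇒≢ (mono i<j) e
... | tri≈ _ i≡j _ = i≢j i≡j
... | tri> _ _ j<i = Finₚ.<⇒≢ (mono j<i) (sym e)

-- The selected indices are increasing because the jumps of a walk are ordered; for sunflowers only
-- their distinctness matters.
Many : ∀ {A : Set} {N} (f : Fin N → A) (c m : ℕ) → Set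
Many {A} {N} f c m =
  (Σ (Fin c → Fin N) λ ι → Monotone ι × (∀ {i j} → i ≢ j → f (ι i) ≢ f (ι j))) ⊎
  (Σ (Fin m → Fin N) λ ι → Monotone ι × ∃ λ a → ∀ i → f (ι i) ≡ a)

module _ {A : Set} (_≟A_ : DecidableEquality A) {N} (f : Fin N → A) where

  private
    lookup-pairs : ∀ {R : Fin N → Fin N → Set} {xs} → AllPairs R xs →
      ∀ i j → i Fin.< j → R (lookup xs i) (lookup xs j)
    lookup-pairs (px ∷ _) zero (suc j) _ = All.lookup px (∈ₚ.∈-lookup j)
    lookup-pairs (_ ∷ ps) (suc i) (suc j) (s≤s i<j) = lookup-pairs ps i j i<j

    fromList : ∀ {R : Fin N → Fin N → Set} (xs : List (Fin N)) {c} → c ≤ length xs →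
      AllPairs R xs → Σ (Fin c → Fin N) λ ι → (∀ {i j} → i Fin.< j → R (ι i) (ι j)) × (∀ i → ι i ∈ xs)
    fromList xs c≤ ps = (λ i → lookup xs (Fin.inject≤ i c≤)) ,
      (λ {i} {j} i<j → lookup-pairs ps _ _
        (subst₂ _<_ (sym (Finₚ.toℕ-inject≤ i c≤)) (sym (Finₚ.toℕ-inject≤ j c≤)) i<j)) ,
      λ i → ∈ₚ.∈-lookup (Fin.inject≤ i c≤)

    both : ∀ {R S : Fin N → Fin N → Set} {xs} → AllPairs R xs → AllPairs S xs →
      AllPairs (λ x y → R x y × S x y) xs
    both [] [] = []
    both (r ∷ rs) (s ∷ ss) = All.zip (r , s) ∷ both rs ss

    split-length : ∀ x (xs : List (Fin N)) →
      length xs ≡ length (filter (λ y → f y ≟A f x) xs) + length (filter (λ y → ¬? (f y ≟A f x)) xs)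
    split-length x [] = refl
    split-length x (y ∷ ys) with f y ≟A f x
    ... | yes _ = cong suc (split-length x ys)
    ... | no _ = trans (cong suc (split-length x ys)) (sym (ℕₚ.+-suc _ _))

    -- Each round either finds m equal values or discards fewer than m elements and keeps one of them.
    search : ∀ c m' (let m = suc m') (xs : List (Fin N)) → AllPairs Fin._<_ xs → c * m ≤ length xs →
      (∃ λ ys → c ≤ length ys × AllPairs Fin._<_ ys × AllPairs (λ i j → f i ≢ f j) ys × (∀ {y} → y ∈ ys → y ∈ xs)) ⊎
      (∃ λ ys → m ≤ length ys × AllPairs Fin._<_ ys × ∃ λ a → ∀ {y} → y ∈ ys → f y ≡ a)
    search zero _ xs ps le = inj₁ ([] , z≤n , [] , [] , λ ())
    search (suc c) m (x ∷ xs) (px ∷ ps) (s≤s le)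
      with suc m ℕ.≤? suc (length (filter (λ y → f y ≟A f x) xs))
    ... | yes le' = inj₂ (x ∷ filter (λ y → f y ≟A f x) xs , le' ,
          Allₚ.filter⁺ (λ y → f y ≟A f x) px ∷ AllPairsₚ.filter⁺ (λ y → f y ≟A f x) ps , f x ,
          λ { (here refl) → refl ; (there y∈) → proj₂ (∈ₚ.∈-filter⁻ (λ y → f y ≟A f x) {xs = xs} y∈) })
    ... | no ¬le' with search c m (filter (λ y → ¬? (f y ≟A f x)) xs)
                         (AllPairsₚ.filter⁺ (λ y → ¬? (f y ≟A f x)) ps)
                         (ℕₚ.+-cancelˡ-≤ m _ _ (ℕₚ.≤-trans le
                           (ℕₚ.≤-trans (ℕₚ.≤-reflexive (split-length x xs))
                             (ℕₚ.+-monoˡ-≤ _ (ℕₚ.<⇒≤ (ℕₚ.≤-pred (ℕₚ.≰⇒> ¬le')))))))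
    ...   | inj₂ r = inj₂ r
    ...   | inj₁ (ys , cy , ms , ds , sub) = inj₁ (x ∷ ys , s≤s cy ,
            All.tabulate (λ y∈ → All.lookup px (proj₁ (∈ₚ.∈-filter⁻ (λ y → ¬? (f y ≟A f x)) {xs = xs} (sub y∈)))) ∷ ms ,
            All.tabulate (λ y∈ e → proj₂ (∈ₚ.∈-filter⁻ (λ y → ¬? (f y ≟A f x)) {xs = xs} (sub y∈)) (sym e)) ∷ ds ,
            λ { (here refl) → here refl ; (there y∈) → there (proj₁ (∈ₚ.∈-filter⁻ (λ y → ¬? (f y ≟A f x)) {xs = xs} (sub y∈))) })


  many : ∀ c m → c * suc m ≤ N → Many f c (suc m)
  many c m le with search c m (allFin N) (AllPairsₚ.tabulate⁺-< id)
                     (subst (c * suc m ≤_) (sym (Listₚ.length-tabulate id)) le)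
  ... | inj₁ (ys , cy , ms , ds , _) =
        let ι , spec , _ = fromList ys cy (both ms ds)
            mono : Monotone ι
            mono i<j = proj₁ (spec i<j)
        in inj₁ (ι , mono , λ {i} {j} i≢j e → distinct (λ {i} {j} → spec {i} {j}) i≢j e)
    where
    distinct : ∀ {c} {ι : Fin c → Fin N} → (∀ {i j} → i Fin.< j → ι i Fin.< ι j × f (ι i) ≢ f (ι j)) →
      ∀ {i j} → i ≢ j → f (ι i) ≢ f (ι j)
    distinct spec {i} {j} i≢j e with Finₚ.<-cmp i j
    ... | tri< i<j _ _ = proj₂ (spec i<j) e
    ... | tri≈ _ i≡j _ = i≢j i≡j
    ... | tri> _ _ j<i = proj₂ (spec j<i) (sym e)
  ... | inj₂ (ys , my , ms , a , eqs) =
        let ι , mono , ι∈ = fromList ys my ms in inj₂ (ι , mono , a , λ i → eqs (ι∈ i))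

mono-equal : ∀ {c N} (f : Fin N → Fin c) m → suc c * suc m ≤ N →
  Σ (Fin (suc m) → Fin N) λ ι → Monotone ι × ∃ λ a → ∀ i → f (ι i) ≡ a
mono-equal {c} f m le with many Fin._≟_ f (suc c) m le
... | inj₂ r = r
... | inj₁ (ι , _ , dist) with Finₚ.pigeonhole ℕₚ.≤-refl (f ∘ ι)
...   | i , j , i<j , e = contradiction e (dist (Finₚ.<⇒≢ i<j))

-- Definability

Pred : Set → Set₁
Pred I = (G : Graph) → (I → V G) → Set

-- A predicate of an assignment of vertices to a context I of variables is definable if it is expressed
-- by formulas uniformly in the placement σ of the context; renaming variables is then composition of placements.
record Def {I : Set} (P : Pred I) : Set where
  field
    fm : ∀ {n} → (I → Fin n) → Formula n
    ok : ∀ {n} (σ : I → Fin n) G (ρ : Fin n → V G) (τ : I → V G) → ρ ∘ σ ≗ τ →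
         eval G (fm σ) ρ ≡ true ⇔ P G τ
open Def

record BDef {I : Set} (b : (G : Graph) → (I → V G) → Bool) : Set where
  field
    bfm : ∀ {n} → (I → Fin n) → Formula n
    bok : ∀ {n} (σ : I → Fin n) G (ρ : Fin n → V G) (τ : I → V G) → ρ ∘ σ ≗ τ →
          eval G (bfm σ) ρ ≡ b G τ
open BDef

anyF-⇔ : ∀ {n} (f : Fin n → Bool) → anyF n f ≡ true ⇔ ∃ λ i → f i ≡ true
anyF-⇔ {zero} f = mk⇔ (λ ()) λ ()
anyF-⇔ {suc n} f with f zero in eq
... | true = mk⇔ (λ _ → zero , eq) (λ _ → refl)
... | false = mk⇔ (λ e → let i , p = Equivalence.to (anyF-⇔ (f ∘ suc)) e in suc i , p)
    λ { (zero , p) → contradiction (trans (sym eq) p) λ ()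
      ; (suc i , p) → Equivalence.from (anyF-⇔ (f ∘ suc)) (i , p) }

∧-⇔ : ∀ {a b} → a ∧ b ≡ true ⇔ (a ≡ true × b ≡ true)
∧-⇔ {true} = mk⇔ (λ e → refl , e) proj₂
∧-⇔ {false} = mk⇔ (λ ()) λ ()

∨-⇔ : ∀ {a b} → a ∨ b ≡ true ⇔ (a ≡ true ⊎ b ≡ true)
∨-⇔ {true} = mk⇔ (λ _ → inj₁ refl) (λ _ → refl)
∨-⇔ {false} = mk⇔ inj₂ λ { (inj₁ ()) ; (inj₂ e) → e }

not-⇔ : ∀ {a} → not a ≡ true ⇔ (¬ a ≡ true)
not-⇔ {true} = mk⇔ (λ ()) (λ n → contradiction refl n)
not-⇔ {false} = mk⇔ (λ _ ()) (λ _ → refl)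

module _ {I : Set} where

  dec : {P : Pred I} → Def P → ∀ G τ → Dec (P G τ)
  dec p G τ = Dec.map (ok p τ G id τ (λ _ → refl)) (eval G (fm p τ) id Bool.≟ true)

  ext : {P : Pred I} → Def P → ∀ G {τ τ'} → τ ≗ τ' → P G τ → P G τ'
  ext p G {τ} {τ'} e pτ = Equivalence.to (ok p τ G id τ' e)
    (Equivalence.from (ok p τ G id τ (λ _ → refl)) pτ)

  d-map : {P Q : Pred I} → (∀ G τ → P G τ ⇔ Q G τ) → Def P → Def Q
  d-map e p .fm = fm p
  d-map e p .ok σ G ρ τ h = mk⇔
    (Equivalence.to (e G τ) ∘ Equivalence.to (ok p σ G ρ τ h))
    (Equivalence.from (ok p σ G ρ τ h) ∘ Equivalence.from (e G τ))

  d-ren : {J : Set} {P : Pred I} (f : I → J) → Def P → Def {J} (λ G τ → P G (τ ∘ f))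
  d-ren f p .fm σ = fm p (σ ∘ f)
  d-ren f p .ok σ G ρ τ h = ok p (σ ∘ f) G ρ (τ ∘ f) (h ∘ f)

  b-edge : (i j : I) → BDef (λ G τ → E G (τ i) (τ j))
  b-edge i j .bfm σ = edge (σ i) (σ j)
  b-edge i j .bok σ G ρ τ h = cong₂ (E G) (h i) (h j)

  b-∧ : ∀ {b c : ∀ G → (I → V G) → Bool} → BDef b → BDef c → BDef (λ G τ → b G τ ∧ c G τ)
  b-∧ p q .bfm σ = conj (bfm p σ) (bfm q σ)
  b-∧ p q .bok σ G ρ τ h = cong₂ _∧_ (bok p σ G ρ τ h) (bok q σ G ρ τ h)

  b-∨ : ∀ {b c : ∀ G → (I → V G) → Bool} → BDef b → BDef c → BDef (λ G τ → b G τ ∨ c G τ)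
  b-∨ p q .bfm σ = disj (bfm p σ) (bfm q σ)
  b-∨ p q .bok σ G ρ τ h = cong₂ _∨_ (bok p σ G ρ τ h) (bok q σ G ρ τ h)

  d-bool : ∀ {b : ∀ G → (I → V G) → Bool} → BDef b → Def (λ G τ → b G τ ≡ true)
  d-bool p .fm = bfm p
  d-bool p .ok σ G ρ τ h rewrite bok p σ G ρ τ h = mk⇔ id id

  d-var : (i j : I) → Def (λ G τ → τ i ≡ τ j)
  d-var i j .fm σ = equal (σ i) (σ j)
  d-var i j .ok σ G ρ τ h rewrite h i | h j = mk⇔ (true-⌊⌋ (τ i Fin.≟ τ j)) (⌊⌋-true (τ i Fin.≟ τ j))

  infixr 6 _d-×_
  infixr 5 _d-⊎_
  infixr 4 _d-→_

  _d-×_ : {P Q : Pred I} → Def P → Def Q → Def (λ G τ → P G τ × Q G τ)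
  (p d-× q) .fm σ = conj (fm p σ) (fm q σ)
  (p d-× q) .ok σ G ρ τ h = mk⇔
    (λ e → let a , b = Equivalence.to ∧-⇔ e in Equivalence.to (ok p σ G ρ τ h) a , Equivalence.to (ok q σ G ρ τ h) b)
    (λ (a , b) → Equivalence.from ∧-⇔ (Equivalence.from (ok p σ G ρ τ h) a , Equivalence.from (ok q σ G ρ τ h) b))

  _d-⊎_ : {P Q : Pred I} → Def P → Def Q → Def (λ G τ → P G τ ⊎ Q G τ)
  (p d-⊎ q) .fm σ = disj (fm p σ) (fm q σ)
  (p d-⊎ q) .ok σ G ρ τ h = mk⇔
    (λ e → Sum.map (Equivalence.to (ok p σ G ρ τ h)) (Equivalence.to (ok q σ G ρ τ h)) (Equivalence.to ∨-⇔ e))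
    (λ s → Equivalence.from ∨-⇔ (Sum.map (Equivalence.from (ok p σ G ρ τ h)) (Equivalence.from (ok q σ G ρ τ h)) s))

  d-¬ : {P : Pred I} → Def P → Def (λ G τ → ¬ P G τ)
  d-¬ p .fm σ = neg (fm p σ)
  d-¬ p .ok σ G ρ τ h = mk⇔
    (λ e np → Equivalence.to not-⇔ e (Equivalence.from (ok p σ G ρ τ h) np))
    (λ n → Equivalence.from not-⇔ (n ∘ Equivalence.to (ok p σ G ρ τ h)))

  -- Implication is read classically, which is sound because a definable predicate is decided by
  -- evaluating its formula.
  _d-→_ : {P Q : Pred I} → Def P → Def Q → Def (λ G τ → P G τ → Q G τ)
  p d-→ q = d-map (λ G τ → mk⇔ (λ { (inj₁ n) x → contradiction x n ; (inj₂ y) _ → y })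
    (λ f → case dec p G τ of λ { (yes x) → inj₂ (f x) ; (no n) → inj₁ n })) (d-¬ p d-⊎ q)

  d-⇔ : {P Q : Pred I} → Def P → Def Q → Def (λ G τ → (P G τ → Q G τ) × (Q G τ → P G τ))
  d-⇔ p q = (p d-→ q) d-× (q d-→ p)

  d-const : {A : Set} → Dec A → Def {I} (λ _ _ → A)
  d-const (no n) .fm σ = ff
  d-const (no n) .ok σ G ρ τ h = mk⇔ (λ ()) (λ a → contradiction a n)
  d-const (yes a) .fm σ = neg ff
  d-const (yes a) .ok σ G ρ τ h = mk⇔ (λ _ → a) (λ _ → refl)

  d-≡ : ∀ {b c : ∀ G → (I → V G) → Bool} → BDef b → BDef c → Def (λ G τ → b G τ ≡ c G τ)
  d-≡ {b} {c} p q = d-map (λ G τ → equiv (b G τ) (c G τ)) (d-⇔ (d-bool p) (d-bool q))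
    where
    equiv : ∀ x y → ((x ≡ true → y ≡ true) × (y ≡ true → x ≡ true)) ⇔ (x ≡ y)
    equiv true y = mk⇔ (λ (f , _) → sym (f refl)) λ { refl → id , id }
    equiv false false = mk⇔ (λ _ → refl) λ { refl → id , id }
    equiv false true = mk⇔ (λ (_ , g) → g refl) λ ()

  d-≡const : ∀ {b : ∀ G → (I → V G) → Bool} → BDef b → ∀ k → Def (λ G τ → b G τ ≡ k)
  d-≡const p true = d-bool p
  d-≡const p false = d-map (λ G τ → mk⇔ Boolₚ.¬-not (λ e e' → contradiction (trans (sym e) e') λ ())) (d-¬ (d-bool p))

  d-∃Fin : ∀ {m} {P : Fin m → Pred I} → (∀ a → Def (P a)) → Def (λ G τ → ∃ λ a → P a G τ)
  d-∃Fin {zero} p = d-map (λ _ _ → mk⇔ (λ ()) λ ()) (d-const {⊥} (no id))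
  d-∃Fin {suc m} p = d-map (λ _ _ → mk⇔
      (λ { (inj₁ x) → zero , x ; (inj₂ (a , x)) → suc a , x })
      (λ { (zero , x) → inj₁ x ; (suc a , x) → inj₂ (a , x) }))
    (p zero d-⊎ d-∃Fin (p ∘ suc))

  d-∀Fin : ∀ {m} {P : Fin m → Pred I} → (∀ a → Def (P a)) → Def (λ G τ → ∀ a → P a G τ)
  d-∀Fin {zero} p = d-map (λ _ _ → mk⇔ (λ _ ()) (λ _ → tt)) (d-const (yes tt))
  d-∀Fin {suc m} p = d-map (λ _ _ → mk⇔
      (λ { (x , f) zero → x ; (x , f) (suc a) → f a })
      (λ f → f zero , f ∘ suc))
    (p zero d-× d-∀Fin (p ∘ suc))

  d-∃ : {P : ∀ G → V G → (I → V G) → Set} →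
    Def {Maybe I} (λ G τ → P G (τ nothing) (τ ∘ just)) → Def {I} (λ G τ → ∃ λ v → P G v τ)
  d-∃ p .fm σ = exi (fm p (maybe (suc ∘ σ) zero))
  d-∃ {P} p .ok σ G ρ τ h = mk⇔
      (λ e → let v , x = Equivalence.to (anyF-⇔ _) e in v , Equivalence.to (inner v) x)
      (λ (v , x) → Equivalence.from (anyF-⇔ _) (v , Equivalence.from (inner v) x))
    where
    inner : ∀ v → _ ⇔ P G v τ
    inner v = ok p (maybe (suc ∘ σ) zero) G (extend v ρ) (maybe τ v) (λ { nothing → refl ; (just i) → h i })

exiN : ∀ N {n} → Formula (N + n) → Formula n
exiN zero φ = φ
exiN (suc N) φ = exiN N (exi φ)

append : ∀ {A : Set} {N n} → (Fin N → A) → (Fin n → A) → Fin (N + n) → A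
append {N = zero} t ρ = ρ
append {N = suc N} t ρ = extend (t zero) (append (t ∘ suc) ρ)

append-↑ˡ : ∀ {A : Set} {N n} (t : Fin N → A) (ρ : Fin n → A) i → append t ρ (i Fin.↑ˡ n) ≡ t i
append-↑ˡ t ρ zero = refl
append-↑ˡ t ρ (suc i) = append-↑ˡ (t ∘ suc) ρ i

append-↑ʳ : ∀ {A : Set} {N n} (t : Fin N → A) (ρ : Fin n → A) j → append t ρ (N Fin.↑ʳ j) ≡ ρ j
append-↑ʳ {N = zero} t ρ j = refl
append-↑ʳ {N = suc N} t ρ j = append-↑ʳ (t ∘ suc) ρ j

exiN-⇔ : ∀ G N {n} (φ : Formula (N + n)) (ρ : Fin n → V G) →
  eval G (exiN N φ) ρ ≡ true ⇔ Σ (Fin N → V G) λ t → eval G φ (append t ρ) ≡ true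
exiN-⇔ G zero φ ρ = mk⇔ (λ e → (λ ()) , e) proj₂
exiN-⇔ G (suc N) φ ρ = mk⇔
  (λ e → let t , e₁ = Equivalence.to (exiN-⇔ G N (exi φ) ρ) e
             v , e₂ = Equivalence.to (anyF-⇔ _) e₁ in extend v t , e₂)
  (λ (t , e) → Equivalence.from (exiN-⇔ G N (exi φ) ρ)
    (t ∘ suc , Equivalence.from (anyF-⇔ _) (t zero , e)))

module _ {I : Set} where

  d-∃T : ∀ N {P : ∀ G → (Fin N → V G) → (I → V G) → Set} →
    Def {Fin N ⊎ I} (λ G τ → P G (τ ∘ inj₁) (τ ∘ inj₂)) →
    Def {I} (λ G τ → Σ (Fin N → V G) λ t → P G t τ)
  d-∃T N p .fm {n} σ = exiN N (fm p [ Fin._↑ˡ n , (N Fin.↑ʳ_) ∘ σ ]′)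
  d-∃T N {P} p .ok {n} σ G ρ τ h = mk⇔
      (λ e → let t , x = Equivalence.to (exiN-⇔ G N _ ρ) e in t , Equivalence.to (inner t) x)
      (λ (t , x) → Equivalence.from (exiN-⇔ G N _ ρ) (t , Equivalence.from (inner t) x))
    where
    inner : ∀ t → _ ⇔ P G t τ
    inner t = ok p [ Fin._↑ˡ n , (N Fin.↑ʳ_) ∘ σ ]′ G (append t ρ) [ t , τ ]′
      (λ { (inj₁ i) → append-↑ˡ t ρ i ; (inj₂ j) → trans (append-↑ʳ t ρ (σ j)) (h j) })

  d-∀ : {P : ∀ G → V G → (I → V G) → Set} →
    Def {Maybe I} (λ G τ → P G (τ nothing) (τ ∘ just)) → Def {I} (λ G τ → ∀ v → P G v τ)
  d-∀ {P} p = d-map (λ G τ → mk⇔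
      (λ n v → decidable-stable (dec p G (maybe τ v)) (λ ¬x → n (v , ¬x)))
      (λ f (v , ¬x) → ¬x (f v)))
    (d-¬ (d-∃ {P = λ G v τ → ¬ P G v τ} (d-¬ p)))

  d-∀T : ∀ N {P : ∀ G → (Fin N → V G) → (I → V G) → Set} →
    Def {Fin N ⊎ I} (λ G τ → P G (τ ∘ inj₁) (τ ∘ inj₂)) →
    Def {I} (λ G τ → ∀ t → P G t τ)
  d-∀T N {P} p = d-map (λ G τ → mk⇔
      (λ n t → decidable-stable (dec p G [ t , τ ]′) (λ ¬x → n (t , ¬x)))
      (λ f (t , ¬x) → ¬x (f t)))
    (d-¬ (d-∃T N {λ G t τ → ¬ P G t τ} (d-¬ p)))

-- Connection models

-- Children are named by vertices instead of nodes of a tree. `adj` is constrained only on label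
-- pairs realised across children, so it need not be symmetric.
record Split {n} (E : Fin n → Fin n → Bool) (ℓ : ℕ) (Sub : (Fin n → Set) → Set) (X : Fin n → Set) : Set where
  field
    child  : Fin n → Fin n
    lab    : Fin n → Fin ℓ
    adj    : Fin ℓ → Fin ℓ → Bool
    across : ∀ {u v} → X u → X v → child u ≢ child v → E u v ≡ adj (lab u) (lab v)
    sub    : ∀ i → Sub (λ v → X v × child v ≡ i)
open Split

-- Mod E ℓ k X: the graph induced on X has a connection model of depth suc k in which every level
-- of the tree has its own labelling with ℓ labels.
Mod : ∀ {n} (E : Fin n → Fin n → Bool) (ℓ k : ℕ) → (Fin n → Set) → Set
Mod E ℓ zero X = ∀ u v → X u → X v → u ≡ v
Mod E ℓ (suc k) X = Split E ℓ (Mod E ℓ k) X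

module _ {n} {E : Fin n → Fin n → Bool} where

  hered : ∀ {ℓ} k {X Y : Fin n → Set} → (∀ {v} → Y v → X v) → Mod E ℓ k X → Mod E ℓ k Y
  hered zero s M u v yu yv = M u v (s yu) (s yv)
  hered (suc k) s M = record
    { child = child M ; lab = lab M ; adj = adj M
    ; across = λ yu yv → across M (s yu) (s yv)
    ; sub = λ i → hered k (λ (yv , e) → s yv , e) (sub M i) }

  subsingleton : ∀ {ℓ} k {X : Fin n → Set} → (Fin n → Fin ℓ) → (∀ u v → X u → X v → u ≡ v) → Mod E ℓ k X
  subsingleton zero lb s = s
  subsingleton (suc k) lb s = record
    { child = id ; lab = lb ; adj = λ _ _ → false
    ; across = λ {u} {v} xu xv u≢v → contradiction (s u v xu xv) u≢v
    ; sub = λ i → subsingleton k lb (λ u v (xu , _) (xv , _) → s u v xu xv) }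

  relabel : ∀ {ℓ ℓ'} k {X : Fin n → Set} (ι : Fin ℓ → Fin ℓ') (r : Fin ℓ' → Maybe (Fin ℓ)) →
    (∀ a → r (ι a) ≡ just a) → Mod E ℓ k X → Mod E ℓ' k X
  relabel zero ι r rι M = M
  relabel {ℓ} {ℓ'} (suc k) ι r rι M = record
    { child = child M ; lab = ι ∘ lab M ; adj = A
    ; across = λ xu xv ne → trans (across M xu xv ne) (sym (A-ι _ _))
    ; sub = λ i → relabel k ι r rι (sub M i) }
    where
    A : Fin ℓ' → Fin ℓ' → Bool
    A a b with r a | r b
    ... | just x | just y = adj M x y
    ... | _ | _ = false
    A-ι : ∀ x y → A (ι x) (ι y) ≡ adj M x y
    A-ι x y rewrite rι x | rι y = refl

  module _ {K : Set} (_≟K_ : DecidableEquality K) (key : Fin n → K) where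
    private
      module R = Representative (λ u v → key u ≡ key v) (λ u v → key u ≟K key v)
        (λ _ → refl) sym trans

    -- Deciding `X` tells which vertices name a child; an index that represents no vertex of `X`
    -- gets an empty piece.
    splitBy : ∀ {ℓ k} {X : Fin n → Set} → (∀ v → Dec (X v)) →
      (lb : Fin n → Fin ℓ) (A : Fin ℓ → Fin ℓ → Bool) →
      (∀ {u v} → X u → X v → key u ≢ key v → E u v ≡ A (lb u) (lb v)) →
      (∀ u → X u → Mod E ℓ k (λ v → X v × key v ≡ key u)) → Mod E ℓ (suc k) X
    splitBy {k = k} {X} X? lb A acr sb = record
      { child = R.rep ; lab = lb ; adj = A
      ; across = λ xu xv ne → acr xu xv (ne ∘ R.rep-≡)
      ; sub = sub' }
      where
      sub' : ∀ i → Mod E _ k (λ v → X v × R.rep v ≡ i)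
      sub' i with Finₚ.any? (λ u → X? u ×-dec (R.rep u Fin.≟ i))
      ... | yes (u , xu , eu) = hered k (λ (xv , ev) → xv , R.rep-≡⁻ (trans ev (sym eu))) (sb u xu)
      ... | no none = subsingleton k lb (λ u v xu _ → contradiction (u , xu) none)

  private
    left : ∀ a {b} → Fin (a + b) → Maybe (Fin a)
    left a z = [ just , const nothing ]′ (Fin.splitAt a z)

    right : ∀ a {b} → Fin (a + b) → Maybe (Fin b)
    right a z = [ const nothing , just ]′ (Fin.splitAt a z)

  enlargeˡ : ∀ {a} b k {X : Fin n → Set} → Mod E a k X → Mod E (a + b) k X
  enlargeˡ {a} b k = relabel k (Fin._↑ˡ b) (left a) (λ x → cong [ just , const nothing ]′ (Finₚ.splitAt-↑ˡ a x b))

  enlargeʳ : ∀ a {b} k {X : Fin n → Set} → Mod E b k X → Mod E (a + b) k X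
  enlargeʳ a {b} k = relabel k (a Fin.↑ʳ_) (right a) (λ x → cong [ const nothing , just ]′ (Finₚ.splitAt-↑ʳ a b x))

  splitSum : ∀ {a b k} {X : Fin n → Set} → (∀ v → Dec (X v)) → (key : Fin n → Fin n) →
    (lb : Fin n → Fin a) (A : Fin a → Fin a → Bool) →
    (∀ {u v} → X u → X v → key u ≢ key v → E u v ≡ A (lb u) (lb v)) →
    (∀ u → X u → Mod E b k (λ v → X v × key v ≡ key u)) → Mod E (a + b) (suc k) X
  splitSum {a} {b} {k} X? key lb A acr sb = splitBy Fin._≟_ key X? (λ v → lb v Fin.↑ˡ b) A'
    (λ xu xv ne → trans (acr xu xv ne) (sym (A'-↑ˡ _ _)))
    (λ u xu → enlargeʳ a k (sb u xu))
    where
    A' : Fin (a + b) → Fin (a + b) → Bool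
    A' x y with left a x | left a y
    ... | just i | just j = A i j
    ... | _ | _ = false
    left-↑ˡ : ∀ x → left a (x Fin.↑ˡ b) ≡ just x
    left-↑ˡ x = cong [ just , const nothing ]′ (Finₚ.splitAt-↑ˡ a x b)
    A'-↑ˡ : ∀ x y → A' (x Fin.↑ˡ b) (y Fin.↑ˡ b) ≡ A x y
    A'-↑ˡ x y rewrite left-↑ˡ x | left-↑ˡ y = refl

  -- The children of all pieces are hung below one common root, so the depth stays that of a single
  -- piece. A label combines the piece, the label inside it, which decides adjacency within the
  -- piece, and `lab₂`, which decides adjacency between pieces.
  module Merge {ℓ k m p} {X : Fin n → Set} (X? : ∀ v → Dec (X v))
    (idx : Fin n → Fin m) (lab₂ : Fin n → Fin p) (A₂ : Fin m → Fin m → Fin p → Fin p → Bool)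
    (cross : ∀ {u v} → X u → X v → idx u ≢ idx v → E u v ≡ A₂ (idx u) (idx v) (lab₂ u) (lab₂ v))
    (part : ∀ j → Mod E ℓ (suc k) (λ v → X v × idx v ≡ j)) where

    private
      L : ℕ
      L = m * (ℓ * p)

      enc : Fin m → Fin ℓ → Fin p → Fin L
      enc i a q = combine i (combine a q)

      d₁ : Fin L → Fin m
      d₁ z = proj₁ (remQuot {m} (ℓ * p) z)
      d₂ : Fin L → Fin ℓ
      d₂ z = proj₁ (remQuot {ℓ} p (proj₂ (remQuot {m} (ℓ * p) z)))
      d₃ : Fin L → Fin p
      d₃ z = proj₂ (remQuot {ℓ} p (proj₂ (remQuot {m} (ℓ * p) z)))

      d₁-enc : ∀ i a q → d₁ (enc i a q) ≡ i
      d₁-enc i a q = cong proj₁ (Finₚ.remQuot-combine i (combine a q))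
      d₂-enc : ∀ i a q → d₂ (enc i a q) ≡ a
      d₂-enc i a q = trans (cong (λ r → proj₁ (remQuot {ℓ} p (proj₂ r))) (Finₚ.remQuot-combine i (combine a q)))
        (cong proj₁ (Finₚ.remQuot-combine a q))
      d₃-enc : ∀ i a q → d₃ (enc i a q) ≡ q
      d₃-enc i a q = trans (cong (λ r → proj₂ (remQuot {ℓ} p (proj₂ r))) (Finₚ.remQuot-combine i (combine a q)))
        (cong proj₂ (Finₚ.remQuot-combine a q))

      lb : Fin n → Fin L
      lb v = enc (idx v) (lab (part (idx v)) v) (lab₂ v)

      key : Fin n → Fin m × Fin n
      key v = idx v , child (part (idx v)) v

      _≟K_ : DecidableEquality (Fin m × Fin n)
      (a , b) ≟K (c , d) = Dec.map′ (λ (x , y) → cong₂ _,_ x y) (λ e → cong proj₁ e , cong proj₂ e)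
        ((a Fin.≟ c) ×-dec (b Fin.≟ d))

      A' : Fin m → Fin m → Fin ℓ → Fin ℓ → Fin p → Fin p → Bool
      A' i j a b q r with i Fin.≟ j
      ... | yes _ = adj (part i) a b
      ... | no _ = A₂ i j q r

      A : Fin L → Fin L → Bool
      A x y = A' (d₁ x) (d₁ y) (d₂ x) (d₂ y) (d₃ x) (d₃ y)

      A-enc : ∀ i j a b q r → A (enc i a q) (enc j b r) ≡ A' i j a b q r
      A-enc i j a b q r rewrite d₁-enc i a q | d₂-enc i a q | d₃-enc i a q
        | d₁-enc j b r | d₂-enc j b r | d₃-enc j b r = refl

      acr : ∀ {u v} → X u → X v → key u ≢ key v → E u v ≡ A (lb u) (lb v)
      acr {u} {v} xu xv ne = trans step (sym (A-enc (idx u) (idx v) _ _ _ _))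
        where
        step : E u v ≡ A' (idx u) (idx v) (lab (part (idx u)) u) (lab (part (idx v)) v) (lab₂ u) (lab₂ v)
        step with idx u Fin.≟ idx v
        ... | no ne' = cross xu xv ne'
        ... | yes e = trans (across (part (idx u)) (xu , refl) (xv , sym e)
                (λ e' → ne (cong₂ _,_ e (trans e' (cong (λ i → child (part i) v) e)))))
                (cong (λ i → adj (part (idx u)) (lab (part (idx u)) u) (lab (part i) v)) e)

    merge : Mod E (m * (ℓ * p)) (suc k) X
    merge = splitBy _≟K_ key X? lb A acr (λ u xu →
      relabel k (λ a → enc (idx u) a (lab₂ u)) (just ∘ d₂) (λ a → cong just (d₂-enc (idx u) a (lab₂ u)))
        (hered k (λ {v} (xv , e) → (xv , cong proj₁ e) ,
            trans (cong (λ i → child (part i) v) (sym (cong proj₁ e))) (cong proj₂ e))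
          (sub (part (idx u)) (child (part (idx u)) u))))

pullback : ∀ {n m} {E : Fin n → Fin n → Bool} {E' : Fin m → Fin m → Bool} (f : Fin m → Fin n) →
  Injective _≡_ _≡_ f → (∀ {i j} → i ≢ j → E' i j ≡ E (f i) (f j)) →
  ∀ {ℓ} k {X : Fin n → Set} {Y : Fin m → Set} → (∀ i → Dec (Y i)) → (∀ {i} → Y i → X (f i)) →
  Mod E ℓ k X → Mod E' ℓ k Y
pullback f inj E'≡ zero Y? s M i j yi yj = inj (M (f i) (f j) (s yi) (s yj))
pullback f inj E'≡ (suc k) Y? s M = splitBy Fin._≟_ (child M ∘ f) Y? (lab M ∘ f) (adj M)
  (λ {i} {j} yi yj ne → trans (E'≡ (λ i≡j → ne (cong (child M ∘ f) i≡j))) (across M (s yi) (s yj) ne))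
  (λ i yi → pullback f inj E'≡ k
    (λ j → Y? j ×-dec (child M (f j) Fin.≟ child M (f i)))
    (λ (yj , e) → s yj , e) (sub M (child M (f i))))

-- From connection models to levelwise models

mutual
  mem⇒∈ : ∀ {L n d} v (t : CTree L n d) → mem v t ≡ true → v ∈ leaves t
  mem⇒∈ v (leaf w) e = here (true-⌊⌋ (v Fin.≟ w) e)
  mem⇒∈ v (node _ _ ts) e = memL⇒∈ v ts e

  memL⇒∈ : ∀ {L n d} v (ts : List (CTree L n d)) → memL v ts ≡ true → v ∈ leavesL ts
  memL⇒∈ v (t ∷ ts) e with mem v t in eq
  ... | true = ∈ₚ.∈-++⁺ˡ (mem⇒∈ v t eq)
  ... | false = ∈ₚ.∈-++⁺ʳ (leaves t) (memL⇒∈ v ts e)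

mutual
  ∈⇒mem : ∀ {L n d} v (t : CTree L n d) → v ∈ leaves t → mem v t ≡ true
  ∈⇒mem v (leaf w) (here e) = ⌊⌋-true (v Fin.≟ w) e
  ∈⇒mem v (node _ _ ts) v∈ = ∈⇒memL v ts v∈

  ∈⇒memL : ∀ {L n d} v (ts : List (CTree L n d)) → v ∈ leavesL ts → memL v ts ≡ true
  ∈⇒memL v (t ∷ ts) v∈ with ∈ₚ.∈-++⁻ (leaves t) v∈
  ... | inj₁ v∈t rewrite ∈⇒mem v t v∈t = refl
  ... | inj₂ v∈ts rewrite ∈⇒memL v ts v∈ts = Boolₚ.∨-zeroʳ (mem v t)

module FromTree {L n} (E : Fin n → Fin n → Bool) (lb : Fin n → Fin L) where

  index : ∀ {d} → List (CTree L n d) → Fin n → ℕ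
  index [] v = zero
  index (t ∷ ts) v = if mem v t then zero else suc (index ts v)

  absent : ∀ {d} (A : Fin L → Fin L → Bool) (ts : List (CTree L n d)) u v →
    memL u ts ≡ false ⊎ memL v ts ≡ false → modelAdjL lb A ts u v ≡ A (lb u) (lb v)
  absent A [] u v _ = refl
  absent A (t ∷ ts) u v a with mem u t | mem v t
  absent A (t ∷ ts) u v (inj₁ ()) | true | _
  absent A (t ∷ ts) u v (inj₂ ()) | _ | true
  absent A (t ∷ ts) u v (inj₂ e) | true | false = absent A ts u v (inj₂ e)
  absent A (t ∷ ts) u v (inj₁ e) | false | _ = absent A ts u v (inj₁ e)
  absent A (t ∷ ts) u v (inj₂ e) | false | false = absent A ts u v (inj₂ e)

  unique-mem : ∀ {d} (t : CTree L n d) (ts : List (CTree L n d)) v → Unique (leaves t ++ leavesL ts) → mem v t ≡ true → memL v ts ≡ false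
  unique-mem t ts v uq e with memL v ts in eq
  ... | false = refl
  ... | true = ⊥-elim (disjoint (leaves t) uq (mem⇒∈ v t e) (memL⇒∈ v ts eq))
    where
    disjoint : ∀ {x : Fin n} xs {ys} → Unique (xs ++ ys) → x ∈ xs → x ∈ ys → ⊥
    disjoint (x ∷ xs) (px ∷ _) (here refl) x∈ys = All.lookup px (∈ₚ.∈-++⁺ʳ xs x∈ys) refl
    disjoint (x ∷ xs) (_ ∷ ps) (there x∈) x∈ys = disjoint xs ps x∈ x∈ys

  unique-++ʳ : ∀ (xs : List (Fin n)) {ys} → Unique (xs ++ ys) → Unique ys
  unique-++ʳ [] u = u
  unique-++ʳ (x ∷ xs) (_ ∷ u) = unique-++ʳ xs u

  unique-++ˡ : ∀ (xs : List (Fin n)) {ys} → Unique (xs ++ ys) → Unique xs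
  unique-++ˡ [] u = []
  unique-++ˡ (x ∷ xs) (p ∷ u) = Allₚ.++⁻ˡ xs p ∷ unique-++ˡ xs u

  separated : ∀ {d} (A : Fin L → Fin L → Bool) (ts : List (CTree L n d)) u v → Unique (leavesL ts) →
    index ts u ≢ index ts v → modelAdjL lb A ts u v ≡ A (lb u) (lb v)
  separated A [] u v uq ne = refl
  separated A (t ∷ ts) u v uq ne with mem u t in eu | mem v t in ev
  ... | true | true = contradiction refl ne
  ... | true | false = absent A ts u v (inj₁ (unique-mem t ts u uq eu))
  ... | false | true = absent A ts u v (inj₂ (unique-mem t ts v uq ev))
  ... | false | false = separated A ts u v (unique-++ʳ (leaves t) uq) (ne ∘ cong suc)

  mutual
    -- `X` is kept general because the recursion over a list of subtrees passes to the vertices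
    -- outside the subtrees already treated, where `modelAdjL` skips these subtrees.
    fromTree : ∀ k (t : CTree L n (suc k)) → Unique (leaves t) → (X : Fin n → Set) → (∀ v → Dec (X v)) →
      (∀ {v} → X v → mem v t ≡ true) →
      (∀ u v → X u → X v → u ≢ v → E u v ≡ modelAdj lb t u v) → Mod E L k X
    fromTree k (leaf w) uq X X? X⊆ ok = subsingleton k lb λ u v xu xv →
      trans (true-⌊⌋ (u Fin.≟ w) (X⊆ xu)) (sym (true-⌊⌋ (v Fin.≟ w) (X⊆ xv)))
    -- At depth 1 a node cannot have children, hence contains no vertex.
    fromTree zero (node A _ []) uq X X? X⊆ ok u v xu xv = contradiction (X⊆ xu) λ ()
    fromTree (suc k) (node A _ ts) uq X X? X⊆ ok = splitBy ℕ._≟_ (index ts) X? lb A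
      (λ {u} {v} xu xv ne → trans (ok u v xu xv (ne ∘ cong (index ts))) (separated A ts u v uq ne))
      (fromTrees k A ts uq X X? X⊆ ok)

    fromTrees : ∀ k A (ts : List (CTree L n (suc k))) → Unique (leavesL ts) → (X : Fin n → Set) → (∀ v → Dec (X v)) →
      (∀ {v} → X v → memL v ts ≡ true) →
      (∀ u v → X u → X v → u ≢ v → E u v ≡ modelAdjL lb A ts u v) →
      ∀ u → X u → Mod E L k (λ v → X v × index ts v ≡ index ts u)
    fromTrees k A [] uq X X? X⊆ ok u xu = contradiction (X⊆ xu) λ ()
    fromTrees k A (t ∷ ts) uq X X? X⊆ ok u xu with mem u t in eu
    ... | true = fromTree k t (unique-++ˡ (leaves t) uq) _
            (λ v → X? v ×-dec (index (t ∷ ts) v ℕ.≟ zero))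
            (λ {v} (_ , e) → inside v e)
            (λ v w (xv , ev) (xw , ew) ne → trans (ok v w xv xw ne) (here-adj v w (inside v ev) (inside w ew)))
      where
      inside : ∀ v → index (t ∷ ts) v ≡ zero → mem v t ≡ true
      inside v e with mem v t
      ... | true = refl
      here-adj : ∀ v w → mem v t ≡ true → mem w t ≡ true → modelAdjL lb A (t ∷ ts) v w ≡ modelAdj lb t v w
      here-adj v w ev ew rewrite ev | ew = refl
    ... | false = hered k (λ {v} (xv , e) → (xv , outside v e) , tail-index v e)
            (fromTrees k A ts (unique-++ʳ (leaves t) uq) (λ v → X v × mem v t ≡ false)
              (λ v → X? v ×-dec (mem v t Bool.≟ false))
              (λ {v} (xv , e) → tail-mem v e (X⊆ xv))
              (λ v w (xv , ev) (xw , _) ne → trans (ok v w xv xw ne) (tail-adj v w ev)) u (xu , eu))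
      where
      outside : ∀ v → index (t ∷ ts) v ≡ suc (index ts u) → mem v t ≡ false
      outside v e with mem v t
      ... | false = refl
      tail-index : ∀ v → index (t ∷ ts) v ≡ suc (index ts u) → index ts v ≡ index ts u
      tail-index v e with mem v t
      ... | false = ℕₚ.suc-injective e
      tail-mem : ∀ v → mem v t ≡ false → memL v (t ∷ ts) ≡ true → memL v ts ≡ true
      tail-mem v e m rewrite e = m
      tail-adj : ∀ v w → mem v t ≡ false → modelAdjL lb A (t ∷ ts) v w ≡ modelAdjL lb A ts v w
      tail-adj v w e rewrite e = refl

model⇒Mod : ∀ {L k} G → ConnectionModel L (suc k) G → Mod (E G) L k (λ _ → ⊤)
model⇒Mod {L} {k} G M = fromTree k tree (unique-resp leafset (Uniqueₚ.allFin⁺ _)) _ (λ _ → yes tt)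
  (λ {v} _ → ∈⇒mem v tree (↭ₚ.∈-resp-↭ (↭-sym leafset) (∈ₚ.∈-allFin v)))
  (λ u v _ _ → correct u v)
  where
  open ConnectionModel M
  open FromTree (E G) label
  unique-resp : ∀ {xs ys : List (Fin (size G))} → xs ↭ ys → Unique ys → Unique xs
  unique-resp p = ↭ₛₚ.Unique-resp-↭ (setoid _) (↭⇒↭ₛ (↭-sym p))

-- From levelwise models back to connection models

-- A connection model has one labelling for all its nodes, so the labels along the path to a leaf
-- are packed into one.
pathLabels : (ℓ k : ℕ) → ℕ
pathLabels ℓ zero = 1
pathLabels ℓ (suc k) = ℓ * pathLabels ℓ k

module ToTree {n} (E : Fin n → Fin n → Bool) (E-sym : ∀ u v → E u v ≡ E v u) {ℓ : ℕ} where

  label : ∀ k {X} → Mod E ℓ k X → Fin n → Fin (pathLabels ℓ k)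
  label zero M v = zero
  label (suc k) M v = combine (lab M v) (label k (sub M (child M v)) v)

  private
    top : ∀ k → Fin (pathLabels ℓ (suc k)) → Fin ℓ
    top k z = proj₁ (remQuot {ℓ} (pathLabels ℓ k) z)
    rest : ∀ k → Fin (pathLabels ℓ (suc k)) → Fin (pathLabels ℓ k)
    rest k z = proj₂ (remQuot {ℓ} (pathLabels ℓ k) z)

  module _ {N : ℕ} where

    -- The adjacency relations are symmetrised because adj M is only constrained on realised label pairs.
    toTree : ∀ k {X} → (∀ v → Dec (X v)) → Mod E ℓ k X → (Fin N → Fin (pathLabels ℓ k)) → CTree N n (suc k)
    toTree zero X? M π with Finₚ.any? X?
    ... | yes (v , _) = leaf v
    ... | no _ = node (λ _ _ → false) (λ _ _ → refl) []
    toTree (suc k) {X} X? M π = node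
      (λ a b → adj M (top k (π a)) (top k (π b)) ∨ adj M (top k (π b)) (top k (π a)))
      (λ a b → Boolₚ.∨-comm (adj M (top k (π a)) (top k (π b))) _)
      -- A node sees only the global label: `π` extracts the labels from this level downwards, and
      -- `rest k` drops that of this level. Indices naming no child yield nodes without leaves.
      (List.map (λ i → toTree k (λ v → X? v ×-dec (child M v Fin.≟ i)) (sub M i) (rest k ∘ π)) (allFin n))

    leavesL-map⁻ : ∀ {d} {A : Set} (F : A → CTree N n d) is {v} →
      v ∈ leavesL (List.map F is) → ∃ λ i → i ∈ is × v ∈ leaves (F i)
    leavesL-map⁻ F (i ∷ is) v∈ with ∈ₚ.∈-++⁻ (leaves (F i)) v∈
    ... | inj₁ v∈i = i , here refl , v∈i
    ... | inj₂ v∈is = let j , j∈ , v∈j = leavesL-map⁻ F is v∈is in j , there j∈ , v∈j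

    leavesL-map⁺ : ∀ {d} {A : Set} (F : A → CTree N n d) {is i v} →
      i ∈ is → v ∈ leaves (F i) → v ∈ leavesL (List.map F is)
    leavesL-map⁺ F (here refl) v∈ = ∈ₚ.∈-++⁺ˡ v∈
    leavesL-map⁺ F {j ∷ is} (there i∈) v∈ = ∈ₚ.∈-++⁺ʳ (leaves (F j)) (leavesL-map⁺ F i∈ v∈)

    leaf⇒X : ∀ k {X} (X? : ∀ v → Dec (X v)) (M : Mod E ℓ k X) π {v} → v ∈ leaves (toTree k X? M π) → X v
    leaf⇒X zero X? M π v∈ with Finₚ.any? X?
    leaf⇒X zero X? M π (here refl) | yes (_ , xv) = xv
    leaf⇒X (suc k) X? M π v∈ =
      let i , _ , v∈i = leavesL-map⁻ _ (allFin n) v∈ in proj₁ (leaf⇒X k _ (sub M i) (rest k ∘ π) v∈i)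

    X⇒leaf : ∀ k {X} (X? : ∀ v → Dec (X v)) (M : Mod E ℓ k X) π {v} → X v → v ∈ leaves (toTree k X? M π)
    X⇒leaf zero X? M π {v} xv with Finₚ.any? X?
    ... | yes (w , xw) = here (M v w xv xw)
    ... | no none = contradiction (v , xv) none
    X⇒leaf (suc k) X? M π {v} xv = leavesL-map⁺ _ (∈ₚ.∈-allFin (child M v))
      (X⇒leaf k _ (sub M (child M v)) (rest k ∘ π) (xv , refl))

    leavesL-unique : ∀ {d} (F : Fin n → CTree N n d) {is} → Unique is → (∀ i → Unique (leaves (F i))) →
      (∀ {i j v} → v ∈ leaves (F i) → v ∈ leaves (F j) → i ≡ j) → Unique (leavesL (List.map F is))
    leavesL-unique F [] uqs apart = []
    leavesL-unique F (p ∷ uq) uqs apart = Uniqueₚ.++⁺ (uqs _) (leavesL-unique F uq uqs apart)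
      (λ (v∈i , v∈is) → let j , j∈ , v∈j = leavesL-map⁻ F _ v∈is in All.lookup p j∈ (apart v∈i v∈j))

    leaves-unique : ∀ k {X} (X? : ∀ v → Dec (X v)) (M : Mod E ℓ k X) π → Unique (leaves (toTree k X? M π))
    leaves-unique zero X? M π with Finₚ.any? X?
    ... | yes _ = [] ∷ []
    ... | no _ = []
    leaves-unique (suc k) X? M π = leavesL-unique _ (Uniqueₚ.allFin⁺ n)
      (λ i → leaves-unique k _ (sub M i) (rest k ∘ π))
      (λ {i} {j} v∈i v∈j → trans (sym (proj₂ (leaf⇒X k _ (sub M i) (rest k ∘ π) v∈i)))
                                  (proj₂ (leaf⇒X k _ (sub M j) (rest k ∘ π) v∈j)))

    module _ (Lab : Fin n → Fin N) where

      adjL-none : ∀ {d} A (F : Fin n → CTree N n d) is u v →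
        (∀ i → mem u (F i) ≡ true → mem v (F i) ≡ true → ⊥) →
        modelAdjL Lab A (List.map F is) u v ≡ A (Lab u) (Lab v)
      adjL-none A F [] u v none = refl
      adjL-none A F (i ∷ is) u v none with mem u (F i) in eu | mem v (F i) in ev
      ... | true | true = ⊥-elim (none i eu ev)
      ... | true | false = adjL-none A F is u v none
      ... | false | _ = adjL-none A F is u v none

      adjL-one : ∀ {d} A (F : Fin n → CTree N n d) {is} u v {i} → i ∈ is →
        mem u (F i) ≡ true → mem v (F i) ≡ true → (∀ j → mem u (F j) ≡ true → j ≡ i) →
        modelAdjL Lab A (List.map F is) u v ≡ modelAdj Lab (F i) u v
      adjL-one A F u v (here refl) eu ev only rewrite eu | ev = refl
      adjL-one A F {j ∷ is} u v (there i∈) eu ev only with mem u (F j) in fu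
      ... | true rewrite only j fu | ev = refl
      ... | false = adjL-one A F u v i∈ eu ev only

      toTree-correct : ∀ k {X} (X? : ∀ v → Dec (X v)) (M : Mod E ℓ k X) π →
        (∀ {v} → X v → π (Lab v) ≡ label k M v) →
        ∀ u v → X u → X v → u ≢ v → E u v ≡ modelAdj Lab (toTree k X? M π) u v
      toTree-correct zero X? M π πe u v xu xv u≢v = contradiction (M u v xu xv) u≢v
      toTree-correct (suc k) {X} X? M π πe u v xu xv u≢v with child M u Fin.≟ child M v
      ... | yes e = trans
            (toTree-correct k (λ w → X? w ×-dec (child M w Fin.≟ child M u)) (sub M (child M u)) (rest k ∘ π)
              (λ {w} (xw , ew) → trans (cong (rest k) (πe xw))
                (trans (cong proj₂ (Finₚ.remQuot-combine (lab M w) _)) (cong (λ i → label k (sub M i) w) ew)))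
              u v (xu , refl) (xv , sym e) u≢v)
            (sym (adjL-one _ F u v (∈ₚ.∈-allFin (child M u))
              (∈⇒mem u (F (child M u)) (X⇒leaf k _ (sub M (child M u)) (rest k ∘ π) (xu , refl)))
              (∈⇒mem v (F (child M u)) (X⇒leaf k _ (sub M (child M u)) (rest k ∘ π) (xv , sym e)))
              (λ j m → sym (inF m))))
        where
        F : Fin n → CTree N n (suc k)
        F i = toTree k (λ v → X? v ×-dec (child M v Fin.≟ i)) (sub M i) (rest k ∘ π)
        inF : ∀ {j w} → mem w (F j) ≡ true → child M w ≡ j
        inF {j} {w} m = proj₂ (leaf⇒X k _ (sub M j) (rest k ∘ π) (mem⇒∈ w (F j) m))
      ... | no ne = trans realised (sym (adjL-none _ F (allFin n) u v
              (λ i mu mv → ne (trans (inF mu) (sym (inF mv))))))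
        where
        F : Fin n → CTree N n (suc k)
        F i = toTree k (λ v → X? v ×-dec (child M v Fin.≟ i)) (sub M i) (rest k ∘ π)
        inF : ∀ {j w} → mem w (F j) ≡ true → child M w ≡ j
        inF {j} {w} m = proj₂ (leaf⇒X k _ (sub M j) (rest k ∘ π) (mem⇒∈ w (F j) m))
        top≡ : ∀ {w} → X w → top k (π (Lab w)) ≡ lab M w
        top≡ {w} xw = trans (cong (top k) (πe xw)) (cong proj₁ (Finₚ.remQuot-combine (lab M w) _))
        realised : E u v ≡ adj M (top k (π (Lab u))) (top k (π (Lab v))) ∨ adj M (top k (π (Lab v))) (top k (π (Lab u)))
        realised rewrite top≡ xu | top≡ xv | sym (across M xu xv ne) | sym (across M xv xu (ne ∘ sym)) | E-sym v u =
          sym (Boolₚ.∨-idem (E u v))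

Mod⇒model : ∀ {ℓ} k G → Mod (E G) ℓ k (λ _ → ⊤) →
  ConnectionModel (pathLabels ℓ k) (suc k) G
Mod⇒model k G M = record
  { label = label k M
  ; tree = T
  ; leafset = ∼bag⇒↭ (unique∧set⇒bag (leaves-unique k (λ _ → yes tt) M id) (Uniqueₚ.allFin⁺ _)
      (mk⇔ (λ _ → ∈ₚ.∈-allFin _) (λ _ → X⇒leaf k (λ _ → yes tt) M id tt)))
  ; correct = λ u v → toTree-correct (label k M) k (λ _ → yes tt) M id (λ _ → refl) u v tt tt }
  where
  open ToTree (E G) (E-sym G)
  T = toTree k (λ _ → yes tt) M id

-- Connected subsets have bounded diameter

Reach : ∀ {n} → (Fin n → Fin n → Set) → ℕ → Fin n → Fin n → Set
Reach R zero u v = u ≡ v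
Reach R (suc m) u v = Reach R m u v ⊎ ∃ λ w → Reach R m u w × R w v

reach-≤ : ∀ {n} {R : Fin n → Fin n → Set} {u v} m d → Reach R m u v → Reach R (d + m) u v
reach-≤ m zero r = r
reach-≤ m (suc d) r = inj₁ (reach-≤ m d r)

reach-trans : ∀ {n} {R : Fin n → Fin n → Set} {u v w} m d → Reach R m u v → Reach R d v w → Reach R (d + m) u w
reach-trans m zero r refl = r
reach-trans m (suc d) r (inj₁ s) = inj₁ (reach-trans m d r s)
reach-trans m (suc d) r (inj₂ (x , s , e)) = inj₂ (x , reach-trans m d r s , e)

-- `Reach` is what formulas express; `Walk` also records that all vertices stay in `X`, so that a
-- segment can be shortened inside a single child.
data Walk {n} (R : Fin n → Fin n → Set) (X : Fin n → Set) : ℕ → Fin n → Fin n → Set where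
  nil  : ∀ {u} → X u → Walk R X 0 u u
  cons : ∀ {m u w v} → X u → R u w → Walk R X m w v → Walk R X (suc m) u v

module _ {n} {R : Fin n → Fin n → Set} where

  walk-map : ∀ {X Y : Fin n → Set} {m u v} → (∀ {x} → X x → Y x) → Walk R X m u v → Walk R Y m u v
  walk-map s (nil x) = nil (s x)
  walk-map s (cons x r w) = cons (s x) r (walk-map s w)

  walk-start : ∀ {X : Fin n → Set} {m u v} → Walk R X m u v → X u
  walk-start (nil x) = x
  walk-start (cons x _ _) = x

  walk-end : ∀ {X : Fin n → Set} {m u v} → Walk R X m u v → X v
  walk-end (nil x) = x
  walk-end (cons _ _ w) = walk-end w

  walk-glue : ∀ {X : Fin n → Set} {a b u x y v} → Walk R X a u x → R x y → Walk R X b y v →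
    Walk R X (a + suc b) u v
  walk-glue (nil x) r w = cons x r w
  walk-glue (cons x s w₁) r w = cons x s (walk-glue w₁ r w)

  walk⇒reach : ∀ {X : Fin n → Set} {m u v} → Walk R X m u v → ∀ {w} d → Reach R d w u → Reach R (m + d) w v
  walk⇒reach (nil _) d r = r
  walk⇒reach {m = suc m} {v = v} (cons _ e w) {y} d r =
    subst (λ j → Reach R j y v) (ℕₚ.+-suc m d) (walk⇒reach w (suc d) (inj₂ (_ , r , e)))

  walk-snoc : ∀ {X : Fin n → Set} {m u w v} → Walk R X m u w → R w v → X v → Walk R X (suc m) u v
  walk-snoc (nil xu) r xv = cons xu r (nil xv)
  walk-snoc (cons xu s w) r xv = cons xu s (walk-snoc w r xv)

  reach⇒walk : ∀ {X : Fin n → Set} → (∀ {u v} → R u v → X v) → ∀ m {u v} → X u → Reach R m u v →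
    ∃ λ j → Walk R X j u v
  reach⇒walk into zero xu refl = 0 , nil xu
  reach⇒walk into (suc m) xu (inj₁ r) = reach⇒walk into m xu r
  reach⇒walk into (suc m) xu (inj₂ (w , r , e)) =
    let j , wk = reach⇒walk into m xu r in suc j , walk-snoc wk e (into e)

-- Cross m u v: a walk from u to v cut into segments (related by S) and m jumps (related by J).
data Cross {n} (S J : Fin n → Fin n → Set) : ℕ → Fin n → Fin n → Set where
  done : ∀ {u v} → S u v → Cross S J 0 u v
  hop  : ∀ {m u x y v} → S u x → J x y → Cross S J m y v → Cross S J (suc m) u v

module _ {n} {S J : Fin n → Fin n → Set} where

  src tgt : ∀ {m u v} → Cross S J m u v → Fin m → Fin n
  src (hop {x = x} _ _ c) zero = x
  src (hop _ _ c) (suc i) = src c i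
  tgt (hop {y = y} _ _ c) zero = y
  tgt (hop _ _ c) (suc i) = tgt c i

  jump : ∀ {m u v} (c : Cross S J m u v) i → J (src c i) (tgt c i)
  jump (hop _ r c) zero = r
  jump (hop _ _ c) (suc i) = jump c i

  prefix : ∀ {m u v} (c : Cross S J m u v) i → Cross S J (toℕ i) u (src c i)
  prefix (hop s _ _) zero = done s
  prefix (hop s r c) (suc i) = hop s r (prefix c i)

  suffix : ∀ {m u v} (c : Cross S J m u v) i → Cross S J (m ∸ suc (toℕ i)) (tgt c i) v
  suffix (hop _ _ c) zero = c
  suffix (hop _ _ c) (suc i) = suffix c i

  glue : ∀ {a b u x y v} → Cross S J a u x → J x y → Cross S J b y v → Cross S J (a + suc b) u v
  glue (done s) r c = hop s r c
  glue (hop s r c₁) r' c = hop s r (glue c₁ r' c)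

  shortcut : ∀ {m u v} (c : Cross S J m u v) {i j} → i Fin.< j → J (src c i) (tgt c j) →
    ∃ λ m' → m' < m × Cross S J m' u v
  shortcut {m} c {i} {j} i<j r = _ , bound , glue (prefix c i) r (suffix c j)
    where
    open ℕₚ.≤-Reasoning
    bound : toℕ i + suc (m ∸ suc (toℕ j)) < m
    bound = begin-strict
      toℕ i + suc (m ∸ suc (toℕ j)) ≡⟨ ℕₚ.+-suc _ _ ⟩
      suc (toℕ i) + (m ∸ suc (toℕ j)) ≤⟨ ℕₚ.+-monoˡ-≤ _ i<j ⟩
      toℕ j + (m ∸ suc (toℕ j)) <⟨ ℕₚ.≤-refl ⟩
      suc (toℕ j) + (m ∸ suc (toℕ j)) ≡⟨ ℕₚ.m+[n∸m]≡n (Finₚ.toℕ<n j) ⟩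
      m ∎

  -- Of three jumps x₁y₁, x₂y₂, x₃y₃ with equal types, one of x₁y₂, x₁y₃, x₂y₃ is again a jump: otherwise
  -- x₁, y₂, y₃, x₂ all lie in the same child, contradicting that x₂y₂ is a jump.
  module _ {t} (child : Fin n → Fin n) (type : Fin n → Fin t)
    (separates : ∀ {x y} → J x y → child x ≢ child y)
    (uniform : ∀ {x y x' y' x'' y''} → J x y → J x' y'' → J x'' y' →
       type x ≡ type x' → type y ≡ type y' → child x' ≢ child y' → J x' y') where

    private
      triple : ∀ {m u v} (c : Cross S J m u v) {i j k} → i Fin.< j → j Fin.< k →
        type (src c i) ≡ type (src c j) → type (src c j) ≡ type (src c k) →
        type (tgt c i) ≡ type (tgt c j) → type (tgt c j) ≡ type (tgt c k) →
        ∃ λ m' → m' < m × Cross S J m' u v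
      triple c {i} {j} {k} i<j j<k s₁ s₂ t₁ t₂
        with child (src c i) Fin.≟ child (tgt c j)
      ... | no ne = shortcut c i<j (uniform (jump c i) (jump c i) (jump c j) refl t₁ ne)
      ... | yes e₁ with child (src c i) Fin.≟ child (tgt c k)
      ...   | no ne = shortcut c (Finₚ.<-trans i<j j<k)
                (uniform (jump c i) (jump c i) (jump c k) refl (trans t₁ t₂) ne)
      ...   | yes e₂ with child (src c j) Fin.≟ child (tgt c k)
      ...     | no ne = shortcut c j<k (uniform (jump c j) (jump c j) (jump c k) refl t₂ ne)
      ...     | yes e₃ = contradiction (trans e₃ (trans (sym e₂) e₁)) (separates (jump c j))

    few-jumps : ∀ m {u v} → Cross S J m u v → ∃ λ m' → m' ≤ suc (t * t) * 3 × Cross S J m' u v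
    few-jumps = ℕᵢ.<-rec _ step
      where
      step : ∀ m → (∀ {j} → j < m → ∀ {u v} → Cross S J j u v → ∃ λ m' → m' ≤ suc (t * t) * 3 × Cross S J m' u v) →
        ∀ {u v} → Cross S J m u v → ∃ λ m' → m' ≤ suc (t * t) * 3 × Cross S J m' u v
      step m rec c with suc (t * t) * 3 ℕ.≤? m
      ... | no ¬le = m , ℕₚ.<⇒≤ (ℕₚ.≰⇒> ¬le) , c
      ... | yes le =
        let f : Fin m → Fin (t * t)
            f i = combine (type (src c i)) (type (tgt c i))
            -- The argument 2 asks for three jumps of equal types, as `triple` requires.
            ι , mono , a , eqs = mono-equal f 2 le
            same : ∀ i j → f (ι i) ≡ f (ι j)
            same i j = trans (eqs i) (sym (eqs j))
            0F = zero ; 1F = suc zero ; 2F = suc (suc zero)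
            left : ∀ i j → type (src c (ι i)) ≡ type (src c (ι j))
            left i j = Finₚ.combine-injectiveˡ {t} _ _ _ _ (same i j)
            right : ∀ i j → type (tgt c (ι i)) ≡ type (tgt c (ι j))
            right i j = Finₚ.combine-injectiveʳ {t} _ _ _ _ (same i j)
            _ , lt , c' = triple c (mono {0F} {1F} (s≤s z≤n)) (mono {1F} {2F} (s≤s (s≤s z≤n)))
              (left 0F 1F) (left 1F 2F) (right 0F 1F) (right 1F 2F)
        in rec lt c'

-- The bound of `few-jumps` for `ℓ * p` types, times a segment and the jump after it, plus the last
-- segment.
diam : (ℓ p k : ℕ) → ℕ
diam ℓ p zero = 0
diam ℓ p (suc k) = suc ((ℓ * p) * (ℓ * p)) * 3 * suc (diam ℓ p k) + diam ℓ p k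

module Diameter {n} {E : Fin n → Fin n → Bool} {R : Fin n → Fin n → Set} {p} (lab₂ : Fin n → Fin p)
  (X₀ : Fin n → Set)
  (R-uniform : ∀ {u v u' v'} → E u v ≡ E u' v' → E v u ≡ E v' u' → lab₂ u ≡ lab₂ u' → lab₂ v ≡ lab₂ v' →
    X₀ u' → X₀ v' → R u v → R u' v') where

  -- Induction on the depth. The walk is cut where it changes the child; segments inside a child are
  -- shortened by induction, and `few-jumps` bounds the number of jumps, since across children `R`
  -- depends only on the types. With a model of the graph itself this bounds the diameter in every
  -- flip, not only in the good ones.
  short : ∀ {ℓ} k {X} → Mod E ℓ k X → (∀ {v} → X v → X₀ v) → ∀ {m u v} → Walk R X m u v →
    ∃ λ m' → m' ≤ diam ℓ p k × Walk R X m' u v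
  short zero M s {u = u} {v} wk with M u v (walk-start wk) (walk-end wk)
  ... | refl = 0 , z≤n , nil (walk-start wk)
  short {ℓ} (suc k) {X} M s {m} {u} {v} wk =
    let _ , c = cut wk
        m' , le , c' = few-jumps (child M) type (proj₁ ∘ proj₂) uniform _ c
        m'' , le' , wk' = flatten c'
    in m'' , ℕₚ.≤-trans le' (ℕₚ.+-monoˡ-≤ _ (ℕₚ.*-monoˡ-≤ (suc D) le)) , wk'
    where
    D = diam ℓ p k
    S J : Fin n → Fin n → Set
    S u v = ∃ λ m → Walk R (λ x → X x × child M x ≡ child M u) m u v
    J x y = R x y × child M x ≢ child M y × X x × X y
    type : Fin n → Fin (ℓ * p)
    type v = combine (lab M v) (lab₂ v)
    uniform : ∀ {x y x' y' x'' y''} → J x y → J x' y'' → J x'' y' →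
      type x ≡ type x' → type y ≡ type y' → child M x' ≢ child M y' → J x' y'
    uniform (r , ne , xx , xy) (_ , _ , xx' , _) (_ , _ , _ , xy') tx ty ne' =
      let lx = Finₚ.combine-injectiveˡ {ℓ} _ _ _ _ tx ; ly = Finₚ.combine-injectiveˡ {ℓ} _ _ _ _ ty in
      R-uniform
        (trans (across M xx xy ne) (trans (cong₂ (adj M) lx ly) (sym (across M xx' xy' ne'))))
        (trans (across M xy xx (ne ∘ sym)) (trans (cong₂ (adj M) ly lx) (sym (across M xy' xx' (ne' ∘ sym)))))
        (Finₚ.combine-injectiveʳ {ℓ} _ _ _ _ tx) (Finₚ.combine-injectiveʳ {ℓ} _ _ _ _ ty) (s xx') (s xy') r ,
      ne' , xx' , xy'
    extend-first : ∀ {j u w v} → child M u ≡ child M w → X u → R u w → Cross S J j w v → Cross S J j u v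
    extend-first e xu r (done (_ , w)) =
      done (_ , cons (xu , refl) r (walk-map (λ (x , e') → x , trans e' (sym e)) w))
    extend-first e xu r (hop (_ , w) j c) =
      hop (_ , cons (xu , refl) r (walk-map (λ (x , e') → x , trans e' (sym e)) w)) j c
    cut : ∀ {m u v} → Walk R X m u v → ∃ λ j → Cross S J j u v
    cut (nil xu) = 0 , done (0 , nil (xu , refl))
    cut (cons {u = u} {w = w} xu r wk) with child M u Fin.≟ child M w | cut wk
    ... | yes e | j , c = j , extend-first e xu r c
    ... | no ne | j , c = suc j , hop (0 , nil (xu , refl)) (r , ne , xu , walk-start wk) c
    segment : ∀ {u v} → S u v → ∃ λ m → m ≤ D × Walk R X m u v
    segment {u} (_ , w) = let m , le , w' = short k (sub M (child M u)) (s ∘ proj₁) w in m , le , walk-map proj₁ w'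
    flatten : ∀ {j u v} → Cross S J j u v → ∃ λ m → m ≤ j * suc D + D × Walk R X m u v
    flatten (done sg) = segment sg
    flatten {suc j} (hop sg (r , _) c) =
      let a , a≤ , w₁ = segment sg
          b , b≤ , w₂ = flatten c
          open ℕₚ.≤-Reasoning
      in a + suc b , (begin
           a + suc b ≡⟨ ℕₚ.+-suc a b ⟩
           suc a + b ≤⟨ ℕₚ.+-mono-≤ (s≤s a≤) b≤ ⟩
           suc D + (j * suc D + D) ≡⟨ ℕₚ.+-assoc (suc D) (j * suc D) D ⟨
           suc j * suc D + D ∎) , walk-glue w₁ r w₂

-- Flips

reach? : ∀ {n} {R : Fin n → Fin n → Set} → (∀ u v → Dec (R u v)) → ∀ m u v → Dec (Reach R m u v)
reach? R? zero u v = u Fin.≟ v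
reach? R? (suc m) u v = reach? R? m u v ⊎-dec Finₚ.any? (λ w → reach? R? m u w ×-dec R? w v)

reach-sym : ∀ {n} {R : Fin n → Fin n → Set} → (∀ {u v} → R u v → R v u) → ∀ m {u v} → Reach R m u v → Reach R m v u
reach-sym s zero r = sym r
reach-sym s (suc m) (inj₁ r) = inj₁ (reach-sym s m r)
reach-sym {R = R} s (suc m) {u} {v} (inj₂ (w , r , e)) =
  subst (λ j → Reach R j v u) (ℕₚ.+-comm m 1) (reach-trans 1 m (inj₂ (v , refl , s e)) (reach-sym s m r))

reach-preserves : ∀ {n} {R : Fin n → Fin n → Set} {T : Fin n → Fin n → Set} → (∀ u → T u u) →
  (∀ {u v w} → T u v → R v w → T u w) → ∀ m {u v} → Reach R m u v → T u v
reach-preserves rf st zero refl = rf _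
reach-preserves rf st (suc m) (inj₁ r) = reach-preserves rf st m r
reach-preserves rf st (suc m) (inj₂ (w , r , e)) = st (reach-preserves rf st m r) e

ty : ∀ {n q} → (Fin q → Fin n → Bool) → Fin n → Fin (2 ^ q)
ty D u = funToFin (λ i → bit (D i u))

bit-injective : ∀ {a b} → bit a ≡ bit b → a ≡ b
bit-injective {a} {b} e = trans (sym (unbit-bit a)) (trans (cong unbit e) (unbit-bit b))

ty-≡ : ∀ {n q} {D D' : Fin q → Fin n → Bool} {u v} → (∀ i → D i u ≡ D' i v) → ty D u ≡ ty D' v
ty-≡ e = funToFin-cong (λ i → cong bit (e i))

ty-≡⁻ : ∀ {n q} {D : Fin q → Fin n → Bool} {u v} → ty D u ≡ ty D v → ∀ i → D i u ≡ D i v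
ty-≡⁻ e i = bit-injective (funToFin-injective e i)

-- Adjacency after complementing the pairs of types on which decode z is true; decode z need not be
-- symmetric, hence the two disjuncts.
record Flip {n q} (E : Fin n → Fin n → Bool) (D : Fin q → Fin n → Bool) (z : Fin (Codes (2 ^ q)))
  (X : Fin n → Set) (u v : Fin n) : Set where
  constructor flipped
  field
    sourceX : X u
    targetX : X v
    differs : E u v ≢ decode z (ty D u) (ty D v) ⊎ E v u ≢ decode z (ty D v) (ty D u)
open Flip

flip? : ∀ {n q} {E : Fin n → Fin n → Bool} {D : Fin q → Fin n → Bool} {z} {X : Fin n → Set} →
  (∀ v → Dec (X v)) → ∀ u v → Dec (Flip E D z X u v)
flip? X? u v = Dec.map′ (λ (xu , xv , d) → flipped xu xv d) (λ (flipped xu xv d) → xu , xv , d)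
  (X? u ×-dec X? v ×-dec (¬? (_ Bool.≟ _) ⊎-dec ¬? (_ Bool.≟ _)))

module Depth (ℓ₀ K : ℕ) where

  -- Abstract because unfolding the bound would unfold Linked.
  abstract
    dist : ℕ → ℕ
    dist q = diam ℓ₀ (2 ^ q) K

    diam≤dist : ∀ q → diam ℓ₀ (2 ^ q) K ≤ dist q
    diam≤dist q = ℕₚ.≤-refl

  -- Reachability within a fixed distance is first-order. Given a model of `E`, it coincides with
  -- unbounded reachability, which makes it transitive.
  Linked : ∀ {n q} (E : Fin n → Fin n → Bool) (D : Fin q → Fin n → Bool) (z : Fin (Codes (2 ^ q)))
    (X : Fin n → Set) → Fin n → Fin n → Set
  Linked {q = q} E D z X = Reach (Flip E D z X) (dist q)

  linked? : ∀ {n q} {E : Fin n → Fin n → Bool} {D : Fin q → Fin n → Bool} {z} {X : Fin n → Set} →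
    (∀ v → Dec (X v)) → ∀ u v → Dec (Linked E D z X u v)
  linked? {q = q} X? = reach? (flip? X?) (dist q)

  linked-refl : ∀ {n q} {E : Fin n → Fin n → Bool} {D : Fin q → Fin n → Bool} {z} {X : Fin n → Set} u →
    Linked E D z X u u
  linked-refl {q = q} {E} {D} {z} {X} u =
    subst (λ j → Reach (Flip E D z X) j u u) (ℕₚ.+-identityʳ (dist q)) (reach-≤ 0 (dist q) refl)

  linked-X : ∀ {n q} {E : Fin n → Fin n → Bool} {D : Fin q → Fin n → Bool} {z} {X : Fin n → Set} m {u v} →
    X u → Reach (Flip E D z X) m u v → X v
  linked-X {X = X} m xu r = reach-preserves {T = λ u v → X u → X v} (λ _ → id) (λ _ e _ → targetX e) m r xu

  module _ {n} {E : Fin n → Fin n → Bool} (M : Mod E ℓ₀ K (λ _ → ⊤)) {q} {D : Fin q → Fin n → Bool}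
    {z : Fin (Codes (2 ^ q))} {X : Fin n → Set} where

    reach⇒linked : ∀ m {u v} → Reach (Flip E D z X) m u v → Linked E D z X u v
    reach⇒linked m {u} {v} r with reach-preserves {T = λ u v → u ≡ v ⊎ X u} (λ _ → inj₁ refl)
      (λ { (inj₁ refl) e → inj₂ (sourceX e) ; (inj₂ x) _ → inj₂ x }) m r
    ... | inj₁ refl = linked-refl u
    ... | inj₂ xu =
      let _ , wk = reach⇒walk targetX m xu r
          m' , le₀ , wk' = short K (hered K (λ _ → tt) M) id wk
          le = ℕₚ.≤-trans le₀ (diam≤dist q)
      in subst (λ j → Reach (Flip E D z X) j u v) (ℕₚ.m∸n+n≡m le)
           (reach-≤ m' (dist q ∸ m') (subst (λ j → Reach (Flip E D z X) j u v) (ℕₚ.+-identityʳ m')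
             (walk⇒reach wk' 0 refl)))
      where
      uniform : ∀ {u v u' v'} → E u v ≡ E u' v' → E v u ≡ E v' u' → ty D u ≡ ty D u' → ty D v ≡ ty D v' →
        X u' → X v' → Flip E D z X u v → Flip E D z X u' v'
      uniform e e' tu tv xu' xv' (flipped _ _ d) rewrite e | e' | tu | tv = flipped xu' xv' d
      open Diameter (ty D) X uniform

    linked-sym : ∀ {u v} → Linked E D z X u v → Linked E D z X v u
    linked-sym = reach-sym (λ (flipped xu xv d) → flipped xv xu (Sum.swap d)) (dist q)

    linked-trans : ∀ {u v w} → Linked E D z X u v → Linked E D z X v w → Linked E D z X u w
    linked-trans r s = reach⇒linked (dist q + dist q) (reach-trans (dist q) (dist q) r s)

    flip⇒linked : ∀ {u v} → Flip E D z X u v → Linked E D z X u v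
    flip⇒linked e = reach⇒linked 1 (inj₂ (_ , refl , e))

    -- The source of all dicings here: a pair whose adjacency is not the predicted one is an edge of
    -- the flip.
    unlinked : ∀ {u v} → X u → X v → ¬ Linked E D z X u v → E u v ≡ decode z (ty D u) (ty D v)
    unlinked {u} {v} xu xv nl with E u v Bool.≟ decode z (ty D u) (ty D v)
    ... | yes e = e
    ... | no ne = contradiction (flip⇒linked (flipped xu xv (inj₁ ne))) nl

-- Twins

Twins : ∀ {n} (E : Fin n → Fin n → Bool) (X : Fin n → Set) → Fin n → Fin n → Set
Twins E X u v = ∀ w → X w → w ≢ u → w ≢ v → E u w ≡ E v w

twins? : ∀ {n} {E : Fin n → Fin n → Bool} {X : Fin n → Set} → (∀ v → Dec (X v)) → ∀ u v → Dec (Twins E X u v)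
twins? X? u v = Finₚ.all? λ w → X? w →-dec ¬? (w Fin.≟ u) →-dec ¬? (w Fin.≟ v) →-dec (_ Bool.≟ _)

twins-refl : ∀ {n} {E : Fin n → Fin n → Bool} {X : Fin n → Set} u → Twins E X u u
twins-refl u w _ _ _ = refl

twins-sym : ∀ {n} {E : Fin n → Fin n → Bool} {X : Fin n → Set} {u v} → Twins E X u v → Twins E X v u
twins-sym t w xw ne ne' = sym (t w xw ne' ne)

module _ {n} {E : Fin n → Fin n → Bool} {X : Fin n → Set} (E-sym : ∀ u v → E u v ≡ E v u) where

  -- The hypotheses are silent about adjacency to the middle vertex within its own pairs; when `x`
  -- is `v`, the comparison goes through the pair of `u` and `w`.
  twins-trans : ∀ {u v w} → X u → X v → X w → Twins E X u v → Twins E X v w → Twins E X u w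
  twins-trans {u} {v} {w} xu xv xw s t x xx ne ne' with x Fin.≟ v
  ... | no x≢v = trans (s x xx ne x≢v) (t x xx x≢v ne')
  ... | yes refl with u Fin.≟ w
  ...   | yes refl = refl
  ...   | no u≢w = trans (E-sym u x) (trans (t u xu (ne ∘ sym) u≢w) (trans (E-sym w u)
            (trans (s w xw (u≢w ∘ sym) (ne' ∘ sym)) (E-sym x w))))

  -- One end is replaced at a time. If replacing `u` first would produce a loop, `v` is replaced
  -- first, unless the two pairs are the same pair reversed.
  twins-adj : ∀ {u u' v v'} → X u → X u' → X v → X v' → Twins E X u u' → Twins E X v v' → u ≢ v → u' ≢ v' →
    E u v ≡ E u' v'
  twins-adj {u} {u'} {v} {v'} xu xu' xv xv' s t ne ne' with u' Fin.≟ v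
  ... | no u'≢v = trans (s v xv (ne ∘ sym) (u'≢v ∘ sym)) (trans (E-sym u' v)
          (trans (t u' xu' u'≢v ne') (E-sym v' u')))
  ... | yes refl with v' Fin.≟ u
  ...   | yes refl = E-sym u v
  ...   | no v'≢u = trans (E-sym u u') (trans (t u xu ne (v'≢u ∘ sym)) (trans (E-sym v' u)
            (s v' xv' v'≢u (ne' ∘ sym))))

same-label⇒twins : ∀ {n} {E : Fin n → Fin n → Bool} {ℓ} {X : Fin n → Set} (M : Mod E ℓ 1 X) {u v} →
  X u → X v → lab M u ≡ lab M v → Twins E X u v
same-label⇒twins M {u} {v} xu xv e w xw w≢u w≢v =
  trans (across M xu xw (apart xu xw w≢u)) (trans (cong (λ a → adj M a (lab M w)) e)
    (sym (across M xv xw (apart xv xw w≢v))))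
  where
  apart : ∀ {u w} → _ → _ → w ≢ u → child M u ≢ child M w
  apart {u} {w} xu xw w≢u e = w≢u (sym (sub M (child M w) u w (xu , e) (xw , refl)))

-- A first-order approximation of bounded depth

samples : ℕ → ℕ
samples ℓ = ℓ * 3

-- The labels that `Merge` produces for one piece per sample, with the labelling of the level above
-- as `lab₂`.
grow : ℕ → ℕ
grow ℓ = samples ℓ * (ℓ * ℓ)

module Recursion (ℓ₀ K : ℕ) where
  open Depth ℓ₀ K public

  -- A first-order expressible approximation of Mod E ℓ (suc k) X; parameters are allowed here.
  Shallow : ∀ {n} (E : Fin n → Fin n → Bool) (ℓ k : ℕ) → (Fin n → Set) → Set
  Shallow {n} E ℓ zero X = Σ (Fin ℓ → Fin n) λ s → ∀ u → X u → ∃ λ i → X (s i) × Twins E X u (s i)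
  Shallow {n} E ℓ (suc k) X = Σ (Fin (samples ℓ) → Fin n) λ s → ∃ λ z →
    ∀ u → X u → Shallow E (grow ℓ) k (Linked E (λ i → E (s i)) z X u)

  shallowLabels : ℕ → ℕ → ℕ
  shallowLabels ℓ zero = suc ℓ
  shallowLabels ℓ (suc k) = 2 ^ samples ℓ + shallowLabels (grow ℓ) k

  module _ {n} {E : Fin n → Fin n → Bool} (E-sym : ∀ u v → E u v ≡ E v u) (M₀ : Mod E ℓ₀ K (λ _ → ⊤)) where

    linked-split : ∀ {ℓ k q} {D : Fin q → Fin n → Bool} {z} {X : Fin n → Set} → (∀ v → Dec (X v)) →
      (∀ u → X u → Mod E ℓ k (Linked E D z X u)) → Mod E (2 ^ q + ℓ) (suc k) X
    linked-split {k = k} {D = D} {z} {X} X? parts = splitSum X? R.rep (ty D) (decode z)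
      (λ xu xv ne → unlinked M₀ xu xv (ne ∘ R.rep-≡))
      (λ u xu → hered k (λ (_ , e) → linked-sym M₀ (R.rep-≡⁻ e)) (parts u xu))
      where
      module R = Representative (Linked E D z X) (linked? X?) linked-refl (linked-sym M₀) (linked-trans M₀)

    -- With the converse `Mod⇒shallow`, only the number of labels is lost when the existence of a
    -- model is replaced by a first-order property.
    shallow⇒Mod : ∀ ℓ k {X} → (∀ v → Dec (X v)) → Shallow E ℓ k X → Mod E (shallowLabels ℓ k) (suc k) X
    shallow⇒Mod ℓ (suc k) X? (s , z , parts) =
      linked-split X? (λ u xu → shallow⇒Mod (grow ℓ) k (linked? X? u) (parts u xu))
    shallow⇒Mod ℓ zero {X} X? (s , cover) = splitBy Fin._≟_ id X? twin A (λ xu xv ne → A-spec (xu , xv , ne))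
      (λ u xu v w (_ , e) (_ , e') → trans e (sym e'))
      where
      Near : Fin n → Fin ℓ → Set
      Near u i = X (s i) × Twins E X u (s i)
      near? : ∀ u i → Dec (Near u i)
      near? u i = X? (s i) ×-dec twins? X? u (s i)
      twin : Fin n → Fin (suc ℓ)
      -- The label `zero` remains for vertices without a twin among the `s i`; these lie outside
      -- `X`.
      twin u = maybe suc zero (first (λ i → ⌊ near? u i ⌋))
      twin-spec : ∀ {u} → X u → ∃ λ i → twin u ≡ suc i × Near u i
      twin-spec {u} xu with first-spec (λ i → ⌊ near? u i ⌋) (⌊⌋-true (near? u _) (proj₂ (cover u xu)))
      ... | i , fi , p rewrite fi = i , refl , true-⌊⌋ (near? u i) p
      same-twin : ∀ {u v} → X u → X v → twin u ≡ twin v → Twins E X u v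
      same-twin xu xv e with twin-spec xu | twin-spec xv
      ... | i , ei , xi , ti | j , ej , _ , tj with trans (sym ei) (trans e ej)
      ...   | refl = twins-trans E-sym xu xi xv ti (twins-sym tj)
      Pair : Fin n → Fin n → Set
      Pair u v = X u × X v × u ≢ v
      pairs = matrix Pair (λ u v → X? u ×-dec X? v ×-dec ¬? (u Fin.≟ v)) twin twin E
        (λ (xu , xv , ne) (xu' , xv' , ne') e e' →
          twins-adj E-sym xu xu' xv xv' (same-twin xu xu' e) (same-twin xv xv' e') ne ne')
      A = proj₁ pairs
      A-spec : ∀ {u v} → Pair u v → E u v ≡ A (twin u) (twin v)
      A-spec = proj₂ pairs

    -- For each label, three vertices in distinct children, or else vertices meeting all children where it occurs.
    module Sampling {ℓ k} {X : Fin n → Set} (X? : ∀ v → Dec (X v)) (M : Mod E ℓ (suc (suc k)) X) (default : Fin n) where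

      ch = child M

      Occurs : Fin ℓ → Fin n → Set
      Occurs b v = X v × lab M v ≡ b

      occurs? : ∀ b v → Dec (Occurs b v)
      occurs? b v = X? v ×-dec (lab M v Fin.≟ b)

      -- `hit` provides a sample with the label of a given vertex; `rich` provides one outside the
      -- children of two given vertices, unless the label occurs only in sampled children.
      record Sample (b : Fin ℓ) : Set where
        field
          point : Fin 3 → Fin n
          hit   : ∀ {v} → Occurs b v → ∃ λ j → Occurs b (point j)
          rich  : (∀ {v} → Occurs b v → ∃ λ j → ch v ≡ ch (point j)) ⊎
                  ((∀ j → Occurs b (point j)) × (∀ {i j} → i ≢ j → ch (point i) ≢ ch (point j)))
      open Sample

      three : ∀ {A : Set} → A → A → A → Fin 3 → A
      three x y z zero = x
      three x y z (suc zero) = y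
      three x y z (suc (suc zero)) = z

      sample : ∀ b → Sample b
      sample b with Finₚ.any? (occurs? b)
      ... | no none = record { point = λ _ → default
            ; hit = λ o → contradiction (_ , o) none ; rich = inj₁ (λ o → contradiction (_ , o) none) }
      ... | yes (x , ox) with Finₚ.any? (λ v → occurs? b v ×-dec ¬? (ch v Fin.≟ ch x))
      ...   | no none = record { point = λ _ → x ; hit = λ _ → zero , ox
            ; rich = inj₁ (λ {v} o → zero , decidable-stable (ch v Fin.≟ ch x) (λ ne → none (v , o , ne))) }
      ...   | yes (y , oy , y≢x) with Finₚ.any? (λ v → occurs? b v ×-dec ¬? (ch v Fin.≟ ch x) ×-dec ¬? (ch v Fin.≟ ch y))
      ...     | no none = record { point = three x y y ; hit = λ _ → zero , ox ; rich = inj₁ both }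
        where
        both : ∀ {v} → Occurs b v → ∃ λ j → ch v ≡ ch (three x y y j)
        both {v} o with ch v Fin.≟ ch x | ch v Fin.≟ ch y
        ... | yes e | _ = zero , e
        ... | no _ | yes e = suc zero , e
        ... | no n₁ | no n₂ = contradiction (v , o , n₁ , n₂) none
      ...     | yes (w , ow , w≢x , w≢y) = record { point = three x y w ; hit = λ _ → zero , ox
            ; rich = inj₂ ((λ { zero → ox ; (suc zero) → oy ; (suc (suc zero)) → ow }) , apart) }
        where
        apart : ∀ {i j} → i ≢ j → ch (three x y w i) ≢ ch (three x y w j)
        apart {zero} {zero} ne = contradiction refl ne
        apart {zero} {suc zero} _ = y≢x ∘ sym
        apart {zero} {suc (suc zero)} _ = w≢x ∘ sym
        apart {suc zero} {zero} _ = y≢x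
        apart {suc zero} {suc zero} ne = contradiction refl ne
        apart {suc zero} {suc (suc zero)} _ = w≢y ∘ sym
        apart {suc (suc zero)} {zero} _ = w≢x
        apart {suc (suc zero)} {suc zero} _ = w≢y
        apart {suc (suc zero)} {suc (suc zero)} ne = contradiction refl ne

      s : Fin (samples ℓ) → Fin n
      s i = point (sample (quotient {ℓ} 3 i)) (remainder {ℓ} 3 i)

      s-combine : ∀ b j → s (combine b j) ≡ point (sample b) j
      s-combine b j = cong (λ (b , j) → point (sample b) j) (Finₚ.remQuot-combine b j)

      D : Fin (samples ℓ) → Fin n → Bool
      D i = E (s i)

      sampled-≡ : ∀ {u v} → ty D u ≡ ty D v → ∀ b j → E (point (sample b) j) u ≡ E (point (sample b) j) v
      sampled-≡ e b j = subst (λ p → E p _ ≡ E p _) (s-combine b j) (ty-≡⁻ {D = D} e (combine b j))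

      T₀ : Fin n → Set
      T₀ v = ∃ λ i → ch v ≡ ch (s i)

      T₀? : ∀ v → Dec (T₀ v)
      T₀? v = Finₚ.any? (λ i → ch v Fin.≟ ch (s i))

      outside : ∀ {v} → ¬ T₀ v → ∀ b j → ch (point (sample b) j) ≢ ch v
      outside nt b j e = nt (combine b j , trans (sym e) (cong ch (sym (s-combine b j))))

      frequent : ∀ {v} → X v → ¬ T₀ v → let p = point (sample (lab M v)) in
        (∀ j → Occurs (lab M v) (p j)) × (∀ {i j} → i ≢ j → ch (p i) ≢ ch (p j))
      frequent {v} xv nt with rich (sample (lab M v))
      ... | inj₂ r = r
      ... | inj₁ c = let j , e = c (xv , refl) in contradiction (sym e) (outside nt (lab M v) j)

      avoid : (c : Fin 3 → Fin n) → (∀ {i j} → i ≢ j → c i ≢ c j) → ∀ x y → ∃ λ j → c j ≢ x × c j ≢ y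
      avoid c inj x y with c zero Fin.≟ x | c zero Fin.≟ y
      ... | no a | no b = zero , a , b
      ... | yes refl | _ with c (suc zero) Fin.≟ y
      ...   | no b = suc zero , inj (λ ()) , b
      ...   | yes refl = suc (suc zero) , inj (λ ()) , inj (λ ())
      avoid c inj x y | no a | yes refl with c (suc zero) Fin.≟ x
      ...   | no b = suc zero , b , inj (λ ())
      ...   | yes refl = suc (suc zero) , inj (λ ()) , inj (λ ())

      row : ∀ {x v b} → Occurs b x → X v → ch x ≢ ch v → E x v ≡ adj M b (lab M v)
      row (xx , refl) xv ne = across M xx xv ne

      -- The label of `v` has samples in three children. One of them is neither that of `u` nor that
      -- of `u'`; its adjacency to `u` and to `u'`, equal by the types, gives the two entries.
      rows-agree : ∀ {u u' v} → X u → X u' → ty D u ≡ ty D u' → X v → ¬ T₀ v →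
        adj M (lab M v) (lab M u) ≡ adj M (lab M v) (lab M u')
      rows-agree {u} {u'} {v} xu xu' e xv nt =
        let occ , inj = frequent xv nt
            j , ne , ne' = avoid (λ j → ch (point (sample (lab M v)) j)) inj (ch u) (ch u')
        in trans (sym (row (occ j) xu ne)) (trans (sampled-≡ e (lab M v) j) (row (occ j) xu' ne'))

      -- Both entries are realised by one pair: `u` and a sample that has the label of `v` and lies
      -- in another child.
      adj-sym : ∀ {u v} → X u → X v → ¬ T₀ v → adj M (lab M v) (lab M u) ≡ adj M (lab M u) (lab M v)
      adj-sym {u} {v} xu xv nt =
        let occ , inj = frequent xv nt
            j , ne , _ = avoid (λ j → ch (point (sample (lab M v)) j)) inj (ch u) (ch u)
        in trans (sym (row (occ j) xu ne)) (trans (E-sym _ u)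
             (trans (row (xu , refl) (proj₁ (occ j)) (ne ∘ sym)) (cong (adj M (lab M u)) (proj₂ (occ j)))))

      -- A sample with the label of `u` lies in a sampled child, hence in another child than `v` and
      -- `v'`.
      columns-agree : ∀ {u v v'} → X u → X v → X v' → ty D v ≡ ty D v' → ¬ T₀ v → ¬ T₀ v' →
        adj M (lab M u) (lab M v) ≡ adj M (lab M u) (lab M v')
      columns-agree {u} xu xv xv' e nt nt' =
        let j , occ = hit (sample (lab M u)) (xu , refl)
        in trans (sym (row occ xv (outside nt (lab M u) j))) (trans (sampled-≡ e (lab M u) j)
             (row occ xv' (outside nt' (lab M u) j)))

      Separated : Fin n → Fin n → Set
      Separated u v = X u × X v × ch u ≢ ch v × ¬ (T₀ u × T₀ v)

      separated? : ∀ u v → Dec (Separated u v)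
      separated? u v = X? u ×-dec X? v ×-dec ¬? (ch u Fin.≟ ch v) ×-dec ¬? (T₀? u ×-dec T₀? v)

      separated-sym : ∀ {u v} → Separated u v → Separated v u
      separated-sym (xu , xv , ne , nt) = xv , xu , ne ∘ sym , λ (a , b) → nt (b , a)

      -- First `u` is exchanged for `u'` while `v` stays. To exchange `v` for `v'`, rows serve if
      -- `u'` is outside `T₀`, and columns if it is inside, for then `v'` is outside.
      homogeneous′ : ∀ {u v u' v'} → Separated u v → Separated u' v' → ty D u ≡ ty D u' → ty D v ≡ ty D v' →
        ¬ T₀ v → E u v ≡ E u' v'
      homogeneous′ {u} {v} {u'} {v'} (xu , xv , ne , _) (xu' , xv' , ne' , nt') eu ev nv =
        trans (E-sym u v) (trans (across M xv xu (ne ∘ sym)) (trans (rows-agree xu xu' eu xv nv)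
          (trans (adj-sym xu' xv nv) (trans last (sym (across M xu' xv' ne'))))))
        where
        last : adj M (lab M u') (lab M v) ≡ adj M (lab M u') (lab M v')
        last with T₀? u'
        ... | no nu' = rows-agree xv xv' ev xu' nu'
        ... | yes tu' = columns-agree xu' xv xv' ev nv (λ tv' → nt' (tu' , tv'))

      homogeneous : ∀ {u v u' v'} → Separated u v → Separated u' v' → ty D u ≡ ty D u' → ty D v ≡ ty D v' →
        E u v ≡ E u' v'
      homogeneous {u} {v} {u'} {v'} sp sp' eu ev with T₀? v
      ... | no nv = homogeneous′ sp sp' eu ev nv
      ... | yes tv = trans (E-sym u v) (trans
              (homogeneous′ (separated-sym sp) (separated-sym sp') ev eu (λ tu → proj₂ (proj₂ (proj₂ sp)) (tu , tv)))
              (E-sym v' u'))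

      flips = matrix Separated separated? (ty D) (ty D) E homogeneous
      z : Fin (Codes (2 ^ samples ℓ))
      z = proj₁ (decode-surjective (proj₁ flips))

      z-spec : ∀ {u v} → Separated u v → E u v ≡ decode z (ty D u) (ty D v)
      z-spec sp = trans (proj₂ flips sp) (sym (proj₂ (decode-surjective (proj₁ flips)) _ _))

      -- `Separated` leaves out pairs inside `T₀`, where types need not determine adjacency.
      -- Components of the flip are thus confined to one child or to `T₀`.
      Near : Fin n → Fin n → Set
      Near u v = ch u ≡ ch v ⊎ (T₀ u × T₀ v)

      T₀-resp : ∀ {u v} → ch u ≡ ch v → T₀ u → T₀ v
      T₀-resp e (i , e') = i , trans (sym e) e'

      near-trans : ∀ {u v w} → Near u v → Near v w → Near u w
      near-trans (inj₁ e) (inj₁ e') = inj₁ (trans e e')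
      near-trans (inj₁ e) (inj₂ (a , b)) = inj₂ (T₀-resp (sym e) a , b)
      near-trans (inj₂ (a , b)) (inj₁ e) = inj₂ (a , T₀-resp e b)
      near-trans (inj₂ (a , _)) (inj₂ (_ , b)) = inj₂ (a , b)

      flip⇒near : ∀ {u v} → Flip E D z X u v → Near u v
      flip⇒near {u} {v} (flipped xu xv d) with ch u Fin.≟ ch v | T₀? u ×-dec T₀? v
      ... | yes e | _ = inj₁ e
      ... | no _ | yes t = inj₂ t
      ... | no ne | no nt = contradiction d λ
              { (inj₁ x) → x (z-spec (xu , xv , ne , nt))
              ; (inj₂ x) → x (z-spec (separated-sym (xu , xv , ne , nt))) }

      linked⇒near : ∀ {u v} → Linked E D z X u v → Near u v
      linked⇒near = reach-preserves (λ _ → inj₁ refl) (λ nr e → near-trans nr (flip⇒near e)) (dist (samples ℓ))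

      -- A component inside `T₀` falls into boundedly many pieces, each within a sampled child, and
      -- these merge without extra depth; any other component lies in one child.
      part : ∀ u → X u → Mod E (grow ℓ) (suc k) (Linked E D z X u)
      part u xu = Merge.merge (linked? X? u) idx (lab M) (λ _ _ → adj M) cross piece
        where
        Y : Fin n → Set
        Y = Linked E D z X u
        Y⊆X : ∀ {v} → Y v → X v
        Y⊆X = linked-X (dist (samples ℓ)) xu
        -- The index is a function of the child, so that different indices imply different children.
        -- The default merely inhabits `Fin (samples ℓ)`.
        idx′ : Fin n → Fin (samples ℓ)
        idx′ c = Pick.pick (λ i → c Fin.≟ ch (s i)) (combine (lab M u) zero)
        idx : Fin n → Fin (samples ℓ)
        idx v = idx′ (ch v)
        idx-T₀ : ∀ {v} → T₀ v → ch v ≡ ch (s (idx v))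
        idx-T₀ {v} = Pick.pick-spec (λ i → ch v Fin.≟ ch (s i)) (combine (lab M u) zero)
        cross : ∀ {x y} → Y x → Y y → idx x ≢ idx y → E x y ≡ adj M (lab M x) (lab M y)
        cross yx yy ne = across M (Y⊆X yx) (Y⊆X yy) (ne ∘ cong idx′)
        piece : ∀ j → Mod E ℓ (suc k) (λ v → Y v × idx v ≡ j)
        piece j with T₀? u
        ... | yes tu = hered (suc k) (λ {v} (yv , e) → Y⊆X yv ,
                trans (idx-T₀ (inT₀ (linked⇒near yv))) (cong (ch ∘ s) e)) (sub M (ch (s j)))
          where
          inT₀ : ∀ {v} → Near u v → T₀ v
          inT₀ (inj₁ e) = T₀-resp e tu
          inT₀ (inj₂ (_ , t)) = t
        ... | no nu = hered (suc k) (λ (yv , _) → Y⊆X yv , same (linked⇒near yv)) (sub M (ch u))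
          where
          same : ∀ {v} → Near u v → ch v ≡ ch u
          same (inj₁ e) = sym e
          same (inj₂ (t , _)) = contradiction t nu

    Mod⇒shallow : ∀ ℓ k {X} → (∀ v → Dec (X v)) → Fin n → Mod E ℓ (suc k) X → Shallow E ℓ k X
    Mod⇒shallow ℓ zero {X} X? default M = s , λ u xu → lab M u , near u xu
      where
      occurs? : ∀ b v → Dec (X v × lab M v ≡ b)
      occurs? b v = X? v ×-dec (lab M v Fin.≟ b)
      s : Fin ℓ → Fin n
      s b = Pick.pick (occurs? b) default
      near : ∀ u → X u → X (s (lab M u)) × Twins E X u (s (lab M u))
      near u xu = let xs , e = Pick.pick-spec (occurs? (lab M u)) default (u , xu , refl) in
        xs , same-label⇒twins M xu xs (sym e)
    Mod⇒shallow ℓ (suc k) {X} X? default M = s , z ,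
      λ u xu → Mod⇒shallow (grow ℓ) k (linked? X? u) default (part u xu)
      where open Sampling X? M default

-- Positions in a model

-- The factor `suc (ℓ * 2)` is for a pigeonhole on the label and on whether the path ends; the other
-- factor leaves either `c` different children or enough positions in one child.
ramsey : (ℓ c k : ℕ) → ℕ
ramsey ℓ c zero = c
ramsey ℓ c (suc k) = suc (ℓ * 2) * suc (c * suc (ramsey ℓ c k))

ramseys : (ℓ c k q : ℕ) → ℕ
ramseys ℓ c k zero = c
ramseys ℓ c k (suc q) = ramsey ℓ (ramseys ℓ c k q) k

module Virtual {n} (E : Fin n → Fin n → Bool) (E-irr : ∀ v → E v v ≡ false) {ℓ : ℕ} where

  -- A position in a model: a node, reached by a path from the root, with a label at each node of the path.
  -- A position determines a neighbourhood as if a vertex were attached there; the positions at leaves include the vertices.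
  Position : ℕ → Set
  Position zero = ⊤
  Position (suc k) = Fin ℓ × Maybe (Fin n × Position k)

  height : ∀ k → Position k → ℕ
  height zero _ = 0
  height (suc k) (_ , nothing) = 0
  height (suc k) (_ , just (_ , d)) = suc (height k d)

  row : ∀ k {X} → Mod E ℓ k X → Position k → Fin n → Bool
  row zero M _ v = false
  row (suc k) M (a , nothing) v = adj M a (lab M v)
  row (suc k) M (a , just (i , d)) v = if ⌊ child M v Fin.≟ i ⌋ then row k (sub M i) d v else adj M a (lab M v)

  position : ∀ k {X} → Mod E ℓ k X → Fin n → Position k
  position zero M x = tt
  position (suc k) M x = lab M x , just (child M x , position k (sub M (child M x)) x)

  row-position : ∀ k {X} (M : Mod E ℓ k X) {x v} → X x → X v → row k M (position k M x) v ≡ E x v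
  row-position zero M {x} {v} xx xv with M x v xx xv
  ... | refl = sym (E-irr x)
  row-position (suc k) M {x} {v} xx xv with child M v Fin.≟ child M x
  ... | yes e = row-position k (sub M (child M x)) (xx , refl) (xv , e)
  ... | no ne = sym (across M xx xv (ne ∘ sym))

  height-position : ∀ k {X} (M : Mod E ℓ k X) x → height k (position k M x) ≡ k
  height-position zero M x = refl
  height-position (suc k) M x = cong suc (height-position k (sub M (child M x)) x)

  -- Constant, or a sunflower: each vertex sees at most one petal differently from the centre.
  Flower : ∀ k {X} → Mod E ℓ k X → ∀ {c} → (Fin c → Position k) → Position k → Set
  Flower k {X} M g e = (∀ j → g j ≡ e) ⊎
    ((∀ j → height k e < height k (g j)) ×
     (∀ {v} → X v → ∀ {i j} → i ≢ j → row k M (g i) v ≡ row k M e v ⊎ row k M (g j) v ≡ row k M e v))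

  subflower : ∀ k {X} (M : Mod E ℓ k X) {c c'} {g : Fin c → Position k} {e} (ι : Fin c' → Fin c) → Monotone ι →
    Flower k M g e → Flower k M (g ∘ ι) e
  subflower k M ι mono (inj₁ eq) = inj₁ (eq ∘ ι)
  subflower k M ι mono (inj₂ (h , r)) = inj₂ (h ∘ ι , λ xv ne → r xv (monotone-injective mono ne))

  private
    inject-mono : ∀ {a b} (le : a ≤ b) → Monotone (λ (i : Fin a) → Fin.inject≤ i le)
    inject-mono le i<j = subst₂ _<_ (sym (Finₚ.toℕ-inject≤ _ le)) (sym (Finₚ.toℕ-inject≤ _ le)) i<j

    tag : ∀ {A : Set} → Maybe A → Fin 2
    tag nothing = zero
    tag (just _) = suc zero

    untag₀ : ∀ {A : Set} (x : Maybe A) → tag x ≡ zero → x ≡ nothing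
    untag₀ nothing _ = refl

    untag₁ : ∀ {A : Set} (x : Maybe A) → tag x ≡ suc zero → ∃ λ y → x ≡ just y
    untag₁ (just y) _ = y , refl

  -- By pigeonhole all positions have the same label at the root and either all stop there, being
  -- equal, or all go on. Then many share a child, where the induction applies, or `c` enter
  -- different children. In the latter case the centre is the current node: a vertex lies in at most
  -- one of these children, and every other petal sees it as the node does.
  ramsey-flower : ∀ k {X} (M : Mod E ℓ k X) c {N} → ramsey ℓ c k ≤ N → (g : Fin N → Position k) →
    Σ (Fin c → Fin N) λ ι → Monotone ι × ∃ λ e → Flower k M (g ∘ ι) e
  ramsey-flower zero M c le g = (λ i → Fin.inject≤ i le) , inject-mono le , tt , inj₁ (λ _ → refl)
  ramsey-flower (suc k) {X} M c {N} le g
    with mono-equal (λ j → combine (proj₁ (g j)) (tag (proj₂ (g j)))) (c * suc (ramsey ℓ c k)) le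
  ... | ι₁ , mono₁ , a , eqs = finish (tag (proj₂ (g (ι₁ zero)))) refl
    where
    m = suc (c * suc (ramsey ℓ c k))
    α : Fin ℓ
    α = proj₁ (g (ι₁ zero))
    labels : ∀ j → proj₁ (g (ι₁ j)) ≡ α
    labels j = Finₚ.combine-injectiveˡ {ℓ} _ _ _ _ (trans (eqs j) (sym (eqs zero)))
    tags : ∀ j → tag (proj₂ (g (ι₁ j))) ≡ tag (proj₂ (g (ι₁ zero)))
    tags j = Finₚ.combine-injectiveʳ {ℓ} _ _ _ _ (trans (eqs j) (sym (eqs zero)))
    c≤m : c ≤ m
    c≤m = ℕₚ.≤-trans (ℕₚ.m≤m*n c (suc (ramsey ℓ c k))) (ℕₚ.n≤1+n _)
    finish : ∀ t → tag (proj₂ (g (ι₁ zero))) ≡ t →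
      Σ (Fin c → Fin N) λ ι → Monotone ι × ∃ λ e → Flower (suc k) M (g ∘ ι) e
    finish zero t₀ = (λ i → ι₁ (Fin.inject≤ i c≤m)) , (λ i<j → mono₁ (inject-mono c≤m i<j)) , (α , nothing) ,
      inj₁ (λ j → cong₂ _,_ (labels _) (untag₀ _ (trans (tags _) t₀)))
    finish (suc zero) t₁ = go (many Fin._≟_ idx c (ramsey ℓ c k) (ℕₚ.n≤1+n _))
      where
      down : ∀ j → ∃ λ y → proj₂ (g (ι₁ j)) ≡ just y
      down j = untag₁ _ (trans (tags j) t₁)
      idx : Fin m → Fin n
      idx j = proj₁ (proj₁ (down j))
      pos : Fin m → Position k
      pos j = proj₂ (proj₁ (down j))
      shape : ∀ j → g (ι₁ j) ≡ (α , just (idx j , pos j))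
      shape j = cong₂ _,_ (labels j) (proj₂ (down j))
      away : ∀ {i d v} → child M v ≢ i → row (suc k) M (α , just (i , d)) v ≡ adj M α (lab M v)
      away {i} {d} {v} ne with child M v Fin.≟ i
      ... | yes e = contradiction e ne
      ... | no _ = refl
      go : Many idx c (suc (ramsey ℓ c k)) → Σ (Fin c → Fin N) λ ι → Monotone ι × ∃ λ e → Flower (suc k) M (g ∘ ι) e
      go (inj₁ (ι₂ , mono₂ , dis)) = ι₁ ∘ ι₂ , (λ i<j → mono₁ (mono₂ i<j)) , (α , nothing) ,
        inj₂ ((λ j → subst (λ p → 0 < height (suc k) p) (sym (shape (ι₂ j))) (s≤s z≤n)) , rows)
        where
        rows : ∀ {v} → X v → ∀ {i j} → i ≢ j →
          row (suc k) M (g (ι₁ (ι₂ i))) v ≡ adj M α (lab M v) ⊎ row (suc k) M (g (ι₁ (ι₂ j))) v ≡ adj M α (lab M v)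
        rows {v} xv {i} {j} ne with child M v Fin.≟ idx (ι₂ i)
        ... | no ne' = inj₁ (trans (cong (λ p → row (suc k) M p v) (shape (ι₂ i))) (away ne'))
        ... | yes e = inj₂ (trans (cong (λ p → row (suc k) M p v) (shape (ι₂ j)))
                        (away (λ e' → dis ne (trans (sym e) e'))))
      go (inj₂ (ι₂ , mono₂ , i , same)) with ramsey-flower k (sub M i) c (ℕₚ.n≤1+n _) (pos ∘ ι₂)
      ... | ι₃ , mono₃ , e , fl = ι₁ ∘ ι₂ ∘ ι₃ , (λ i<j → mono₁ (mono₂ (mono₃ i<j))) , (α , just (i , e)) , lift fl
        where
        shape′ : ∀ j → g (ι₁ (ι₂ (ι₃ j))) ≡ (α , just (i , pos (ι₂ (ι₃ j))))
        shape′ j = trans (shape _) (cong (λ i → α , just (i , pos (ι₂ (ι₃ j)))) (same (ι₃ j)))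
        lift : Flower k (sub M i) (pos ∘ ι₂ ∘ ι₃) e → Flower (suc k) M (g ∘ ι₁ ∘ ι₂ ∘ ι₃) (α , just (i , e))
        lift (inj₁ eq) = inj₁ (λ j → trans (shape′ j) (cong (λ d → α , just (i , d)) (eq j)))
        lift (inj₂ (h , r)) = inj₂
          ((λ j → subst (λ p → suc (height k e) < height (suc k) p) (sym (shape′ j)) (s≤s (h j))) , rows)
          where
          rows : ∀ {v} → X v → ∀ {x y} → x ≢ y →
            row (suc k) M (g (ι₁ (ι₂ (ι₃ x)))) v ≡ row (suc k) M (α , just (i , e)) v ⊎
            row (suc k) M (g (ι₁ (ι₂ (ι₃ y)))) v ≡ row (suc k) M (α , just (i , e)) v
          rows {v} xv {x} {y} ne rewrite shape′ x | shape′ y with child M v Fin.≟ i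
          ... | yes e' = r (xv , e') ne
          ... | no _ = inj₁ refl

  ramsey-flowers : ∀ k {X} (M : Mod E ℓ k X) c q {N} → ramseys ℓ c k q ≤ N → (g : Fin q → Fin N → Position k) →
    Σ (Fin c → Fin N) λ ι → Monotone ι × Σ (Fin q → Position k) λ e → ∀ i → Flower k M (g i ∘ ι) (e i)
  ramsey-flowers k M c zero le g = (λ i → Fin.inject≤ i le) , inject-mono le , (λ ()) , λ ()
  ramsey-flowers k M c (suc q) le g with ramsey-flower k M (ramseys ℓ c k q) le (g zero)
  ... | ι₁ , mono₁ , e₁ , fl₁ with ramsey-flowers k M c q ℕₚ.≤-refl (λ i j → g (suc i) (ι₁ j))
  ...   | ι₂ , mono₂ , e₂ , fl₂ = ι₁ ∘ ι₂ , (λ i<j → mono₁ (mono₂ i<j)) , (λ { zero → e₁ ; (suc i) → e₂ i }) ,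
          λ { zero → subflower k M ι₂ mono₂ fl₁ ; (suc i) → fl₂ i }

total : ∀ {q} → (Fin q → ℕ) → ℕ
total {zero} f = 0
total {suc q} f = f zero + total (f ∘ suc)

total-≤ : ∀ {q} {f g : Fin q → ℕ} → (∀ i → f i ≤ g i) → total f ≤ total g
total-≤ {zero} le = z≤n
total-≤ {suc q} le = ℕₚ.+-mono-≤ (le zero) (total-≤ (le ∘ suc))

total-< : ∀ {q} {f g : Fin q → ℕ} → (∀ i → f i ≤ g i) → ∀ i → f i < g i → total f < total g
total-< le zero lt = ℕₚ.+-mono-<-≤ lt (total-≤ (le ∘ suc))
total-< le (suc i) lt = ℕₚ.+-mono-≤-< (le zero) (total-< (le ∘ suc) i lt)

total-const : ∀ q c → total {q} (λ _ → c) ≡ q * c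
total-const zero c = refl
total-const (suc q) c = cong (c +_) (total-const q c)

-- Iterated sunflowers of parameters

maj : Bool → Bool → Bool → Bool
maj a b c = (a ∧ b) ∨ (b ∧ c) ∨ (a ∧ c)

maj-cong : ∀ {a b c a' b' c'} → a ≡ a' → b ≡ b' → c ≡ c' → maj a b c ≡ maj a' b' c'
maj-cong refl refl refl = refl

AtMostOne : ∀ {c} → (Fin c → Set) → Set
AtMostOne Agrees = ∀ i j → i ≢ j → Agrees i ⊎ Agrees j

maj-≡ : (x : Fin 3 → Bool) (b : Bool) → AtMostOne (λ i → x i ≡ b) →
  maj (x zero) (x (suc zero)) (x (suc (suc zero))) ≡ b
maj-≡ x b h with x zero | x (suc zero) | x (suc (suc zero))
  | h zero (suc zero) (λ ()) | h (suc zero) (suc (suc zero)) (λ ()) | h zero (suc (suc zero)) (λ ())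
... | true | true | _ | inj₁ refl | _ | _ = refl
... | true | true | _ | inj₂ refl | _ | _ = refl
... | true | false | true | _ | _ | inj₁ refl = refl
... | true | false | true | _ | _ | inj₂ refl = refl
... | true | false | false | _ | inj₁ refl | _ = refl
... | true | false | false | _ | inj₂ refl | _ = refl
... | false | true | true | _ | inj₁ refl | _ = refl
... | false | true | true | _ | inj₂ refl | _ = refl
... | false | true | false | _ | _ | inj₁ refl = refl
... | false | true | false | _ | _ | inj₂ refl = refl
... | false | false | _ | inj₁ refl | _ | _ = refl
... | false | false | _ | inj₂ refl | _ | _ = refl

-- Each property fails for at most one of the three indices.
common : {P Q : Fin 3 → Set} → AtMostOne P → AtMostOne Q → ∃ λ i → P i × Q i
common {P} {Q} p q with p zero (suc zero) (λ ()) | q zero (suc zero) (λ ())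
... | inj₁ a | inj₁ b = _ , a , b
... | inj₂ a | inj₂ b = _ , a , b
... | inj₁ a | inj₂ b with p (suc zero) (suc (suc zero)) (λ ()) | q zero (suc (suc zero)) (λ ())
...   | inj₁ a' | _ = _ , a' , b
...   | _ | inj₁ b' = _ , a , b'
...   | inj₂ a' | inj₂ b' = _ , a' , b'
common {P} {Q} p q | inj₂ a | inj₁ b with q (suc zero) (suc (suc zero)) (λ ()) | p zero (suc (suc zero)) (λ ())
...   | inj₁ b' | _ = _ , a , b'
...   | _ | inj₁ a' = _ , a' , b
...   | inj₂ b' | inj₂ a' = _ , a' , b'

module Generic (ℓ₀ k K q : ℕ) where
  open Recursion ℓ₀ K public

  abstract
    -- The first summand lets three petals form a flower of positions. The second leaves a petal
    -- that agrees with the centre at both ends of each of the `dist q` edges of a walk, since at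
    -- most `q` petals deviate at a vertex.
    extraPetals : ℕ
    extraPetals = ramseys ℓ₀ 3 K q + dist q * (q + q)

    extraPetals-ramsey : ramseys ℓ₀ 3 K q ≤ extraPetals
    extraPetals-ramsey = ℕₚ.m≤m+n _ _

    extraPetals-dist : dist q * (q + q) ≤ extraPetals
    extraPetals-dist = ℕₚ.m≤n+m _ (ramseys ℓ₀ 3 K q)

  petals : ℕ
  petals = 3 + extraPetals

  codeSize : ℕ → ℕ
  codeSize zero = q
  codeSize (suc r) = petals * codeSize r

  Code : ℕ → ℕ → Set
  Code r n = Fin (codeSize r) → Fin n

  slice : ∀ {A : Set} {N} → (Fin (petals * N) → A) → Fin petals → Fin N → A
  slice t j i = t (combine j i)

  -- In a sunflower any three petals have the centre as their majority, so the first three are used.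
  sets : ∀ r {n} (E : Fin n → Fin n → Bool) → Code r n → Fin q → Fin n → Bool
  sets zero E t i v = E (t i) v
  sets (suc r) E t i v = maj (sets r E (slice t zero) i v) (sets r E (slice t (suc zero)) i v)
    (sets r E (slice t (suc (suc zero))) i v)

  Differ : ∀ r {n} (E : Fin n → Fin n → Bool) → Code r n → Code r n → Set
  Differ r E t t' = ∃ λ i → ∃ λ v → sets r E t i v ≢ sets r E t' i v

  Centred : ∀ r {n} (E : Fin n → Fin n → Bool) → Code (suc r) n → Set
  Centred r E t = ∀ i v → AtMostOne (λ j → sets r E (slice t j) i v ≡ sets (suc r) E t i v)

  -- Generation 0: the parameters for which the flip by z has shallow components;
  -- generation suc r: centres of sunflowers of distinct members of generation r.
  Family : ∀ {n} (E : Fin n → Fin n → Bool) (z : Fin (Codes (2 ^ q))) r → Code r n → Set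
  Family E z zero t = ∀ u → Shallow E (grow ℓ₀) k (Linked E (sets zero E t) z (λ _ → ⊤) u)
  Family E z (suc r) t = (∀ j → Family E z r (slice t j)) ×
    (∀ j j' → j ≢ j' → Differ r E (slice t j) (slice t j')) × Centred r E t

  sets-cong : ∀ r {n} (E : Fin n → Fin n → Bool) {t t' : Code r n} → t ≗ t' → ∀ i v → sets r E t i v ≡ sets r E t' i v
  sets-cong zero E e i v = cong (λ x → E x v) (e i)
  sets-cong (suc r) E {t} {t'} e i v = maj-cong (at zero) (at (suc zero)) (at (suc (suc zero)))
    where
    at : ∀ j → sets r E (slice t j) i v ≡ sets r E (slice t' j) i v
    at j = sets-cong r E (λ x → e (combine j x)) i v

  differ? : ∀ r {n} (E : Fin n → Fin n → Bool) t t' → Dec (Differ r E t t')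
  differ? r E t t' = Finₚ.any? λ i → Finₚ.any? λ v → ¬? (_ Bool.≟ _)

  partLabels : ℕ → ℕ
  partLabels zero = shallowLabels (grow ℓ₀) k
  partLabels (suc r) = petals * (partLabels r * ((2 ^ q) ^ petals))

  -- The positions of `q` vertices have total height `q * K`, and every generation lowers the total.
  maxRank : ℕ
  maxRank = q * K

  topSize : ℕ
  topSize = ramseys ℓ₀ petals K q

  module _ {n} {E : Fin n → Fin n → Bool} (E-sym : ∀ u v → E u v ≡ E v u) (E-irr : ∀ v → E v v ≡ false)
    (M₀ : Mod E ℓ₀ K (λ _ → ⊤)) (z : Fin (Codes (2 ^ q))) where

    Component : ∀ r → Code r n → Fin n → Fin n → Set
    Component r t = Linked E (sets r E t) z (λ _ → ⊤)

    component? : ∀ r t u v → Dec (Component r t u v)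
    component? r t = linked? (λ _ → yes tt)

    module Centre r (t : Code (suc r) n) (centred : Centred r E t) where

      D : Fin q → Fin n → Bool
      D = sets (suc r) E t
      Dᵖ : Fin petals → Fin q → Fin n → Bool
      Dᵖ j = sets r E (slice t j)

      -- Being centred allows at most one deviating petal for each of the `q` coordinates; a
      -- coordinate without one contributes the harmless entry `zero`.
      deviating : ∀ w → Σ (List (Fin petals)) λ xs → length xs ≡ q × (∀ {j} → j ∉ xs → ∀ i → Dᵖ j i w ≡ D i w)
      deviating w = tabulate bad , Listₚ.length-tabulate bad , spec
        where
        bad? : ∀ i → Dec (∃ λ j → Dᵖ j i w ≢ D i w)
        bad? i = Finₚ.any? λ j → ¬? (Dᵖ j i w Bool.≟ D i w)
        bad : Fin q → Fin petals
        bad i = case bad? i of λ { (yes (j , _)) → j ; (no _) → zero }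
        bad-spec : ∀ i j → Dᵖ j i w ≢ D i w → j ≡ bad i
        bad-spec i j ne with bad? i
        ... | no none = contradiction (j , ne) none
        ... | yes (j' , ne') with j Fin.≟ j'
        ...   | yes e = e
        ...   | no j≢j' = contradiction (centred i w j j' j≢j') [ ne , ne' ]′
        spec : ∀ {j} → j ∉ tabulate bad → ∀ i → Dᵖ j i w ≡ D i w
        spec {j} j∉ i = decidable-stable (Dᵖ j i w Bool.≟ D i w)
          (λ ne → j∉ (subst (_∈ tabulate bad) (sym (bad-spec i j ne)) (∈ₚ.∈-tabulate⁺ i)))

      -- Types decide which adjacencies are flipped, so a petal that agrees with the centre at all
      -- vertices of the walk sees the same walk.
      transfer : ∀ m {u v} → Reach (Flip E D z (λ _ → ⊤)) m u v →
        Σ (List (Fin petals)) λ xs → length xs ≤ m * (q + q) ×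
          (∀ {j} → j ∉ xs → Reach (Flip E (Dᵖ j) z (λ _ → ⊤)) m u v)
      transfer zero e = [] , z≤n , λ _ → e
      transfer (suc m) (inj₁ r) = let xs , le , f = transfer m r in
        xs , ℕₚ.≤-trans le (ℕₚ.m≤n+m _ (q + q)) , λ j∉ → inj₁ (f j∉)
      transfer (suc m) {u} {v} (inj₂ (w , r , flipped _ _ d)) =
        let xs , le , f = transfer m r
            ys , ly , g = deviating w
            ys' , ly' , g' = deviating v
            open ℕₚ.≤-Reasoning
        in (ys ++ ys') ++ xs ,
           (begin
              length ((ys ++ ys') ++ xs) ≡⟨ Listₚ.length-++ (ys ++ ys') ⟩
              length (ys ++ ys') + length xs ≡⟨ cong (_+ length xs) (trans (Listₚ.length-++ ys) (cong₂ _+_ ly ly')) ⟩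
              (q + q) + length xs ≤⟨ ℕₚ.+-monoʳ-≤ (q + q) le ⟩
              (q + q) + m * (q + q) ∎) ,
           λ {j} j∉ → inj₂ (w , f (j∉ ∘ ∈ₚ.∈-++⁺ʳ (ys ++ ys')) , flipped tt tt
             (subst₂ (λ a b → E w v ≢ decode z a b ⊎ E v w ≢ decode z b a)
               (sym (ty-≡ {D = Dᵖ j} {D' = D} (g (j∉ ∘ ∈ₚ.∈-++⁺ˡ ∘ ∈ₚ.∈-++⁺ˡ))))
               (sym (ty-≡ {D = Dᵖ j} {D' = D} (g' (j∉ ∘ ∈ₚ.∈-++⁺ˡ ∘ ∈ₚ.∈-++⁺ʳ ys)))) d))

      covered : ∀ {u v} → Component (suc r) t u v → ∃ λ j → Component r (slice t j) u v
      covered c = let xs , le , f = transfer (dist q) c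
                      j , j∉ = missing xs (s≤s (ℕₚ.≤-trans le (ℕₚ.≤-trans extraPetals-dist (ℕₚ.m≤n+m extraPetals 2))))
                  in j , f j∉

      -- By the choice of first j, pieces i < j are separated by the component of u in the i-th flip.
      part : (∀ j u → Mod E (partLabels r) (suc k) (Component r (slice t j) u)) →
        ∀ u → Mod E (partLabels (suc r)) (suc k) (Component (suc r) t u)
      part parts u = Merge.merge (component? (suc r) t u) idx lab₂ A₂ cross
          (λ j → hered (suc k) (λ { (c , refl) → idx-spec c }) (parts j u))
        where
        module At v = Pick (λ j → component? r (slice t j) u v) zero
        idx : Fin n → Fin petals
        idx v = At.pick v
        idx-spec : ∀ {v} → Component (suc r) t u v → Component r (slice t (idx v)) u v
        idx-spec {v} c = At.pick-spec v (covered c)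
        idx-least : ∀ {v} → Component (suc r) t u v → ∀ {i} → i Fin.< idx v → ¬ Component r (slice t i) u v
        idx-least {v} c = At.pick-least v (covered c)
        lab₂ : Fin n → Fin ((2 ^ q) ^ petals)
        lab₂ v = funToFin (λ j → ty (Dᵖ j) v)
        A₂ : Fin petals → Fin petals → Fin ((2 ^ q) ^ petals) → Fin ((2 ^ q) ^ petals) → Bool
        A₂ i j a b with Finₚ.<-cmp i j
        ... | tri< _ _ _ = decode {2 ^ q} z (finToFun a i) (finToFun b i)
        ... | _ = decode {2 ^ q} z (finToFun a j) (finToFun b j)
        lab₂-spec : ∀ v j → finToFun (lab₂ v) j ≡ ty (Dᵖ j) v
        lab₂-spec v j = Finₚ.finToFun-funToFin (λ j → ty (Dᵖ j) v) j
        at : ∀ {x y} j → ¬ Component r (slice t j) x y → E x y ≡ decode {2 ^ q} z (finToFun (lab₂ x) j) (finToFun (lab₂ y) j)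
        at {x} {y} j nc = trans (unlinked M₀ tt tt nc) (cong₂ (decode {2 ^ q} z) (sym (lab₂-spec x j)) (sym (lab₂-spec y j)))
        cross : ∀ {x y} → Component (suc r) t u x → Component (suc r) t u y → idx x ≢ idx y →
          E x y ≡ A₂ (idx x) (idx y) (lab₂ x) (lab₂ y)
        cross {x} {y} cx cy ne with Finₚ.<-cmp (idx x) (idx y)
        ... | tri< lt _ _ = at (idx x) (λ c → idx-least cy lt (linked-trans M₀ (idx-spec cx) c))
        ... | tri≈ _ e _ = contradiction e ne
        ... | tri> _ _ gt = at (idx y) (λ c → idx-least cx gt (linked-trans M₀ (idx-spec cy) (linked-sym M₀ c)))

    family⇒Mod : ∀ r t → Family E z r t → ∀ u → Mod E (partLabels r) (suc k) (Component r t u)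
    family⇒Mod zero t F u = shallow⇒Mod E-sym M₀ (grow ℓ₀) k (component? zero t u) (F u)
    family⇒Mod (suc r) t (F , _ , centred) = Centre.part r t centred (λ j → family⇒Mod r (slice t j) (F j))

    open Virtual E E-irr {ℓ₀}

    Realised : ∀ r → Code r n → (Fin q → Position K) → Set
    Realised r t d = ∀ i v → sets r E t i v ≡ row K M₀ (d i) v

    flower-atMostOne : ∀ {c r} {ts : Fin c → Code r n} {d : Fin c → Fin q → Position K} → (∀ j → Realised r (ts j) (d j)) →
      ∀ {e : Fin q → Position K} {i} → Flower K M₀ (λ j → d j i) (e i) → ∀ v →
      AtMostOne (λ j → sets r E (ts j) i v ≡ row K M₀ (e i) v)
    flower-atMostOne real {i = i} (inj₁ eq) v j _ _ = inj₁ (trans (real j i v) (cong (λ d → row K M₀ d v) (eq j)))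
    flower-atMostOne real {i = i} (inj₂ (_ , r)) v j j' ne = Sum.map (trans (real j i v)) (trans (real j' i v)) (r tt ne)

    -- Three petals are chosen whose positions form flowers in all coordinates. The centres realise
    -- the majority sets, because at every vertex one of the three petals agrees with both
    -- (`common`). Distinct petals differ in some coordinate; its flower is not constant, so the
    -- total height drops.
    realise : ∀ r t → Family E z r t → Σ (Fin q → Position K) λ d → Realised r t d × total (height K ∘ d) + r ≤ maxRank
    realise zero t F = (λ i → position K M₀ (t i)) , (λ i v → sym (row-position K M₀ tt tt)) ,
      ℕₚ.≤-reflexive (trans (ℕₚ.+-identityʳ _) (trans (cong-total (λ i → height-position K M₀ (t i))) (total-const q K)))
      where
      cong-total : ∀ {q} {f g : Fin q → ℕ} → f ≗ g → total f ≡ total g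
      cong-total {zero} e = refl
      cong-total {suc q} e = cong₂ _+_ (e zero) (cong-total (e ∘ suc))
    realise (suc r) t (F , differ , centred) with ramsey-flowers K M₀ 3 q
      (ℕₚ.≤-trans extraPetals-ramsey (ℕₚ.m≤n+m extraPetals 3))
      (λ i j → proj₁ (realise r (slice t j) (F j)) i)
    ... | ι , mono , e , fl = e , real , bound
      where
      d : Fin petals → Fin q → Position K
      d j = proj₁ (realise r (slice t j) (F j))
      real : Realised (suc r) t e
      real i v = let a , p , p' = common
                       (flower-atMostOne {r = r} {ts = λ a → slice t (ι a)} {d = d ∘ ι}
                         (λ a → proj₁ (proj₂ (realise r (slice t (ι a)) (F (ι a))))) {e} (fl i) v)
                       (λ a b ne → centred i v (ι a) (ι b) (monotone-injective mono ne))
                 in trans (sym p') p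
      heights : ∀ i → height K (e i) ≤ height K (d (ι zero) i)
      heights i with fl i
      ... | inj₁ eq = ℕₚ.≤-reflexive (cong (height K) (sym (eq zero)))
      ... | inj₂ (h , _) = ℕₚ.<⇒≤ (h zero)
      strict : total (height K ∘ e) < total (height K ∘ d (ι zero))
      strict with differ (ι zero) (ι (suc zero)) (monotone-injective mono {zero} {suc zero} (λ ()))
      ... | i , v , ne with fl i
      ...   | inj₂ (h , _) = total-< heights i (h zero)
      ...   | inj₁ eq = contradiction
              (trans (at zero) (sym (at (suc zero)))) ne
        where
        at : ∀ a → sets r E (slice t (ι a)) i v ≡ row K M₀ (e i) v
        at a = trans (proj₁ (proj₂ (realise r (slice t (ι a)) (F (ι a)))) i v) (cong (λ d → row K M₀ d v) (eq a))
      bound : total (height K ∘ e) + suc r ≤ maxRank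
      bound = ℕₚ.≤-trans (ℕₚ.≤-reflexive (ℕₚ.+-suc _ r)) (ℕₚ.≤-trans (ℕₚ.+-monoˡ-≤ r strict)
        (proj₂ (proj₂ (realise r (slice t (ι zero)) (F (ι zero))))))

    no-family : ∀ t → ¬ Family E z (suc maxRank) t
    no-family t F = ℕₚ.<-irrefl refl (ℕₚ.≤-trans (ℕₚ.m≤n+m _ _) (proj₂ (proj₂ (realise (suc maxRank) t F))))

    module _ (family-ext : ∀ r {t t'} → t ≗ t' → Family E z r t → Family E z r t')
             (family? : ∀ r t → Dec (Family E z r t)) where

      -- Among `topSize` positions some `petals` form flowers, and the centre of the resulting
      -- sunflower of sets would belong to the next generation.
      few-distinct : ∀ r → ¬ (∃ λ t → Family E z (suc r) t) → (ts : Fin topSize → Code r n) →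
        (∀ j → Family E z r (ts j)) → (∀ {i j} → i ≢ j → Differ r E (ts i) (ts j)) → ⊥
      few-distinct r none ts F differ with ramsey-flowers K M₀ petals q ℕₚ.≤-refl
        (λ i j → proj₁ (realise r (ts j) (F j)) i)
      ... | ι , mono , e , fl = none (t , (λ j → family-ext r (sym ∘ slice-t j) (F (ι j))) , distinct , centred)
        where
        t : Code (suc r) n
        t x = ts (ι (quotient (codeSize r) x)) (remainder {petals} (codeSize r) x)
        slice-t : ∀ j → slice t j ≗ ts (ι j)
        slice-t j x = cong (λ (a , b) → ts (ι a) b) (Finₚ.remQuot-combine j x)
        same : ∀ j i v → sets r E (slice t j) i v ≡ sets r E (ts (ι j)) i v
        same j = sets-cong r E (slice-t j)
        distinct : ∀ j j' → j ≢ j' → Differ r E (slice t j) (slice t j')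
        distinct j j' ne = let i , v , ne' = differ (monotone-injective mono ne) in
          i , v , λ e → ne' (trans (sym (same j i v)) (trans e (same j' i v)))
        near : ∀ i v → AtMostOne (λ j → sets r E (slice t j) i v ≡ row K M₀ (e i) v)
        near i v j j' ne = Sum.map (trans (same j i v)) (trans (same j' i v))
          (flower-atMostOne {r = r} {ts = ts ∘ ι} {d = λ a → proj₁ (realise r (ts (ι a)) (F (ι a)))}
            (λ a → proj₁ (proj₂ (realise r (ts (ι a)) (F (ι a))))) {e} (fl i) v j j' ne)
        centre : ∀ i v → sets (suc r) E t i v ≡ row K M₀ (e i) v
        centre i v = maj-≡ (λ a → sets r E (slice t (a Fin.↑ˡ extraPetals)) i v) _
          (λ a b ne → near i v _ _ (ne ∘ Finₚ.↑ˡ-injective extraPetals a b))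
        centred : Centred r E t
        centred i v j j' ne = Sum.map (λ p → trans p (sym (centre i v))) (λ p → trans p (sym (centre i v))) (near i v j j' ne)

      Cover : ∀ r m → Set
      Cover r m = Σ (Fin m → Code r n) λ ts → ∀ t → Family E z r t → ∃ λ j → ∀ i v → sets r E t i v ≡ sets r E (ts j) i v

      -- Distinct members are collected greedily; by `few-distinct` the collection stops before it
      -- has `topSize` members, and `default` pads the list.
      cover : ∀ r → Code r n → ¬ (∃ λ t → Family E z (suc r) t) → Cover r topSize
      cover r default none with grown topSize
        where
        cons-code : ∀ {m} → Code r n → (Fin m → Code r n) → Fin (suc m) → Code r n
        cons-code t ts zero = t
        cons-code t ts (suc j) = ts j
        grown : ∀ m → Cover r m ⊎ Σ (Fin m → Code r n) λ ts →
          (∀ j → Family E z r (ts j)) × (∀ {i j} → i ≢ j → Differ r E (ts i) (ts j))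
        grown zero = inj₂ ((λ ()) , (λ ()) , λ { {()} })
        grown (suc m) with grown m
        ... | inj₁ (ts , cov) = inj₁ (cons-code default ts , λ t F → let j , e = cov t F in suc j , e)
        ... | inj₂ (ts , F , differ) with anyFun?
                {P = λ t → Family E z r t × ∀ j → Differ r E t (ts j)}
                (λ e (Ft , d) → family-ext r e Ft , λ j → let i , v , ne = d j in
                  i , v , λ e' → ne (trans (sets-cong r E e i v) e'))
                (λ t → family? r t ×-dec Finₚ.all? (λ j → differ? r E t (ts j)))
        ...   | yes (t , Ft , d) = inj₂ (cons-code t ts , (λ { zero → Ft ; (suc j) → F j }) ,
                  λ { {zero} {zero} ne → contradiction refl ne
                    ; {zero} {suc j} _ → d j
                    ; {suc i} {zero} _ → let x , v , ne' = d i in x , v , ne' ∘ sym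
                    ; {suc i} {suc j} ne → differ (ne ∘ cong suc) })
        ...   | no nomore = inj₁ (cons-code default ts , λ t Ft →
                  let j , same = Finₚ.¬∀⟶∃¬ m (λ j → Differ r E t (ts j)) (λ j → differ? r E t (ts j))
                                   (λ d → nomore (t , Ft , d))
                  in suc j , λ i v → decidable-stable (_ Bool.≟ _) (λ ne → same (i , v , ne)))
      ... | inj₁ c = c
      ... | inj₂ (ts , F , differ) = ⊥-elim (few-distinct r none ts F differ)

-- Meets of dicings

module Refinement {n} {Θ A : Set} (link : Θ → Fin n → Fin n → Set) (type : Θ → Fin n → A) where

  All-linked : Fin n → Fin n → Set
  All-linked u v = ∀ θ → link θ u v

  Same-type : Fin n → Fin n → Set
  Same-type u v = ∀ θ → type θ u ≡ type θ v

  Narrow : Fin n → Set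
  Narrow a = ∀ x y → Same-type a x → Same-type a y → All-linked a x ⊎ All-linked a y ⊎ All-linked x y

  -- Links to all vertices could produce unboundedly many parts. A narrow type meets at most two
  -- classes of `All-linked`, so the links to narrow vertices are bounded information.
  Refined : Fin n → Fin n → Set
  Refined u v = Same-type u v × (∀ a → Narrow a → ∀ θ → (link θ u a → link θ v a) × (link θ v a → link θ u a))

-- Suppose that the unlinked pairs u₀v₀ and u₁v₁ of equal types disagree on adjacency. Each pair of these types
-- is linked by every θ that predicts the opposite of its adjacency; this forces u₀ and u₁, or v₀ and v₁, to be
-- linked by all θ, and the type on that side to meet at most two classes.
module Meet {n} {E : Fin n → Fin n → Bool} (E-sym : ∀ u v → E u v ≡ E v u) {Θ A : Set}
  (link : Θ → Fin n → Fin n → Set) (link? : ∀ θ u v → Dec (link θ u v))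
  (link-sym : ∀ θ {u v} → link θ u v → link θ v u)
  (link-trans : ∀ θ {u v w} → link θ u v → link θ v w → link θ u w)
  (type : Θ → Fin n → A) (value : Θ → A → A → Bool)
  (dicing : ∀ θ {u v} → ¬ link θ u v → E u v ≡ value θ (type θ u) (type θ v)) where

  open Refinement link type

  private
    module Conflict {u₀ u₁ v₀ v₁} (Z : Θ → Bool)
      (dice : ∀ θ {x y} → Same-type u₀ x → Same-type v₀ y → ¬ link θ x y → E x y ≡ Z θ)
      (e₁ : E u₁ v₁ ≡ not (E u₀ v₀))
      (su : Same-type u₀ u₁) (sv : Same-type v₀ v₁)
      (n₀ : ¬ All-linked u₀ v₀) (n₁ : ¬ All-linked u₁ v₁) where

      e = E u₀ v₀

      -- `Q e` and `Q (not e)` are symmetric and transitive with meet `All-linked`; every pair with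
      -- one end of each type lies in one of them, according to its adjacency.
      Q : Bool → Fin n → Fin n → Set
      Q b x y = ∀ θ → Z θ ≡ b → link θ x y

      Q-sym : ∀ {b x y} → Q b x y → Q b y x
      Q-sym q θ eq = link-sym θ (q θ eq)

      Q-trans : ∀ {b x y w} → Q b x y → Q b y w → Q b x w
      Q-trans q r θ eq = link-trans θ (q θ eq) (r θ eq)

      split : ∀ b → b ≡ e ⊎ b ≡ not e
      split b with b Bool.≟ e
      ... | yes p = inj₁ p
      ... | no ne = inj₂ (Boolₚ.¬-not ne)

      both : ∀ {x y} → Q e x y → Q (not e) x y → All-linked x y
      both q r θ with split (Z θ)
      ... | inj₁ p = q θ p
      ... | inj₂ p = r θ p

      opposite : ∀ {x y} → Same-type u₀ x → Same-type v₀ y → ∀ {b} → E x y ≡ not b → Q b x y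
      opposite {x} {y} sx sy {b} eq θ zθ = decidable-stable (link? θ x y) λ nl →
        Boolₚ.not-¬ {b} refl (trans (sym zθ) (trans (sym (dice θ sx sy nl)) eq))

      refl-type : ∀ {x} → Same-type x x
      refl-type θ = refl

      either : ∀ {x y} → Same-type u₀ x → Same-type v₀ y → Q e x y ⊎ Q (not e) x y
      either {x} {y} sx sy with split (E x y)
      ... | inj₁ p = inj₂ (opposite sx sy (trans p (sym (Boolₚ.not-involutive e))))
      ... | inj₂ p = inj₁ (opposite sx sy p)

      q₁-u₀v₀ : Q (not e) u₀ v₀
      q₁-u₀v₀ = opposite refl-type refl-type (sym (Boolₚ.not-involutive e))

      ¬q₀-u₀v₀ : ¬ Q e u₀ v₀
      ¬q₀-u₀v₀ q = n₀ (both q q₁-u₀v₀)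

      q₀-u₁v₁ : Q e u₁ v₁
      q₀-u₁v₁ = opposite su sv e₁

      ¬q₁-u₁v₁ : ¬ Q (not e) u₁ v₁
      ¬q₁-u₁v₁ q = n₁ (both q₀-u₁v₁ q)

      -- The links of `x` to `v₀` and `v₁` fix its class: of the four outcomes of `either`, two
      -- contradict `¬q₀-u₀v₀` or `¬q₁-u₁v₁`, and the other two describe one class each.
      narrow : All-linked u₀ u₁ → Narrow u₀
      narrow p x y sx sy with locate sx | locate sy
        where
        q₀-u₀v₁ : Q e u₀ v₁
        q₀-u₀v₁ = Q-trans (λ θ _ → p θ) q₀-u₁v₁
        locate : ∀ {x} → Same-type u₀ x → All-linked u₀ x ⊎ (Q e x v₀ × Q (not e) x v₁)
        locate {x} sx with either sx refl-type | either sx sv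
        ... | inj₁ a | inj₂ b = inj₂ (a , b)
        ... | inj₁ a | inj₁ b = contradiction (Q-trans q₀-u₀v₁ (Q-trans (Q-sym b) a)) ¬q₀-u₀v₀
        ... | inj₂ a | inj₁ b = inj₁ (both (Q-trans q₀-u₀v₁ (Q-sym b)) (Q-trans q₁-u₀v₀ (Q-sym a)))
        ... | inj₂ a | inj₂ b = contradiction
                (Q-trans (λ θ _ → link-sym θ (p θ)) (Q-trans q₁-u₀v₀ (Q-trans (Q-sym a) b))) ¬q₁-u₁v₁
      ... | inj₁ a | _ = inj₁ a
      ... | inj₂ _ | inj₁ b = inj₂ (inj₁ b)
      ... | inj₂ (a , b) | inj₂ (c , d) = inj₂ (inj₂ (both (Q-trans a (Q-sym c)) (Q-trans b (Q-sym d))))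

      -- If a `θ` predicting `e` left `u₀` and `v₀` unlinked, then, `u₀` being narrow and linked to
      -- `u₁`, refinement would leave `u₁` and `v₁` unlinked too, where the prediction `e` is wrong.
      linked-case : All-linked u₀ u₁ → (∀ a → Narrow a → ∀ θ → link θ v₁ a → link θ v₀ a) → ⊥
      linked-case p refined = ¬q₀-u₀v₀ λ θ zθ → decidable-stable (link? θ u₀ v₀) λ nl →
        let nl₁ : ¬ link θ u₁ v₁
            nl₁ l = nl (link-sym θ (refined u₀ (narrow p) θ (link-trans θ (link-sym θ l) (link-sym θ (p θ)))))
        in Boolₚ.not-¬ {e} refl (trans (sym zθ) (trans (sym (dice θ su sv nl₁)) e₁))

      sides : All-linked u₀ u₁ ⊎ All-linked v₀ v₁
      sides with either {u₀} refl-type sv | either {y = v₀} su refl-type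
      ... | inj₁ a | inj₁ b = contradiction (Q-trans a (Q-trans (Q-sym q₀-u₁v₁) b)) ¬q₀-u₀v₀
      ... | inj₁ a | inj₂ b = inj₁ (both (Q-trans a (Q-sym q₀-u₁v₁)) (Q-trans q₁-u₀v₀ (Q-sym b)))
      ... | inj₂ a | inj₁ b = inj₂ (both (Q-trans (Q-sym b) q₀-u₁v₁) (Q-trans (Q-sym q₁-u₀v₀) a))
      ... | inj₂ a | inj₂ b = contradiction (Q-trans b (Q-trans (Q-sym q₁-u₀v₀) a)) ¬q₁-u₁v₁

  refined-homogeneous : ∀ {u₀ u₁ v₀ v₁} → Refined u₀ u₁ → Refined v₀ v₁ →
    ¬ All-linked u₀ v₀ → ¬ All-linked u₁ v₁ → E u₀ v₀ ≡ E u₁ v₁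
  refined-homogeneous {u₀} {u₁} {v₀} {v₁} (su , ru) (sv , rv) n₀ n₁ =
    decidable-stable (_ Bool.≟ _) λ ne →
      let dice : ∀ θ {x y} → Same-type u₀ x → Same-type v₀ y → ¬ link θ x y → E x y ≡ value θ (type θ u₀) (type θ v₀)
          dice θ sx sy nl = trans (dicing θ nl) (cong₂ (value θ) (sym (sx θ)) (sym (sy θ)))
          e₁ : E u₁ v₁ ≡ not (E u₀ v₀)
          e₁ = Boolₚ.¬-not (ne ∘ sym)
          open Conflict _ dice e₁ su sv n₀ n₁
      in case sides of λ
        { (inj₁ p) → linked-case p (λ a na θ → proj₂ (rv a na θ))
        -- The same argument with the two sides of the pairs exchanged.
        ; (inj₂ p) → Conflict.linked-case (λ θ → value θ (type θ u₀) (type θ v₀))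
            (λ θ {y} {x} sy sx nl → trans (E-sym y x) (dice θ sx sy (nl ∘ link-sym θ)))
            (trans (E-sym v₁ u₁) (trans e₁ (cong not (E-sym u₀ v₀)))) sv su
            (n₀ ∘ λ f θ → link-sym θ (f θ)) (n₁ ∘ λ f θ → link-sym θ (f θ)) p
            (λ a na θ → proj₂ (ru a na θ)) }

-- First-order definitions of the last generation and of the meet

module Definability (ℓ₀ k K q : ℕ) where
  open Generic ℓ₀ k K q public

  -- A member of generation `suc r` consists of members of generation `r`, so for each `z` at most
  -- one `r` qualifies.
  Top : ∀ {n} (E : Fin n → Fin n → Bool) (z : Fin (Codes (2 ^ q))) → ℕ → Set
  Top E z r = (∃ λ t → Family E z r t) × ¬ (∃ λ t → Family E z (suc r) t)

  Index : ∀ {n} → (Fin n → Fin n → Bool) → Set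
  Index {n} E = Σ (Fin (Codes (2 ^ q))) λ z → Σ (Fin (suc maxRank)) λ r → Σ (Code (toℕ r) n) λ t →
    Top E z (toℕ r) × Family E z (toℕ r) t

  link : ∀ {n} (E : Fin n → Fin n → Bool) → Index E → Fin n → Fin n → Set
  link E (z , r , t , _) = Linked E (sets (toℕ r) E t) z (λ _ → ⊤)

  type : ∀ {n} (E : Fin n → Fin n → Bool) → Index E → Fin n → Fin (2 ^ q)
  type E (z , r , t , _) = ty (sets (toℕ r) E t)

  module Ref {n} (E : Fin n → Fin n → Bool) = Refinement (link E) (type E)
  open Ref public

  d-ty : ∀ {I : Set} {q} {b : Fin q → ∀ G → (I → V G) → Bool} → (∀ i → BDef (b i)) → ∀ a →
    Def (λ G τ → funToFin (λ i → bit (b i G τ)) ≡ a)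
  d-ty {q = q} {b = b} d a = d-map
    (λ G τ → mk⇔
      (λ e → trans (funToFin-cong (λ i → trans (cong bit (e i)) (bit-unbit _))) (Finₚ.funToFin-finToFin {q} {2} a))
      (λ e i → trans (sym (unbit-bit _)) (trans (cong unbit (sym (Finₚ.finToFun-funToFin (λ i → bit (b i G τ)) i)))
        (cong (λ a → unbit (finToFun a i)) e))))
    (d-∀Fin (λ i → d-≡const (d i) (unbit (finToFun a i))))
    where
    bit-unbit : ∀ x → bit (unbit x) ≡ x
    bit-unbit zero = refl
    bit-unbit (suc zero) = refl

  module _ {I : Set} {q} {z : Fin (Codes (2 ^ q))} where

    d-differs : {b : ∀ G → (I → V G) → Bool} {x y : ∀ G → (I → V G) → Fin (2 ^ q)} → BDef b →
      (∀ a → Def (λ G τ → x G τ ≡ a)) → (∀ a → Def (λ G τ → y G τ ≡ a)) →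
      Def (λ G τ → b G τ ≢ decode z (x G τ) (y G τ))
    d-differs {b} {x} {y} db dx dy = d-map
      (λ G τ → mk⇔ (λ { (a , c , refl , refl , ne) → ne }) (λ ne → x G τ , y G τ , refl , refl , ne))
      (d-∃Fin λ a → d-∃Fin λ c → dx a d-× dy c d-× d-¬ (d-≡const db (decode z a c)))

    d-flip : {D : ∀ G → (I → V G) → Fin q → V G → Bool} {X : ∀ G → (I → V G) → V G → Set} (u v : I) →
      (∀ i w → BDef (λ G τ → D G τ i (τ w))) → (∀ w → Def (λ G τ → X G τ (τ w))) →
      Def (λ G τ → Flip (E G) (D G τ) z (X G τ) (τ u) (τ v))
    d-flip u v dD dX = d-map
      (λ G τ → mk⇔ (λ (a , b , c) → flipped a b c) (λ (flipped a b c) → a , b , c))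
      (dX u d-× dX v d-× (d-differs (b-edge u v) (tyD u) (tyD v) d-⊎ d-differs (b-edge v u) (tyD v) (tyD u)))
      where
      tyD : ∀ w a → _
      tyD w = d-ty (λ i → dD i w)

  d-reach : ∀ {I J : Set} {R : ∀ G → (I → V G) → V G → V G → Set} →
    Def {Maybe (Maybe I)} (λ G τ → R G (τ ∘ just ∘ just) (τ (just nothing)) (τ nothing)) →
    ∀ m (f : I → J) (u v : J) → Def {J} (λ G τ → Reach (R G (τ ∘ f)) m (τ u) (τ v))
  d-reach dR zero f u v = d-var u v
  d-reach {J = J} {R} dR (suc m) f u v = d-reach {R = R} dR m f u v d-⊎
    d-∃ {P = λ G w τ → Reach (R G (τ ∘ f)) m (τ u) w × R G (τ ∘ f) w (τ v)}
      (d-reach {R = R} dR m (just ∘ f) (just u) nothing d-×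
       d-ren {P = λ G τ → R G (τ ∘ just ∘ just) (τ (just nothing)) (τ nothing)}
         (maybe (maybe (just ∘ f) nothing) (just v)) dR)

  d-linked : ∀ {I J : Set} {q} {z : Fin (Codes (2 ^ q))} {D : ∀ G → (I → V G) → Fin q → V G → Bool}
    {X : ∀ G → (I → V G) → V G → Set} →
    (∀ {J : Set} (f : I → J) i w → BDef {J} (λ G τ → D G (τ ∘ f) i (τ w))) →
    (∀ {J : Set} (f : I → J) w → Def {J} (λ G τ → X G (τ ∘ f) (τ w))) →
    (f : I → J) (u v : J) → Def {J} (λ G τ → Linked (E G) (D G (τ ∘ f)) z (X G (τ ∘ f)) (τ u) (τ v))
  d-linked {q = q} {z = z} {D} {X} dD dX = d-reach {R = λ G τ → Flip (E G) (D G τ) z (X G τ)}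
    (d-flip {D = λ G τ → D G (τ ∘ just ∘ just)} {X = λ G τ → X G (τ ∘ just ∘ just)} (just nothing) nothing
      (dD (just ∘ just)) (dX (just ∘ just))) (dist q)

  -- Definability under all renamings allows a component, which is a set with further parameters, to
  -- be passed on in the recursion of `d-shallow`.
  DefSet : ∀ {I : Set} → (∀ G → (I → V G) → V G → Set) → Set₁
  DefSet {I} X = ∀ {J : Set} (f : I → J) w → Def {J} (λ G τ → X G (τ ∘ f) (τ w))

  d-twins : ∀ {I J : Set} {X : ∀ G → (I → V G) → V G → Set} → DefSet X → (f : I → J) (u v : J) →
    Def {J} (λ G τ → Twins (E G) (X G (τ ∘ f)) (τ u) (τ v))
  d-twins {X = X} dX f u v = d-∀ {P = λ G w τ → X G (τ ∘ f) w → w ≢ τ u → w ≢ τ v → E G (τ u) w ≡ E G (τ v) w}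
    (dX (just ∘ f) nothing d-→ d-¬ (d-var nothing (just u)) d-→ d-¬ (d-var nothing (just v)) d-→
     d-≡ (b-edge (just u) nothing) (b-edge (just v) nothing))

  d-shallow : ∀ ℓ k {I J : Set} {X : ∀ G → (I → V G) → V G → Set} → DefSet X → (f : I → J) →
    Def {J} (λ G τ → Shallow (E G) ℓ k (X G (τ ∘ f)))
  d-shallow ℓ zero {X = X} dX f =
    d-∃T ℓ {λ G s τ → ∀ u → X G (τ ∘ f) u → ∃ λ i → X G (τ ∘ f) (s i) × Twins (E G) (X G (τ ∘ f)) u (s i)}
      (d-∀ {P = λ G u τ → X G (τ ∘ inj₂ ∘ f) u →
             ∃ λ i → X G (τ ∘ inj₂ ∘ f) (τ (inj₁ i)) × Twins (E G) (X G (τ ∘ inj₂ ∘ f)) u (τ (inj₁ i))}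
        (dX (just ∘ inj₂ ∘ f) nothing d-→
         d-∃Fin (λ i → dX (just ∘ inj₂ ∘ f) (just (inj₁ i)) d-×
                        d-twins {X = X} dX (just ∘ inj₂ ∘ f) nothing (just (inj₁ i)))))
  d-shallow ℓ (suc k) {I} {J} {X} dX f =
    d-∃T (samples ℓ) {λ G s τ → ∃ λ z → ∀ u → X G (τ ∘ f) u →
        Shallow (E G) (grow ℓ) k (Linked (E G) (λ i → E G (s i)) z (X G (τ ∘ f)) u)}
      (d-∃Fin λ z → d-∀ {P = λ G u τ → X G (τ ∘ inj₂ ∘ f) u →
             Shallow (E G) (grow ℓ) k (Linked (E G) (λ i → E G (τ (inj₁ i))) z (X G (τ ∘ inj₂ ∘ f)) u)}
        (dX (just ∘ inj₂ ∘ f) nothing d-→ d-shallow (grow ℓ) k {X = comp z} (component z) id))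
    where
    comp : Fin (Codes (2 ^ samples ℓ)) → ∀ G → (Maybe (Fin (samples ℓ) ⊎ J) → V G) → V G → Set
    comp z G τ v = Linked (E G) (λ i → E G (τ (just (inj₁ i)))) z (X G (τ ∘ just ∘ inj₂ ∘ f)) (τ nothing) v
    component : ∀ z → DefSet (comp z)
    component z g w = d-linked {D = λ G τ i → E G (τ (just (inj₁ i)))} {X = λ G τ → X G (τ ∘ just ∘ inj₂ ∘ f)}
      (λ g i w → b-edge (g (just (inj₁ i))) w) (λ g w → dX (g ∘ just ∘ inj₂ ∘ f) w) g (g nothing) w

  b-sets : ∀ r {I : Set} (t : Fin (codeSize r) → I) i v → BDef (λ G τ → sets r (E G) (τ ∘ t) i (τ v))
  b-sets zero t i v = b-edge (t i) v
  b-sets (suc r) t i v = b-∨ (b-∧ (at zero) (at (suc zero)))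
    (b-∨ (b-∧ (at (suc zero)) (at (suc (suc zero)))) (b-∧ (at zero) (at (suc (suc zero)))))
    where
    at : ∀ j → BDef (λ G τ → sets r (E G) (slice (τ ∘ t) j) i (τ v))
    at j = b-sets r (slice t j) i v

  d-true : ∀ {I : Set} → Def {I} (λ _ _ → ⊤)
  d-true = d-const (yes tt)

  d-component : ∀ r z {I : Set} (t : Fin (codeSize r) → I) (u v : I) →
    Def (λ G τ → Linked (E G) (sets r (E G) (τ ∘ t)) z (λ _ → ⊤) (τ u) (τ v))
  d-component r z t = d-linked {D = λ G τ → sets r (E G) τ} {X = λ _ _ _ → ⊤} (λ f i w → b-sets r f i w) (λ _ _ → d-true) t

  d-family : ∀ z r {I : Set} (t : Fin (codeSize r) → I) → Def (λ G τ → Family (E G) z r (τ ∘ t))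
  d-family z zero t = d-∀ {P = λ G u τ → Shallow (E G) (grow ℓ₀) k (Linked (E G) (sets zero (E G) (τ ∘ t)) z (λ _ → ⊤) u)}
    (d-shallow (grow ℓ₀) k {X = λ G τ → Linked (E G) (sets zero (E G) (τ ∘ just ∘ t)) z (λ _ → ⊤) (τ nothing)}
      (λ f w → d-component zero z (f ∘ just ∘ t) (f nothing) w) id)
  d-family z (suc r) t = d-∀Fin (λ j → d-family z r (slice t j)) d-×
    d-∀Fin (λ j → d-∀Fin λ j' → d-const (¬? (j Fin.≟ j')) d-→
      d-∃Fin λ i → d-∃ {P = λ G v τ → sets r (E G) (slice (τ ∘ t) j) i v ≢ sets r (E G) (slice (τ ∘ t) j') i v}
        (d-¬ (d-≡ (b-sets r (just ∘ slice t j) i nothing) (b-sets r (just ∘ slice t j') i nothing)))) d-×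
    d-∀Fin (λ i → d-∀ {P = λ G v τ → AtMostOne (λ j → sets r (E G) (slice (τ ∘ t) j) i v ≡ sets (suc r) (E G) (τ ∘ t) i v)}
      (d-∀Fin λ j → d-∀Fin λ j' → d-const (¬? (j Fin.≟ j')) d-→
        (d-≡ (b-sets r (just ∘ slice t j) i nothing) (b-sets (suc r) (just ∘ t) i nothing) d-⊎
         d-≡ (b-sets r (just ∘ slice t j') i nothing) (b-sets (suc r) (just ∘ t) i nothing))))

  d-top : ∀ z r {I : Set} → Def {I} (λ G τ → Top (E G) z r)
  d-top z r = d-∃T (codeSize r) {λ G t τ → Family (E G) z r t} (d-family z r inj₁) d-×
    d-¬ (d-∃T (codeSize (suc r)) {λ G t τ → Family (E G) z (suc r) t} (d-family z (suc r) inj₁))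

  -- `z` and `r` range over fixed finite sets and become conjunctions; only `t` is quantified in the
  -- graph, relative to `Top` and `Family`.
  d-∀Index : ∀ {I : Set} {Q : ∀ z r G → Code r (size G) → (I → V G) → Set} →
    (∀ z r → Def {Fin (codeSize r) ⊎ I} (λ G τ → Q z r G (τ ∘ inj₁) (τ ∘ inj₂))) →
    Def {I} (λ G τ → ((z , r , t , _) : Index (E G)) → Q z (toℕ r) G t τ)
  d-∀Index {Q = Q} d = d-map (λ G τ → mk⇔ (λ h (z , r , t , top , F) → h z r top t F) (λ h z r top t F → h (z , r , t , top , F)))
    (d-∀Fin λ z → d-∀Fin {P = λ r G τ → Top (E G) z (toℕ r) → ∀ t → Family (E G) z (toℕ r) t → Q z (toℕ r) G t τ}
      λ r → d-top z (toℕ r) d-→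
        d-∀T (codeSize (toℕ r)) {λ G t τ → Family (E G) z (toℕ r) t → Q z (toℕ r) G t τ}
          (d-family z (toℕ r) inj₁ d-→ d z (toℕ r)))

  d-all-linked : ∀ {I : Set} (u v : I) → Def (λ G τ → All-linked (E G) (τ u) (τ v))
  d-all-linked u v = d-∀Index {Q = λ z r G t τ → Linked (E G) (sets r (E G) t) z (λ _ → ⊤) (τ u) (τ v)}
    (λ z r → d-component r z inj₁ (inj₂ u) (inj₂ v))

  d-same-type : ∀ {I : Set} (u v : I) → Def (λ G τ → Same-type (E G) (τ u) (τ v))
  d-same-type u v = d-∀Index {Q = λ z r G t τ → ty (sets r (E G) t) (τ u) ≡ ty (sets r (E G) t) (τ v)}
    (λ z r → d-map (λ G τ → let D = sets r (E G) (τ ∘ inj₁) in mk⇔ (ty-≡ {D = D} {D' = D}) (ty-≡⁻ {D = D}))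
      (d-∀Fin λ i → d-≡ (b-sets r inj₁ i (inj₂ u)) (b-sets r inj₁ i (inj₂ v))))

  d-narrow : ∀ {I : Set} (a : I) → Def (λ G τ → Narrow (E G) (τ a))
  d-narrow a = d-∀ {P = λ G x τ → ∀ y → Same-type (E G) (τ a) x → Same-type (E G) (τ a) y →
      All-linked (E G) (τ a) x ⊎ All-linked (E G) (τ a) y ⊎ All-linked (E G) x y}
    (d-∀ {P = λ G y τ → Same-type (E G) (τ (just a)) (τ nothing) → Same-type (E G) (τ (just a)) y →
      All-linked (E G) (τ (just a)) (τ nothing) ⊎ All-linked (E G) (τ (just a)) y ⊎ All-linked (E G) (τ nothing) y}
      (d-same-type (just (just a)) (just nothing) d-→ d-same-type (just (just a)) nothing d-→
        (d-all-linked (just (just a)) (just nothing) d-⊎ d-all-linked (just (just a)) nothing d-⊎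
         d-all-linked (just nothing) nothing)))

  d-refined : ∀ {I : Set} (u v : I) → Def (λ G τ → Refined (E G) (τ u) (τ v))
  d-refined u v = d-same-type u v d-×
    d-∀ {P = λ G a τ → Narrow (E G) a → ∀ θ → (link (E G) θ (τ u) a → link (E G) θ (τ v) a) ×
                                            (link (E G) θ (τ v) a → link (E G) θ (τ u) a)}
      (d-narrow nothing d-→
        d-∀Index {Q = λ z r G t τ → let L = Linked (E G) (sets r (E G) t) z (λ _ → ⊤) in
            (L (τ (just u)) (τ nothing) → L (τ (just v)) (τ nothing)) ×
            (L (τ (just v)) (τ nothing) → L (τ (just u)) (τ nothing))}
          (λ z r → d-⇔ (d-component r z inj₁ (inj₂ (just u)) (inj₂ nothing))
                        (d-component r z inj₁ (inj₂ (just v)) (inj₂ nothing))))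

-- Uniform bounds on labels and parts

module Canonical (ℓ₀ k K q : ℕ) where
  open Definability ℓ₀ k K q public

  -- The rank of the last generation depends on the graph and on `z`, so the labels of all ranks are
  -- added up.
  totalLabels : ℕ → ℕ
  totalLabels zero = partLabels zero
  totalLabels (suc r) = partLabels (suc r) + totalLabels r

  raise : ∀ {n} {E : Fin n → Fin n → Bool} {r} R {j X} → r ≤ R → Mod E (partLabels r) j X → Mod E (totalLabels R) j X
  raise zero z≤n M = M
  raise {r = r} (suc R) {j} le M with r ℕ.≟ suc R
  ... | yes refl = enlargeˡ (totalLabels R) j M
  ... | no ne = enlargeʳ (partLabels (suc R)) j (raise R (ℕₚ.≤-pred (ℕₚ.≤∧≢⇒< le ne)) M)

  -- One type for each flip code, rank and entry of the cover; `linkings` has one bit for each of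
  -- these and each of two representatives.
  profiles : ℕ
  profiles = (((2 ^ q) ^ topSize) ^ suc maxRank) ^ Codes (2 ^ q)

  linkings : ℕ
  linkings = (((2 ^ topSize) ^ suc maxRank) ^ Codes (2 ^ q)) ^ 2

  colours : ℕ
  colours = profiles * linkings ^ profiles

  module _ (G : Graph) (M₀ : Mod (E G) ℓ₀ K (λ _ → ⊤)) where

    private
      n = size G

      -- Abstract to keep the formulas folded.
      abstract
        family? : ∀ z r t → Dec (Family (E G) z r t)
        family? z r t = dec (d-family z r {I = V G} t) G id

        family-ext : ∀ z r {t t'} → t ≗ t' → Family (E G) z r t → Family (E G) z r t'
        family-ext z r {t} {t'} e = ext (d-family z r {I = Fin (codeSize r)} id) G {t} {t'} e

        top? : ∀ z r → Dec (Top (E G) z r)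
        top? z r = dec (d-top z r {I = ⊥}) G (λ ())

        all-linked? : ∀ u v → Dec (All-linked (E G) u v)
        all-linked? u v = dec (d-all-linked {I = V G} u v) G id

        same-type? : ∀ u v → Dec (Same-type (E G) u v)
        same-type? u v = dec (d-same-type {I = V G} u v) G id

        narrow? : ∀ a → Dec (Narrow (E G) a)
        narrow? a = dec (d-narrow {I = V G} a) G id

    mkIndex : ∀ {z} r → r < suc maxRank → (Σ (Code r n) λ t → Top (E G) z r × Family (E G) z r t) → Index (E G)
    mkIndex {z} r lt w = z , fromℕ< lt ,
      subst (λ r → Σ (Code r n) λ t → Top (E G) z r × Family (E G) z r t) (sym (Finₚ.toℕ-fromℕ< lt)) w

    -- Climbs until the next generation is empty, which happens by `no-family`. Some index must
    -- exist: over an empty `Index` all vertices would be linked, and no part would have become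
    -- shallower.
    top-index : ∀ {z} fuel r t → r + fuel ≡ maxRank → Family (E G) z r t → Index (E G)
    top-index {z} fuel r t e F with anyFun? (family-ext z (suc r)) (family? z (suc r))
    ... | no none = mkIndex r (s≤s (ℕₚ.≤-trans (ℕₚ.m≤m+n r fuel) (ℕₚ.≤-reflexive e))) (t , ((t , F) , none) , F)
    top-index {z} zero r t e F | yes (t' , F') = contradiction
      (subst (λ r → Σ (Code (suc r) n) (Family (E G) z (suc r))) (trans (sym (ℕₚ.+-identityʳ r)) e) (t' , F'))
      (λ (t , F) → no-family (E-sym G) (E-irr G) M₀ z t F)
    top-index {z} (suc fuel) r t e F | yes (t' , F') = top-index fuel (suc r) t' (trans (sym (ℕₚ.+-suc r fuel)) e) F'

    part : Index (E G) → ∀ u → Mod (E G) (totalLabels maxRank) (suc k) (All-linked (E G) u)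
    part θ@(z , r , t , _ , F) u = hered (suc k) (λ l → l θ)
      (raise maxRank (ℕₚ.≤-pred (Finₚ.toℕ<n r)) (family⇒Mod (E-sym G) (E-irr G) M₀ z (toℕ r) t F u))

    private
      link? : ∀ θ u v → Dec (link (E G) θ u v)
      link? (z , r , t , _) = linked? (λ _ → yes tt)

    link-sym : ∀ θ {u v} → link (E G) θ u v → link (E G) θ v u
    link-sym (z , r , t , _) = linked-sym M₀

    link-trans : ∀ θ {u v w} → link (E G) θ u v → link (E G) θ v w → link (E G) θ u w
    link-trans (z , r , t , _) = linked-trans M₀

    link-refl : ∀ θ u → link (E G) θ u u
    link-refl (z , r , t , _) = linked-refl

    homogeneous : ∀ {u₀ u₁ v₀ v₁} → Refined (E G) u₀ u₁ → Refined (E G) v₀ v₁ →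
      ¬ All-linked (E G) u₀ v₀ → ¬ All-linked (E G) u₁ v₁ → E G u₀ v₀ ≡ E G u₁ v₁
    homogeneous = Meet.refined-homogeneous (E-sym G) (link (E G)) link? link-sym link-trans (type (E G))
      (λ (z , _) → decode z) (λ { (z , r , t , _) nl → unlinked M₀ tt tt nl })

    module Colouring (default : V G) where

      Covers : ∀ z r → (Fin topSize → Code r n) → Set
      Covers z r ts = Top (E G) z r → ∀ t → Family (E G) z r t → ∃ λ j → ∀ i v → sets r (E G) t i v ≡ sets r (E G) (ts j) i v

      codes : ∀ z r → Σ (Fin topSize → Code r n) (Covers z r)
      codes z r with top? z r
      ... | no nt = (λ _ _ → default) , λ top → contradiction top nt
      ... | yes (_ , none) = let ts , cov = cover (E-sym G) (E-irr G) M₀ z (family-ext z) (family? z) r (λ _ → default) none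
                             in ts , λ _ → cov

      D : ∀ z (r : Fin (suc maxRank)) → Fin topSize → Fin q → V G → Bool
      D z r j = sets (toℕ r) (E G) (proj₁ (codes z (toℕ r)) j)

      representative : ∀ ((z , r , t , _) : Index (E G)) → ∃ λ j → ∀ i v → sets (toℕ r) (E G) t i v ≡ D z r j i v
      representative (z , r , t , top , F) = proj₂ (codes z (toℕ r)) top t F

      abstract
        table : ∀ {m} → (Fin (Codes (2 ^ q)) → Fin (suc maxRank) → Fin topSize → Fin m) →
          Fin (((m ^ topSize) ^ suc maxRank) ^ Codes (2 ^ q))
        table f = funToFin (λ z → funToFin (λ r → funToFin (f z r)))

        table-injective : ∀ {m} {f g : Fin (Codes (2 ^ q)) → Fin (suc maxRank) → Fin topSize → Fin m} →
          table f ≡ table g → ∀ z r j → f z r j ≡ g z r j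
        table-injective {f = f} {g} e z r j = funToFin-injective {f = f z r} {g = g z r}
          (funToFin-injective {f = λ r → funToFin (f z r)} {g = λ r → funToFin (g z r)}
            (funToFin-injective {f = λ z → funToFin (λ r → funToFin (f z r))} {g = λ z → funToFin (λ r → funToFin (g z r))} e z) r) j

      profile : V G → Fin profiles
      profile u = table (λ z r j → ty (D z r j) u)

      profile⇒same-type : ∀ {u v} → profile u ≡ profile v → Same-type (E G) u v
      profile⇒same-type {u} {v} e θ@(z , r , t , _) =
        let j , same = representative θ in
        trans (ty-≡ {D = sets (toℕ r) (E G) t} {D' = D z r j} (λ i → same i u))
          (trans (table-injective e z r j) (sym (ty-≡ {D = sets (toℕ r) (E G) t} {D' = D z r j} (λ i → same i v))))

      -- A narrow type meets at most two classes of All-linked; both are represented.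
      module First κ = Pick (λ a → (profile a Fin.≟ κ) ×-dec narrow? a) default
      module Second κ = Pick (λ b → same-type? (First.pick κ) b ×-dec ¬? (all-linked? (First.pick κ) b)) (First.pick κ)

      rep : Fin profiles → Fin 2 → V G
      rep κ zero = First.pick κ
      rep κ (suc zero) = Second.pick κ

      rep-spec : ∀ a → Narrow (E G) a → ∃ λ i → All-linked (E G) (rep (profile a) i) a
      rep-spec a na =
        let κ = profile a
            pe , n₁ = First.pick-spec κ (a , refl , na)
        in case all-linked? (First.pick κ) a of λ
          { (yes l) → zero , l
          ; (no nl) → let s₂ , nl₂ = Second.pick-spec κ (a , profile⇒same-type pe , nl) in
              case n₁ (Second.pick κ) a s₂ (profile⇒same-type pe) of λ
                { (inj₁ l) → contradiction l nl₂
                ; (inj₂ (inj₁ l)) → contradiction l nl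
                ; (inj₂ (inj₂ l)) → suc zero , l } }

      linkedTo : V G → V G → Fin (Codes (2 ^ q)) → Fin (suc maxRank) → Fin topSize → Fin 2
      linkedTo u b z r j = bit ⌊ linked? {E = E G} {D = D z r j} {z = z} {X = λ _ → ⊤} (λ _ → yes tt) u b ⌋

      linking : V G → Fin profiles → Fin linkings
      linking u κ = funToFin (λ i → table (linkedTo u (rep κ i)))

      colour : V G → Fin colours
      colour u = combine (profile u) (funToFin (linking u))

      linked-cong : ∀ {z : Fin (Codes (2 ^ q))} {D D' : Fin q → V G → Bool} {u v} → (∀ i w → D i w ≡ D' i w) → Linked (E G) D z (λ _ → ⊤) u v →
        Linked (E G) D' z (λ _ → ⊤) u v
      linked-cong {z} {D} {D'} e = reach-map (dist q)
        where
        flip-cong : ∀ {u v} → Flip (E G) D z (λ _ → ⊤) u v → Flip (E G) D' z (λ _ → ⊤) u v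
        flip-cong {u} {v} (flipped _ _ d) = flipped tt tt
          (subst₂ (λ a b → E G u v ≢ decode z a b ⊎ E G v u ≢ decode z b a)
            (ty-≡ {D = D} {D' = D'} (λ i → e i u)) (ty-≡ {D = D} {D' = D'} (λ i → e i v)) d)
        reach-map : ∀ m {u v} → Reach (Flip (E G) D z (λ _ → ⊤)) m u v → Reach (Flip (E G) D' z (λ _ → ⊤)) m u v
        reach-map zero r = r
        reach-map (suc m) (inj₁ r) = inj₁ (reach-map m r)
        reach-map (suc m) (inj₂ (w , r , x)) = inj₂ (w , reach-map m r , flip-cong x)

      -- `a` may be replaced by a representative linked to it by all indices, and `θ` by an entry of
      -- the cover; the bit for this pair is part of the colour.
      colour⇒link : ∀ {u v} → colour u ≡ colour v → ∀ a → Narrow (E G) a → ∀ θ → link (E G) θ u a → link (E G) θ v a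
      colour⇒link {u} {v} e a na θ@(z , r , t , _) l =
        let i , la = rep-spec a na
            j , same = representative θ
            b = rep (profile a) i
            bits = table-injective {f = linkedTo u b} {g = linkedTo v b}
              (funToFin-injective {f = λ i → table (linkedTo u (rep (profile a) i))} {g = λ i → table (linkedTo v (rep (profile a) i))}
                (funToFin-injective {f = linking u} {g = linking v}
                  (Finₚ.combine-injectiveʳ {profiles} (profile u) _ (profile v) _ e) (profile a)) i) z r j
            u~b = linked-cong same (link-trans θ l (link-sym θ (la θ)))
            v~b = true-⌊⌋ (linked? (λ _ → yes tt) v b)
                    (trans (sym (bit-injective bits)) (⌊⌋-true (linked? (λ _ → yes tt) u b) u~b))
        in link-trans θ (linked-cong (λ i w → sym (same i w)) v~b) (la θ)

      colour⇒refined : ∀ {u v} → colour u ≡ colour v → Refined (E G) u v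
      colour⇒refined {u} {v} e = profile⇒same-type (Finₚ.combine-injectiveˡ {profiles} (profile u) _ (profile v) _ e) ,
        λ a na θ → colour⇒link e a na θ , colour⇒link (sym e) a na θ

-- Assembling the theorem

pull-edge : ∀ G {m} (f : Fin m → V G) {i j} → i ≢ j → E (pull G f) i j ≡ E G (f i) (f j)
pull-edge G f {i} {j} ne with i Fin.≟ j
... | yes e = contradiction e ne
... | no _ = refl

Conclusion : GraphClass → ℕ → Set₁
Conclusion C d = Σ GraphClass λ C' → Hereditary C' × ShrubDepth≤ d C' ×
    Σ ℕ λ m → Σ (Formula₂ m) λ φ → Σ (Formula₂ m) λ lam →
    Finitary φ C × Finitary lam C × DefinesPartition φ × DefinesPartition lam ×
    Σ ℕ λ ℓ → ∀ (G : Graph) → C G → Σ (Fin m → V G) λ s →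
    (IsDicing G (defRel φ G s) (defRel lam G s) × PartsAtMost G (defRel lam G s) ℓ) ×
    (∀ (u : V G) {k : ℕ} (f : Fin k → V G) → Injective _≡_ _≡_ f →
    EnumeratesPart G (defRel φ G s) u f → C' (pull G f))

-- The formulas have no parameters: the class may contain the empty graph, which has none to offer.
module Conclude (C : GraphClass) (ℓ k B : ℕ)
  (P L : (G : Graph) → V G → V G → Set)
  (d-P : ∀ {I : Set} (u v : I) → Def (λ G τ → P G (τ u) (τ v)))
  (d-L : ∀ {I : Set} (u v : I) → Def (λ G τ → L G (τ u) (τ v)))
  (P-equivalence : ∀ G → IsEquivalence (P G)) (L-equivalence : ∀ G → IsEquivalence (L G))
  (homogeneous : ∀ G → C G → ∀ {u u' v v'} → L G u u' → L G v v' → ¬ P G u v → ¬ P G u' v' → E G u v ≡ E G u' v')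
  (parts : ∀ G → C G → ∀ u → Mod (E G) ℓ k (P G u))
  (colour : ∀ G → C G → V G → Fin B)
  (colour⇒L : ∀ G (c : C G) {u v} → colour G c u ≡ colour G c v → L G u v) where

  private
    module Defined (R : (G : Graph) → V G → V G → Set) (d : Def {Fin 2} (λ G τ → R G (τ zero) (τ (suc zero)))) where

      formula : Formula₂ 0
      formula = fm d id

      formula-⇔ : ∀ G b u v → defRel formula G b u v ≡ true ⇔ R G u v
      formula-⇔ G b u v = ok d id G (extend u (extend v b)) _ (λ _ → refl)

      partition : (∀ G → IsEquivalence (R G)) → DefinesPartition formula
      partition eq G b = record
        { refl = Equivalence.from (formula-⇔ G b _ _) (IsEquivalence.refl (eq G))
        ; sym = λ {u} {v} r → Equivalence.from (formula-⇔ G b v u)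
            (IsEquivalence.sym (eq G) (Equivalence.to (formula-⇔ G b u v) r))
        ; trans = λ {u} {v} {w} r s → Equivalence.from (formula-⇔ G b u w)
            (IsEquivalence.trans (eq G) (Equivalence.to (formula-⇔ G b u v) r) (Equivalence.to (formula-⇔ G b v w) s)) }

      finitary : Finitary formula C
      finitary = 1 , λ G _ bs → zero , suc zero , (λ ()) , λ u v →
        ⇔⇒≡ (Equivalence.from (formula-⇔ G (bs (suc zero)) u v) ∘ Equivalence.to (formula-⇔ G (bs zero) u v))
            (Equivalence.from (formula-⇔ G (bs zero) u v) ∘ Equivalence.to (formula-⇔ G (bs (suc zero)) u v))
        where
        ⇔⇒≡ : ∀ {a b} → (a ≡ true → b ≡ true) → (b ≡ true → a ≡ true) → a ≡ b
        ⇔⇒≡ {true} f g = sym (f refl)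
        ⇔⇒≡ {false} {true} f g = g refl
        ⇔⇒≡ {false} {false} f g = refl

    module φ = Defined P (d-P zero (suc zero))
    module lam = Defined L (d-L zero (suc zero))

    ModClass : GraphClass
    ModClass H = Mod (E H) ℓ k (λ _ → ⊤)

    restrict : ∀ G {m} (f : Fin m → V G) → Injective _≡_ _≡_ f → ∀ {X} → (∀ i → X (f i)) → Mod (E G) ℓ k X → ModClass (pull G f)
    restrict G f inj inX = pullback f inj (pull-edge G f) k (λ _ → yes tt) (λ {i} _ → inX i)

    isDicing : ∀ G → C G → ∀ b → IsDicing G (defRel φ.formula G b) (defRel lam.formula G b)
    isDicing G c b = (λ u v → ⌊ W? u v ⌋) ,
      (λ u v → ⌊⌋-⇔ (W? u v) (W? v u) W-sym W-sym) ,
      (λ u u' v v' l l' → let lu = Equivalence.to (lam.formula-⇔ G b u u') l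
                              lv = Equivalence.to (lam.formula-⇔ G b v v') l' in
        ⌊⌋-⇔ (W? u v) (W? u' v') (W-resp (L.sym lu) (L.sym lv)) (W-resp lu lv)) ,
      λ u v e → agree (λ p → contradiction (trans (sym e) (Equivalence.from (φ.formula-⇔ G b u v) p)) λ ())
      where
      module L = IsEquivalence (L-equivalence G)
      module P = IsEquivalence (P-equivalence G)
      -- Invariance under `L` is enforced by asking for an adjacent pair in different `P`-parts
      -- anywhere in the two `L`-classes; by homogeneity one such pair speaks for all.
      W : V G → V G → Set
      W u v = ∃ λ u' → ∃ λ v' → L G u u' × L G v v' × ¬ P G u' v' × E G u' v' ≡ true
      W? : ∀ u v → Dec (W u v)
      W? u v = Finₚ.any? λ u' → Finₚ.any? λ v' → dec (d-L {V G} u u') G id ×-dec dec (d-L {V G} v v') G id ×-dec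
        ¬? (dec (d-P {V G} u' v') G id) ×-dec (E G u' v' Bool.≟ true)
      W-sym : ∀ {u v} → W u v → W v u
      W-sym (u' , v' , lu , lv , np , e) = v' , u' , lv , lu , (np ∘ P.sym) , trans (E-sym G v' u') e
      W-resp : ∀ {u u' v v'} → L G u u' → L G v v' → W u' v' → W u v
      W-resp lu lv (x , y , lx , ly , r) = x , y , L.trans lu lx , L.trans lv ly , r
      agree : ∀ {u v} → ¬ P G u v → E G u v ≡ ⌊ W? u v ⌋
      agree {u} {v} np with W? u v
      ... | yes (u' , v' , lu , lv , np' , e) = trans (homogeneous G c lu lv np np') e
      ... | no none with E G u v in eq
      ...   | true = contradiction (u , v , L.refl , L.refl , np , eq) none
      ...   | false = refl

    partsAtMost : ∀ G → C G → ∀ b → PartsAtMost G (defRel lam.formula G b) B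
    partsAtMost G c b ws with Finₚ.pigeonhole (ℕₚ.n<1+n B) (colour G c ∘ ws)
    ... | i , j , i<j , e = i , j , Finₚ.<⇒≢ i<j , Equivalence.from (lam.formula-⇔ G b (ws i) (ws j)) (colour⇒L G c e)

  conclusion : Conclusion C (suc k)
  conclusion = ModClass ,
    (λ G f inj M → restrict G f inj (λ _ → tt) M) ,
    (pathLabels ℓ k , λ G M → Mod⇒model k G M) ,
    0 , φ.formula , lam.formula ,
    φ.finitary , lam.finitary , φ.partition P-equivalence , lam.partition L-equivalence ,
    B , λ G c → (λ ()) , (isDicing G c (λ ()) , partsAtMost G c (λ ())) ,
      λ u f inj en → restrict G f inj (λ i → Equivalence.to (φ.formula-⇔ G (λ ()) u (f i)) (proj₂ (en (f i)) i)) (parts G c u)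

-- Depth 1 admits only single vertices as parts, so types must decide every adjacency. Equal labels
-- make twins because each child of the root has at most one vertex.
depth-two : ∀ C L → (∀ G → C G → ConnectionModel L 2 G) → Conclusion C 1
depth-two C ℓ model = Conclude.conclusion C ℓ 0 ℓ (λ _ → _≡_) (λ G → Twins (E G) (λ _ → ⊤))
  d-var (λ u v → d-twins {I = ⊥} {X = λ _ _ _ → ⊤} (λ _ _ → d-true) (λ ()) u v)
  (λ _ → isEquivalence)
  (λ G → record { refl = twins-refl {E = E G} {X = λ _ → ⊤} _ ; sym = twins-sym {E = E G} {X = λ _ → ⊤}
                 ; trans = twins-trans {X = λ _ → ⊤} (E-sym G) tt tt tt })
  (λ G _ t t' ne ne' → twins-adj (E-sym G) tt tt tt tt t t' ne ne')
  (λ G _ u v w e e' → trans (sym e) e')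
  (λ G c → lab (model⇒Mod G (model G c)))
  (λ G c e → same-label⇒twins (model⇒Mod G (model G c)) tt tt e)
  where open Definability 0 0 0 0

module _ (C : GraphClass) (ℓ₀ k : ℕ) (model : ∀ G → C G → ConnectionModel ℓ₀ (suc (suc (suc k))) G) where

  private
    open Canonical ℓ₀ k (suc (suc k)) (samples ℓ₀)

    M₀ : ∀ G → C G → Mod (E G) ℓ₀ (suc (suc k)) (λ _ → ⊤)
    M₀ G c = model⇒Mod G (model G c)

    index : ∀ G → C G → V G → Index (E G)
    -- `Shallow` at level `suc k` for the whole graph unfolds to generation 0 of `Family`, with the
    -- samples as parameters; hence the choice `q = samples ℓ₀`.
    index G c v = let s , z , F = Mod⇒shallow (E-sym G) (M₀ G c) ℓ₀ (suc k) (λ _ → yes tt) v (M₀ G c)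
                  in top-index G (M₀ G c) {z = z} maxRank 0 s refl (λ u → F u tt)

    -- All-linked is an equivalence on the members of C only; P is one on every graph.
    P : (G : Graph) → V G → V G → Set
    P G u v = ∀ w → (All-linked (E G) u w → All-linked (E G) v w) × (All-linked (E G) v w → All-linked (E G) u w)

    P-equivalence : ∀ G → IsEquivalence (P G)
    P-equivalence G = record
      { refl = λ _ → id , id
      ; sym = λ p w → proj₂ (p w) , proj₁ (p w)
      ; trans = λ p r w → (proj₁ (r w) ∘ proj₁ (p w)) , (proj₂ (p w) ∘ proj₂ (r w)) }

    P⇒linked : ∀ G → C G → ∀ {u v} → P G u v → All-linked (E G) u v
    P⇒linked G c {v = v} p = proj₂ (p v) (λ θ → link-refl G (M₀ G c) θ v)

    linked⇒P : ∀ G → C G → ∀ {u v} → All-linked (E G) u v → P G u v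
    linked⇒P G c l w = (λ m θ → link-trans G (M₀ G c) θ (link-sym G (M₀ G c) θ (l θ)) (m θ)) ,
                       (λ m θ → link-trans G (M₀ G c) θ (l θ) (m θ))

    d-P : ∀ {I : Set} (u v : I) → Def (λ G τ → P G (τ u) (τ v))
    d-P u v = d-∀ {P = λ G w τ → (All-linked (E G) (τ u) w → All-linked (E G) (τ v) w) ×
                                 (All-linked (E G) (τ v) w → All-linked (E G) (τ u) w)}
      (d-⇔ (d-all-linked (just u) nothing) (d-all-linked (just v) nothing))

    refined-equivalence : ∀ G → IsEquivalence (Refined (E G))
    refined-equivalence G = record
      { refl = (λ _ → refl) , λ _ _ _ → id , id
      ; sym = λ (s , r) → (sym ∘ s) , λ a na θ → proj₂ (r a na θ) , proj₁ (r a na θ)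
      ; trans = λ (s , r) (s' , r') → (λ θ → trans (s θ) (s' θ)) ,
          λ a na θ → (proj₁ (r' a na θ) ∘ proj₁ (r a na θ)) , (proj₂ (r a na θ) ∘ proj₂ (r' a na θ)) }

  depth-three⁺ : Conclusion C (suc (suc k))
  depth-three⁺ = Conclude.conclusion C (totalLabels maxRank) (suc k) colours P (λ G → Refined (E G))
    d-P d-refined P-equivalence refined-equivalence
    (λ G c r r' n n' → homogeneous G (M₀ G c) r r' (n ∘ linked⇒P G c) (n' ∘ linked⇒P G c))
    (λ G c u → hered (suc k) (P⇒linked G c) (part G (M₀ G c) (index G c u) u))
    -- A colouring depends on a default vertex; `anchor` makes it the same for all vertices, so that
    -- colours are comparable.
    (λ G c u → Colouring.colour G (M₀ G c) (anchor u) u)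
    (λ G c {u} {v} e → Colouring.colour⇒refined G (M₀ G c) (anchor u)
      (trans e (cong (λ a → Colouring.colour G (M₀ G c) a v) (anchor-const v u))))
    where
    anchor : ∀ {n} → Fin n → Fin n
    anchor {suc n} _ = zero
    anchor-const : ∀ {n} (u v : Fin n) → anchor u ≡ anchor v
    anchor-const {suc n} _ _ = refl

theorem13 : (C : GraphClass) (d : ℕ) → 1 < d → ShrubDepth≤ d C →
    Σ GraphClass λ C' → Hereditary C' × ShrubDepth≤ (d ∸ 1) C' ×
    Σ ℕ λ m → Σ (Formula₂ m) λ φ → Σ (Formula₂ m) λ lam →
    Finitary φ C × Finitary lam C × DefinesPartition φ × DefinesPartition lam ×
    Σ ℕ λ ℓ → ∀ (G : Graph) → C G → Σ (Fin m → V G) λ s →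
    (IsDicing G (defRel φ G s) (defRel lam G s) × PartsAtMost G (defRel lam G s) ℓ) ×
    (∀ (u : V G) {k : ℕ} (f : Fin k → V G) → Injective _≡_ _≡_ f →
    EnumeratesPart G (defRel φ G s) u f → C' (pull G f))
theorem13 C (suc zero) (s≤s ()) _
theorem13 C (suc (suc zero)) _ (ℓ , model) = depth-two C ℓ model
theorem13 C (suc (suc (suc k))) _ (ℓ , model) = depth-three⁺ C ℓ k model
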